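{- The degree structures $\mathcal D^1_{<\omega}$, $\mathcal D^1_{\omega|<\omega}$, $\mathcal D^{<\omega}_1$, $\mathcal P^1_{<\omega}$, $\mathcal P^1_{\omega|<\omega}$, and $\mathcal P^{<\omega}_1$ are not Brouwerian.
   Context: Let $\{\Phi_e\}_{e\in\mathbb N}$ be an effective enumeration of all partial computable functions $\Phi_e:\subseteq\mathbb N^{\mathbb N}\to\mathbb N^{\mathbb N}$. A learner is a total computable function $\Psi:\mathbb N^{<\mathbb N}\to\mathbb N$. A partial function $\Gamma:\subseteq\mathbb N^{\mathbb N}\to\mathbb N^{\mathbb N}$ is identified by $\Psi$ if for every $g\in\mathrm{dom}(\Gamma)$ the limit $\lim_n\Psi(g\upharpoonright n)$ exists and $\Phi_{\lim_n\Psi(g\upharpoonright n)}(g)=\Gamma(g)$. $\Gamma$ is $(1,<\omega)$-computable if it is identified by a learner $\Psi$ with $\sup_{g\in\mathrm{dom}(\Gamma)}\#\{n:\Psi(g\upharpoonright (n+1))\neq\Psi(g\upharpoonright n)\}<\omega$. $\Gamma$ is $(1,\omega|<\omega)$-computable if it is identified by a learner $\Psi$ with $\sup_{g\in\mathrm{dom}(\Gamma)}\#\{\Psi(g\upharpoonright n):n\in\mathbb N\}<\omega$. $\Gamma$ is $(<\omega,1)$-computable if there is $b\in\mathbb N$ such that for every $g\in\mathrm{dom}(\Gamma)$, $\Gamma(g)=\Phi_e(g)$ for some $e<b$. For each of these notions, written $(\alpha,\beta|\gamma)$ (or $(\alpha,\beta)$), and $A,B\subseteq\mathbb N^{\mathbb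 N}$, $A\le^\alpha_{\beta|\gamma}B$ means there is a partial function $\Gamma$ computable in that sense with $B\subseteq\mathrm{dom}(\Gamma)$ and $\Gamma(g)\in A$ for every $g\in B$. $\mathcal D^\alpha_{\beta|\gamma}$ is the partial order obtained by quotienting the set of all subsets of $\mathbb N^{\mathbb N}$, preordered by $\le^\alpha_{\beta|\gamma}$, by the induced equivalence; $\mathcal P^\alpha_{\beta|\gamma}$ is obtained in the same way from the set of all nonempty $\Pi^0_1$ subsets of $2^{\mathbb N}$. In these structures the join of the degrees of $A$ and $B$ is the degree of $A\otimes B=\{f\oplus g:f\in A,\ g\in B\}$, where $(f\oplus g)(2n)=f(n)$, $(f\oplus g)(2n+1)=g(n)$. Such a structure is Brouwerian if for all elements $p,q$ there is a least element $r$ such that $p\le q\vee r$. -}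

module Defs where

open import Data.List.Base using (List; []; _∷_; length; applyUpTo)
open import Data.List.Membership.Propositional using () renaming (_∈_ to _∈ˡ_)
open import Data.Nat.Base using (ℕ; zero; suc; _+_; _*_; _≤_; _<_)
open import Data.Nat.Properties using (<-cmp; +-comm; +-suc; +-identityʳ; 1+n≢0)
open import Data.Product.Base using (∃; ∃-syntax; _×_; _,_; proj₁; proj₂)
open import Data.Empty using (⊥-elim)
open import Data.Unit.Base using (⊤)
open import Function.Base using (_∘_)
open import Function.Bundles using (_⇔_)
open import Level using (0ℓ) renaming (suc to lsuc)
open import Relation.Binary.Core using (Rel)
open import Relation.Binary.Definitions using (_Respects_; _Respectsˡ_; _Respectsʳ_; tri<; tri≈; tri>)
open import Relation.Binary.PropositionalEquality
  using (_≡_; _≢_; _≗_; refl; sym; trans; cong; cong₂; subst)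
open import Relation.Unary using (Pred; Satisfiable)

------------------------------------------------------------------------
-- Cantor pairing

-- Walk along the antidiagonals (0,0), (1,0), (0,1), (2,0), (1,1), (0,2), …
next : ℕ × ℕ → ℕ × ℕ
next (zero  , y) = suc y , zero
next (suc x , y) = x , suc y

unpair : ℕ → ℕ × ℕ
unpair zero    = zero , zero
unpair (suc n) = next (unpair n)

π₁ π₂ : ℕ → ℕ
π₁ = proj₁ ∘ unpair
π₂ = proj₂ ∘ unpair

triangle : ℕ → ℕ
triangle zero    = zero
triangle (suc n) = suc n + triangle n

⟨_,_⟩ : ℕ → ℕ → ℕ
⟨ x , y ⟩ = y + triangle (x + y)

private
  unpair-shift : ∀ y x z n → unpair n ≡ (y + x , z) → unpair (y + n) ≡ (x , y + z)
  unpair-shift zero    x z n eq = eq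
  unpair-shift (suc y) x z n eq =
    cong next (unpair-shift y (suc x) z n (trans eq (cong (_, z) (sym (+-suc y x)))))

  unpair-triangle : ∀ s → unpair (triangle s) ≡ (s , 0)
  unpair-triangle zero    = refl
  unpair-triangle (suc s) =
    trans (cong next (unpair-shift s 0 0 (triangle s)
             (trans (unpair-triangle s) (cong (_, 0) (sym (+-identityʳ s))))))
          (cong (λ k → suc k , 0) (+-identityʳ s))

unpair-pair : ∀ x y → unpair ⟨ x , y ⟩ ≡ (x , y)
unpair-pair x y =
  trans (unpair-shift y x 0 (triangle (x + y))
           (trans (unpair-triangle (x + y)) (cong (_, 0) (+-comm x y))))
        (cong (x ,_) (+-identityʳ y))

pair-injective : ∀ {x y x′ y′} → ⟨ x , y ⟩ ≡ ⟨ x′ , y′ ⟩ → x ≡ x′ × y ≡ y′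
pair-injective {x} {y} {x′} {y′} eq = cong proj₁ eq′ , cong proj₂ eq′
  where
  eq′ : (x , y) ≡ (x′ , y′)
  eq′ = trans (sym (unpair-pair x y)) (trans (cong unpair eq) (unpair-pair x′ y′))

encodeList : List ℕ → ℕ
encodeList []      = 0
encodeList (x ∷ σ) = suc ⟨ x , encodeList σ ⟩

------------------------------------------------------------------------
-- Baire space

Baire : Set
Baire = ℕ → ℕ

infix 25 _↾_
_↾_ : Baire → ℕ → List ℕ
g ↾ n = applyUpTo g n

infixr 20 _⊕_
_⊕_ : Baire → Baire → Baire
(f ⊕ g) zero    = f zero
(f ⊕ g) (suc n) = (g ⊕ (f ∘ suc)) n

⊕-even : ∀ f g n → (f ⊕ g) (2 * n) ≡ f n
⊕-odd  : ∀ f g n → (f ⊕ g) (suc (2 * n)) ≡ g n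
⊕-even f g zero    = refl
⊕-even f g (suc n) =
  trans (cong (g ⊕ (f ∘ suc)) (+-suc n (n + 0))) (⊕-odd g (f ∘ suc) n)
⊕-odd f g n = ⊕-even g (f ∘ suc) n

-- In the absence of function extensionality, sets of points and partial
-- functions are required to respect pointwise equality.
record Subset : Set₁ where
  field
    mem  : Pred Baire 0ℓ
    resp : mem Respects _≗_

open Subset public using (mem)

infix 4 _∈_
_∈_ : Baire → Subset → Set
f ∈ A = mem A f

infixr 20 _⊗_
_⊗_ : Subset → Subset → Subset
A ⊗ B = record
  { mem  = λ h → ∃[ f ] ∃[ g ] f ∈ A × g ∈ B × h ≗ f ⊕ g
  ; resp = λ { h≗h′ (f , g , f∈A , g∈B , h≗) →
               f , g , f∈A , g∈B , λ n → trans (sym (h≗h′ n)) (h≗ n) }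
  }

-- graph Γ g f means: Γ(g) is defined and equal to f.
record PartialFunction : Set₁ where
  field
    graph      : Rel Baire 0ℓ
    respˡ      : graph Respectsˡ _≗_
    respʳ      : graph Respectsʳ _≗_
    functional : ∀ {g f f′} → graph g f → graph g f′ → f ≗ f′

open PartialFunction public using (graph)

dom : PartialFunction → Pred Baire 0ℓ
dom Γ g = ∃[ f ] graph Γ g f

------------------------------------------------------------------------
-- Computability relative to an oracle

-- Kleene's partial recursive functions relative to an oracle, in unary form
-- with several arguments packed by the pairing function.
data Code : Set where
  zer succ idn left right oracle : Code
  pair comp prec                 : Code → Code → Code
  mini                           : Code → Code

infix 4 _⊢_·_⇓_ _⊢rec_,_·_,_⇓_

mutual

  -- g ⊢ c · x ⇓ v : with oracle g, the program c halts on x with output v.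
  data _⊢_·_⇓_ (g : Baire) : Code → ℕ → ℕ → Set where
    zer    : ∀ {x} → g ⊢ zer · x ⇓ 0
    succ   : ∀ {x} → g ⊢ succ · x ⇓ suc x
    idn    : ∀ {x} → g ⊢ idn · x ⇓ x
    left   : ∀ {x} → g ⊢ left · x ⇓ π₁ x
    right  : ∀ {x} → g ⊢ right · x ⇓ π₂ x
    oracle : ∀ {x} → g ⊢ oracle · x ⇓ g x
    pair   : ∀ {a b x v w} → g ⊢ a · x ⇓ v → g ⊢ b · x ⇓ w →
             g ⊢ pair a b · x ⇓ ⟨ v , w ⟩
    comp   : ∀ {a b x v w} → g ⊢ b · x ⇓ w → g ⊢ a · w ⇓ v →
             g ⊢ comp a b · x ⇓ v
    prec   : ∀ {a b x v} → g ⊢rec a , b · π₁ x , π₂ x ⇓ v →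
             g ⊢ prec a b · x ⇓ v
    -- The least n with a⟨x,n⟩ = 0, where a⟨x,m⟩ halts with value k m + 1
    -- for all m < n (k is irrelevant elsewhere).
    mini   : ∀ {a x n} (k : ℕ → ℕ) →
             (∀ {m} → m < n → g ⊢ a · ⟨ x , m ⟩ ⇓ suc (k m)) →
             g ⊢ a · ⟨ x , n ⟩ ⇓ 0 →
             g ⊢ mini a · x ⇓ n

  -- Primitive recursion: r(x,0) = a(x), r(x,n+1) = b⟨x,⟨n,r(x,n)⟩⟩.
  data _⊢rec_,_·_,_⇓_ (g : Baire) (a b : Code) (x : ℕ) : ℕ → ℕ → Set where
    base : ∀ {v} → g ⊢ a · x ⇓ v → g ⊢rec a , b · x , 0 ⇓ v
    step : ∀ {n v w} → g ⊢rec a , b · x , n ⇓ w →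
           g ⊢ b · ⟨ x , ⟨ n , w ⟩ ⟩ ⇓ v → g ⊢rec a , b · x , suc n ⇓ v

mutual

  ⇓-functional : ∀ {g c x v w} → g ⊢ c · x ⇓ v → g ⊢ c · x ⇓ w → v ≡ w
  ⇓-functional zer zer = refl
  ⇓-functional succ succ = refl
  ⇓-functional idn idn = refl
  ⇓-functional left left = refl
  ⇓-functional right right = refl
  ⇓-functional oracle oracle = refl
  ⇓-functional (pair p q) (pair p′ q′) =
    cong₂ ⟨_,_⟩ (⇓-functional p p′) (⇓-functional q q′)
  ⇓-functional (comp p q) (comp p′ q′) with ⇓-functional p p′
  ... | refl = ⇓-functional q q′
  ⇓-functional (prec p) (prec p′) = rec-functional p p′
  ⇓-functional (mini {n = n} k h z) (mini {n = n′} k′ h′ z′) with <-cmp n n′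
  ... | tri< n<n′ _ _ = ⊥-elim (1+n≢0 (sym (⇓-functional z (h′ n<n′))))
  ... | tri≈ _ eq _   = eq
  ... | tri> _ _ n′<n = ⊥-elim (1+n≢0 (⇓-functional (h n′<n) z′))

  rec-functional : ∀ {g a b x n v w} → g ⊢rec a , b · x , n ⇓ v →
                   g ⊢rec a , b · x , n ⇓ w → v ≡ w
  rec-functional (base p) (base p′) = ⇓-functional p p′
  rec-functional (step p q) (step p′ q′) with rec-functional p p′
  ... | refl = ⇓-functional q q′

mutual

  ⇓-resp-≗ : ∀ {g h c x v} → g ≗ h → g ⊢ c · x ⇓ v → h ⊢ c · x ⇓ v
  ⇓-resp-≗ e zer = zer
  ⇓-resp-≗ e succ = succ
  ⇓-resp-≗ e idn = idn
  ⇓-resp-≗ e left = left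
  ⇓-resp-≗ e right = right
  ⇓-resp-≗ {h = h} e (oracle {x}) = subst (h ⊢ oracle · x ⇓_) (sym (e x)) oracle
  ⇓-resp-≗ e (pair p q) = pair (⇓-resp-≗ e p) (⇓-resp-≗ e q)
  ⇓-resp-≗ e (comp p q) = comp (⇓-resp-≗ e p) (⇓-resp-≗ e q)
  ⇓-resp-≗ e (prec p) = prec (rec-resp-≗ e p)
  ⇓-resp-≗ e (mini k f p) = mini k (λ m<n → ⇓-resp-≗ e (f m<n)) (⇓-resp-≗ e p)

  rec-resp-≗ : ∀ {g h a b x n v} → g ≗ h →
               g ⊢rec a , b · x , n ⇓ v → h ⊢rec a , b · x , n ⇓ v
  rec-resp-≗ e (base p) = base (⇓-resp-≗ e p)
  rec-resp-≗ e (step p q) = step (rec-resp-≗ e p) (⇓-resp-≗ e q)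

encode : Code → ℕ
encode zer        = ⟨ 0 , 0 ⟩
encode succ       = ⟨ 1 , 0 ⟩
encode idn        = ⟨ 2 , 0 ⟩
encode left       = ⟨ 3 , 0 ⟩
encode right      = ⟨ 4 , 0 ⟩
encode oracle     = ⟨ 5 , 0 ⟩
encode (pair a b) = ⟨ 6 , ⟨ encode a , encode b ⟩ ⟩
encode (comp a b) = ⟨ 7 , ⟨ encode a , encode b ⟩ ⟩
encode (prec a b) = ⟨ 8 , ⟨ encode a , encode b ⟩ ⟩
encode (mini a)   = ⟨ 9 , encode a ⟩

private
  data View : Code → ℕ → ℕ → Set where
    zer    : View zer 0 0
    succ   : View succ 1 0
    idn    : View idn 2 0
    left   : View left 3 0
    right  : View right 4 0
    oracle : View oracle 5 0
    pair   : ∀ a b {m} → m ≡ ⟨ encode a , encode b ⟩ → View (pair a b) 6 m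
    comp   : ∀ a b {m} → m ≡ ⟨ encode a , encode b ⟩ → View (comp a b) 7 m
    prec   : ∀ a b {m} → m ≡ ⟨ encode a , encode b ⟩ → View (prec a b) 8 m
    mini   : ∀ a {m} → m ≡ encode a → View (mini a) 9 m

  view : ∀ c → ∃[ t ] ∃[ m ] encode c ≡ ⟨ t , m ⟩ × View c t m
  view zer        = _ , _ , refl , zer
  view succ       = _ , _ , refl , succ
  view idn        = _ , _ , refl , idn
  view left       = _ , _ , refl , left
  view right      = _ , _ , refl , right
  view oracle     = _ , _ , refl , oracle
  view (pair a b) = 6 , _ , refl , pair a b refl
  view (comp a b) = 7 , _ , refl , comp a b refl
  view (prec a b) = 8 , _ , refl , prec a b refl
  view (mini a)   = 9 , _ , refl , mini a refl

encode-injective : ∀ c d → encode c ≡ encode d → c ≡ d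
encode-injective c d eq with view c | view d
... | t , m , p , u | t′ , m′ , q , u′
  with pair-injective {t} {m} {t′} {m′} (trans (sym p) (trans eq q))
... | refl , refl = same u u′
  where
  same : ∀ {c d t m} → View c t m → View d t m → c ≡ d
  same zer zer = refl
  same succ succ = refl
  same idn idn = refl
  same left left = refl
  same right right = refl
  same oracle oracle = refl
  same (pair a b p) (pair a′ b′ q) with pair-injective (trans (sym p) q)
  ... | r , s = cong₂ pair (encode-injective a a′ r) (encode-injective b b′ s)
  same (comp a b p) (comp a′ b′ q) with pair-injective (trans (sym p) q)
  ... | r , s = cong₂ comp (encode-injective a a′ r) (encode-injective b b′ s)
  same (prec a b p) (prec a′ b′ q) with pair-injective (trans (sym p) q)
  ... | r , s = cong₂ prec (encode-injective a a′ r) (encode-injective b b′ s)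
  same (mini a p) (mini a′ q) = cong mini (encode-injective a a′ (trans (sym p) q))

-- Φ e is nowhere defined if e is not the code of a program.
Φ : ℕ → PartialFunction
Φ e = record
  { graph      = λ g f → ∃[ c ] encode c ≡ e × (∀ n → g ⊢ c · n ⇓ f n)
  ; respˡ      = λ { g≗h (c , eq , r) → c , eq , λ n → ⇓-resp-≗ g≗h (r n) }
  ; respʳ      = λ { {g} f≗f′ (c , eq , r) →
                     c , eq , λ n → subst (g ⊢ c · n ⇓_) (f≗f′ n) (r n) }
  ; functional = functional
  }
  where
  functional : ∀ {g f f′ : Baire} →
               ∃[ c ] encode c ≡ e × (∀ n → g ⊢ c · n ⇓ f n) →
               ∃[ c ] encode c ≡ e × (∀ n → g ⊢ c · n ⇓ f′ n) → f ≗ f′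
  functional (c , eq , r) (c′ , eq′ , r′) n
    with encode-injective c c′ (trans eq (sym eq′))
  ... | refl = ⇓-functional (r n) (r′ n)

-- Computability without an oracle is computability with the oracle 0.
Computable : (List ℕ → ℕ) → Set
Computable θ = ∃[ c ] ∀ σ → (λ _ → 0) ⊢ c · encodeList σ ⇓ θ σ

------------------------------------------------------------------------
-- Learnability

record Learner : Set where
  field
    guess      : List ℕ → ℕ
    computable : Computable guess

open Learner public using (guess)

Limit : (ℕ → ℕ) → ℕ → Set
Limit u e = ∃[ s ] ∀ n → s ≤ n → u n ≡ e

Identifies : Learner → PartialFunction → Set
Identifies Ψ Γ = ∀ {g f} → graph Γ g f →
  ∃[ e ] Limit (λ n → guess Ψ (g ↾ n)) e × graph (Φ e) g f

-- The set S has at most b elements.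
#_≤_ : Pred ℕ 0ℓ → ℕ → Set
# S ≤ b = ∃[ xs ] length xs ≤ b × (∀ {n} → S n → n ∈ˡ xs)

MindChanges : Learner → Baire → Pred ℕ 0ℓ
MindChanges Ψ g n = guess Ψ (g ↾ suc n) ≢ guess Ψ (g ↾ n)

Guesses : Learner → Baire → Pred ℕ 0ℓ
Guesses Ψ g e = ∃[ n ] guess Ψ (g ↾ n) ≡ e

Notion : Set₁
Notion = PartialFunction → Set

⟨1,<ω⟩ : Notion
⟨1,<ω⟩ Γ = ∃[ Ψ ] Identifies Ψ Γ ×
  (∃[ b ] ∀ g → dom Γ g → # MindChanges Ψ g ≤ b)

⟨1,ω|<ω⟩ : Notion
⟨1,ω|<ω⟩ Γ = ∃[ Ψ ] Identifies Ψ Γ ×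
  (∃[ b ] ∀ g → dom Γ g → # Guesses Ψ g ≤ b)

⟨<ω,1⟩ : Notion
⟨<ω,1⟩ Γ = ∃[ b ] ∀ {g f} → graph Γ g f → ∃[ e ] e < b × graph (Φ e) g f

------------------------------------------------------------------------
-- Degree structures

Reducible : Notion → Rel Subset (lsuc 0ℓ)
Reducible N A B = ∃[ Γ ] N Γ ×
  (∀ g → g ∈ B → dom Γ g × (∀ f → graph Γ g f → f ∈ A))

-- A quotient of a preordered collection of sets is given by its
-- representatives; two representatives denote the same degree if each is
-- below the other.
record DegreeStructure : Set₂ where
  field
    Element : Pred Subset 0ℓ
    _≼_     : Rel Subset (lsuc 0ℓ)

-- The join of the degrees of q and r is the degree of q ⊗ r.
Brouwerian : DegreeStructure → Set₁
Brouwerian D = ∀ p q → Element p → Element q →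
  ∃[ r ] Element r × p ≼ (q ⊗ r) ×
         (∀ s → Element s → p ≼ (q ⊗ s) → r ≼ s)
  where open DegreeStructure D

2^ℕ : Pred Baire 0ℓ
2^ℕ f = ∀ n → f n < 2

-- A is a Π⁰₁ subset of Cantor space: the set of infinite binary sequences all
-- of whose finite initial segments satisfy a computable condition.
IsΠ⁰₁ : Subset → Set
IsΠ⁰₁ A = ∃[ θ ] Computable θ ×
  (∀ f → f ∈ A ⇔ (2^ℕ f × (∀ n → θ (f ↾ n) ≡ 0)))

𝒟 : Notion → DegreeStructure
𝒟 N = record { Element = λ _ → ⊤ ; _≼_ = Reducible N }

𝒫 : Notion → DegreeStructure
𝒫 N = record
  { Element = λ A → Satisfiable (mem A) × IsΠ⁰₁ A
  ; _≼_     = Reducible N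
  }

{-# OPTIONS --safe #-}
-- There are uniformly Π⁰₁ classes X i and a point G whose i-th part is in X i,
-- while no member of X i is computable from the other parts of G.  Each X i
-- excludes one pattern of each of its blocks of digits.  A block is reserved for
-- one program and one string v of digits of the lower levels.  If v can be
-- extended so that the program outputs a pattern on the block, whatever patterns
-- are excluded on the higher levels, then such a pattern is excluded from the
-- block.  Otherwise G can avoid some further patterns on the higher levels and
-- thereby prevent any output; there is room for this because the lengths of the
-- blocks double from one level to the next.
--
-- A member of q determines a number m and shows up to m marks, one after the
-- other.  To find a member of p, one has to output the current number k of marks
-- and a member of X (ix m k), which is available only until the next mark.  If
-- m ≥ b, a member of s b can be used instead, and so p ≤ q ⊗ s b with b mind
-- changes.  Suppose that p ≤ q ⊗ r with at most N guesses on each oracle, and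
-- r ≤ s (N + 1).  Then a part of G computes a member h₀ of r, and for m = N each
-- of the N + 1 values of k requires a new guess on f ⊕ h₀, for a suitable f ∈ q.
module Submission where

open import Axiom.ExcludedMiddle using (ExcludedMiddle)
open import Data.Empty using (⊥)
open import Data.Fin.Base using (Fin; zero; suc; toℕ)
open import Data.Fin.Properties using (injective⇒≤; toℕ<n; toℕ-injective)
open import Data.List.Base using (List; []; _∷_; length; map; upTo) renaming (lookup to lookupˡ)
open import Data.List.Properties using (length-map; length-upTo)
open import Data.List.Membership.Propositional.Properties using (∈-map⁺; ∈-upTo⁺)
open import Data.Nat.ListAction using (sum)
open import Data.List.Membership.Propositional using () renaming (_∈_ to _∈ˡ_)
open import Data.List.Relation.Unary.Any using (here; there) renaming (index to position)
open import Data.List.Relation.Unary.Any.Properties using (lookup-index)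
open import Data.Nat.Base hiding (_/_; _%_; parity)
open import Data.Nat.DivMod using (_/_; _%_; +-distrib-/-∣ʳ; m<n⇒m/n≡0; m*n/n≡m; [m+kn]%n≡m%n; m<n⇒m%n≡m)
open import Data.Nat.Divisibility.Core using (divides-refl)
open import Data.Nat.Properties
open import Data.Product.Base using (∃; ∃-syntax; _×_; _,_; proj₁; proj₂)
open import Data.Sum.Base using (_⊎_; inj₁; inj₂)
open import Data.Unit.Base using (⊤; tt)
open import Function.Base using (_∘_; id; case_of_)
open import Function.Bundles using (_⇔_; mk⇔; Equivalence)
open import Level using (0ℓ)
open import Relation.Binary.Definitions using (tri<; tri≈; tri>)
open import Relation.Binary.PropositionalEquality
open import Relation.Unary using (Pred)
open import Relation.Nullary using (¬_; Dec; yes; no; contradiction)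
open import Defs

-- A least `r` would lie below every `s b`, so it can be tested against an `s b` chosen after the
-- bound `N` of the given reduction. The value `b = N + 1` makes the class of `s b` worthless for
-- `m = N`, since `p` accepts `X (iy k)` only for `k ≤ m`. Compactness shapes `p` and `q`. As `q`
-- has to be a Π⁰₁ class, the sequences `0^m 1 …` that announce `m` bring along their limit `0^ω`.
-- There a member of `X iz` is demanded, which the oracles with a finite `m` do not compute, so a
-- solution cannot pretend that `m` never appears. The classes `X (iw m)` likewise keep it from
-- announcing another `m`. A mark may be set at any later moment, with only a finite part of the
-- oracle fixed; hence digits of `y` before a mark count for nothing after it. Any finite part of an
-- oracle can be written into a program, so only the classes of the infinite parts matter when `G`
-- is used.

open Equivalence

-- An opaque copy of the pairing, which is expensive to unfold on literals.
opaque
  pr : ℕ → ℕ → ℕ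
  pr x y = ⟨ x , y ⟩

  fst snd : ℕ → ℕ
  fst = π₁
  snd = π₂

  pr-def : ∀ x y → pr x y ≡ ⟨ x , y ⟩
  pr-def x y = refl

  fst-def : ∀ x → fst x ≡ π₁ x
  fst-def x = refl

  snd-def : ∀ x → snd x ≡ π₂ x
  snd-def x = refl

  fst-pr : ∀ x y → fst (pr x y) ≡ x
  fst-pr x y = cong proj₁ (unpair-pair x y)

  snd-pr : ∀ x y → snd (pr x y) ≡ y
  snd-pr x y = cong proj₂ (unpair-pair x y)

triangle-mono : ∀ {m n} → m ≤ n → triangle m ≤ triangle n
triangle-mono z≤n       = z≤n
triangle-mono (s≤s m≤n) = +-mono-≤ (s≤s m≤n) (triangle-mono m≤n)

opaque
  unfolding pr

  pr-mono-≤ : ∀ {x x′ y y′} → x ≤ x′ → y ≤ y′ → pr x y ≤ pr x′ y′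
  pr-mono-≤ p q = +-mono-≤ q (triangle-mono (+-mono-≤ p q))

  pr-mono-< : ∀ {x x′ y y′} → x ≤ x′ → y < y′ → pr x y < pr x′ y′
  pr-mono-< p q = +-mono-<-≤ q (triangle-mono (+-mono-≤ p (<⇒≤ q)))

  y≤pr : ∀ x y → y ≤ pr x y
  y≤pr x y = m≤m+n y _

-- A language of oracle terms and its compiler.

natrec : ∀ {a} {A : Set a} → A → (ℕ → A → A) → ℕ → A
natrec z s zero    = z
natrec z s (suc n) = s n (natrec z s n)

ifz : ℕ → ℕ → ℕ → ℕ
ifz n x y = natrec x (λ _ _ → y) n

Env : ℕ → Set
Env zero    = ⊤
Env (suc n) = ℕ × Env n

⌜_⌝ : ∀ {n} → Env n → ℕ
⌜_⌝ {zero}  _       = 0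
⌜_⌝ {suc n} (x , ρ) = ⟨ x , ⌜ ρ ⌝ ⟩

lookup : ∀ {n} → Fin n → Env n → ℕ
lookup zero    (x , _) = x
lookup (suc i) (_ , ρ) = lookup i ρ

-- With `F` as an index, a compiled function used in a larger term denotes `F` itself, so that many
-- later correctness proofs are `refl`.
record Rec (k : ℕ) (F : Baire → Env k → ℕ) : Set where
  field
    code : Code
    runs : ∀ o ρ → o ⊢ code · ⌜ ρ ⌝ ⇓ F o ρ
open Rec

infixl 30 _·_
infixr 5 _∷_

mutual
  data Tm : ℕ → Set where
    var       : ∀ {n} → Fin n → Tm n
    lit       : ∀ {n} → ℕ → Tm n
    sucᵗ      : ∀ {n} → Tm n → Tm n
    prᵗ       : ∀ {n} → Tm n → Tm n → Tm n
    fstᵗ sndᵗ : ∀ {n} → Tm n → Tm n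
    orc       : ∀ {n} → Tm n → Tm n
    recᵗ      : ∀ {n} → Tm n → Tm (suc (suc n)) → Tm n → Tm n
    wk        : ∀ {n} → Tm n → Tm (suc n)
    app       : ∀ {n k} → Tm k → Tms n k → Tm n
    _·_       : ∀ {n k F} → Rec k F → Tms n k → Tm n

  data Tms (n : ℕ) : ℕ → Set where
    []  : Tms n 0
    _∷_ : ∀ {k} → Tm n → Tms n k → Tms n (suc k)

mutual
  ⟦_⟧ : ∀ {n} → Tm n → Baire → Env n → ℕ
  ⟦ var i ⟧          o ρ = lookup i ρ
  ⟦ lit k ⟧          o ρ = k
  ⟦ sucᵗ t ⟧         o ρ = suc (⟦ t ⟧ o ρ)
  ⟦ prᵗ t u ⟧        o ρ = pr (⟦ t ⟧ o ρ) (⟦ u ⟧ o ρ)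
  ⟦ fstᵗ t ⟧         o ρ = fst (⟦ t ⟧ o ρ)
  ⟦ sndᵗ t ⟧         o ρ = snd (⟦ t ⟧ o ρ)
  ⟦ orc t ⟧          o ρ = o (⟦ t ⟧ o ρ)
  ⟦ recᵗ z s k ⟧     o ρ = natrec (⟦ z ⟧ o ρ) (λ i r → ⟦ s ⟧ o (r , i , ρ)) (⟦ k ⟧ o ρ)
  ⟦ wk t ⟧           o ρ = ⟦ t ⟧ o (proj₂ ρ)
  ⟦ app t ts ⟧       o ρ = ⟦ t ⟧ o (⟦ ts ⟧* o ρ)
  ⟦ _·_ {F = F} _ ts ⟧ o ρ = F o (⟦ ts ⟧* o ρ)

  ⟦_⟧* : ∀ {n k} → Tms n k → Baire → Env n → Env k
  ⟦ [] ⟧*     o ρ = tt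
  ⟦ t ∷ ts ⟧* o ρ = ⟦ t ⟧ o ρ , ⟦ ts ⟧* o ρ

litᶜ : ℕ → Code
litᶜ zero    = zer
litᶜ (suc k) = comp succ (litᶜ k)

varᶜ : ∀ {n} → Fin n → Code
varᶜ zero    = left
varᶜ (suc i) = comp (varᶜ i) right

recᶜ : Code → Code → Code → Code
-- `prec` hands ⟨x, ⟨n, r⟩⟩ to its step; the inner `pair` turns this into ⟨r, ⟨n, x⟩⟩, the
-- environment for which `s` is compiled.
recᶜ z s k = comp (prec z (comp s (pair (comp right right) (pair (comp left right) left)))) (pair idn k)

mutual
  compile : ∀ {n} → Tm n → Code
  compile (var i)      = varᶜ i
  compile (lit k)      = litᶜ k
  compile (sucᵗ t)     = comp succ (compile t)
  compile (prᵗ t u)    = pair (compile t) (compile u)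
  compile (fstᵗ t)     = comp left (compile t)
  compile (sndᵗ t)     = comp right (compile t)
  compile (orc t)      = comp oracle (compile t)
  compile (recᵗ z s k) = recᶜ (compile z) (compile s) (compile k)
  compile (wk t)       = comp (compile t) right
  compile (app t ts)   = comp (compile t) (compiles ts)
  compile (r · ts)     = comp (code r) (compiles ts)

  compiles : ∀ {n k} → Tms n k → Code
  compiles []       = zer
  compiles (t ∷ ts) = pair (compile t) (compiles ts)

left⇓ : ∀ {o} x y → o ⊢ left · ⟨ x , y ⟩ ⇓ x
left⇓ {o} x y = subst (o ⊢ left · ⟨ x , y ⟩ ⇓_) (cong proj₁ (unpair-pair x y)) left

right⇓ : ∀ {o} x y → o ⊢ right · ⟨ x , y ⟩ ⇓ y
right⇓ {o} x y = subst (o ⊢ right · ⟨ x , y ⟩ ⇓_) (cong proj₂ (unpair-pair x y)) right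

lit⇓ : ∀ {o x} k → o ⊢ litᶜ k · x ⇓ k
lit⇓ zero    = zer
lit⇓ (suc k) = comp (lit⇓ k) succ

var⇓ : ∀ {o n} (i : Fin n) (ρ : Env n) → o ⊢ varᶜ i · ⌜ ρ ⌝ ⇓ lookup i ρ
var⇓ zero    (x , ρ) = left⇓ x _
var⇓ (suc i) (x , ρ) = comp (right⇓ x _) (var⇓ i ρ)

prec⇓ : ∀ {o a b x n v} → o ⊢rec a , b · x , n ⇓ v → o ⊢ prec a b · ⟨ x , n ⟩ ⇓ v
prec⇓ {o} {a} {b} {x} {n} {v} r = prec (subst (λ p → o ⊢rec a , b · proj₁ p , proj₂ p ⇓ v) (sym (unpair-pair x n)) r)

rec⇓ : ∀ {o z s k x v n} {f : ℕ → ℕ → ℕ} → o ⊢ z · x ⇓ v → o ⊢ k · x ⇓ n →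
       (∀ i r → o ⊢ s · ⟨ r , ⟨ i , x ⟩ ⟩ ⇓ f i r) → o ⊢ recᶜ z s k · x ⇓ natrec v f n
rec⇓ {o} {z} {s} {x = x} {v} {n} {f} zv kn sf = comp (pair idn kn) (prec⇓ (go n))
  where
  go : ∀ n → o ⊢rec z , _ · x , n ⇓ natrec v f n
  go zero    = base zv
  go (suc n) = step (go n)
    (comp (pair (comp (right⇓ x _) (right⇓ n _)) (pair (comp (right⇓ x _) (left⇓ n _)) (left⇓ x _))) (sf n _))

mutual
  compile⇓ : ∀ {n} (t : Tm n) o ρ → o ⊢ compile t · ⌜ ρ ⌝ ⇓ ⟦ t ⟧ o ρ
  compile⇓ (var i)      o ρ = var⇓ i ρ
  compile⇓ (lit k)      o ρ = lit⇓ k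
  compile⇓ (sucᵗ t)     o ρ = comp (compile⇓ t o ρ) succ
  compile⇓ (prᵗ t u)    o ρ = subst (o ⊢ _ · _ ⇓_) (sym (pr-def _ _)) (pair (compile⇓ t o ρ) (compile⇓ u o ρ))
  compile⇓ (fstᵗ t)     o ρ = subst (o ⊢ _ · _ ⇓_) (sym (fst-def _)) (comp (compile⇓ t o ρ) left)
  compile⇓ (sndᵗ t)     o ρ = subst (o ⊢ _ · _ ⇓_) (sym (snd-def _)) (comp (compile⇓ t o ρ) right)
  compile⇓ (orc t)      o ρ = comp (compile⇓ t o ρ) oracle
  compile⇓ (recᵗ z s k) o ρ =
    rec⇓ (compile⇓ z o ρ) (compile⇓ k o ρ) (λ i r → compile⇓ s o (r , i , ρ))
  compile⇓ (wk t)       o ρ = comp (right⇓ (proj₁ ρ) ⌜ proj₂ ρ ⌝) (compile⇓ t o (proj₂ ρ))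
  compile⇓ (app t ts)   o ρ = comp (compiles⇓ ts o ρ) (compile⇓ t o _)
  compile⇓ (r · ts)     o ρ = comp (compiles⇓ ts o ρ) (runs r o _)

  compiles⇓ : ∀ {n k} (ts : Tms n k) o ρ → o ⊢ compiles ts · ⌜ ρ ⌝ ⇓ ⌜ ⟦ ts ⟧* o ρ ⌝
  compiles⇓ []       o ρ = zer
  compiles⇓ (t ∷ ts) o ρ = pair (compile⇓ t o ρ) (compiles⇓ ts o ρ)

toRec : ∀ {n F} (t : Tm n) → (∀ o ρ → ⟦ t ⟧ o ρ ≡ F o ρ) → Rec n F
toRec t eq .code     = compile t
toRec t eq .runs o ρ = subst (o ⊢ compile t · ⌜ ρ ⌝ ⇓_) (eq o ρ) (compile⇓ t o ρ)

pattern v0 = var zero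
pattern v1 = var (suc zero)
pattern v2 = var (suc (suc zero))
pattern v3 = var (suc (suc (suc zero)))
pattern v4 = var (suc (suc (suc (suc zero))))
pattern v5 = var (suc (suc (suc (suc (suc zero)))))
pattern v6 = var (suc (suc (suc (suc (suc (suc zero))))))


plusᴿ : Rec 2 (λ { o (x , y , _) → x + y })
plusᴿ = toRec (recᵗ v1 (sucᵗ v0) v0) (λ { o (x , y , _) → go x y })
  where
  go : ∀ x y → natrec y (λ _ → suc) x ≡ x + y
  go zero    y = refl
  go (suc x) y = cong suc (go x y)

infixl 22 _+ᵗ_ _∸ᵗ_
infixl 23 _*ᵗ_

_+ᵗ_ _*ᵗ_ _∸ᵗ_ : ∀ {n} → Tm n → Tm n → Tm n
t +ᵗ u = plusᴿ · (t ∷ u ∷ [])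

timesᴿ : Rec 2 (λ { o (x , y , _) → x * y })
timesᴿ = toRec (recᵗ (lit 0) (v3 +ᵗ v0) v0) (λ { o (x , y , _) → go x y })
  where
  go : ∀ x y → natrec 0 (λ _ r → y + r) x ≡ x * y
  go zero    y = refl
  go (suc x) y = cong (y +_) (go x y)

t *ᵗ u = timesᴿ · (t ∷ u ∷ [])

predᴿ : Rec 1 (λ { o (x , _) → pred x })
predᴿ = toRec (recᵗ (lit 0) v1 v0) (λ { o (zero , _) → refl ; o (suc x , _) → refl })

monusᴿ : Rec 2 (λ { o (x , y , _) → x ∸ y })
monusᴿ = toRec (recᵗ v0 (predᴿ · (v0 ∷ [])) v1) (λ { o (x , y , _) → go x y })
  where
  go : ∀ x y → natrec x (λ _ → pred) y ≡ x ∸ y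
  go x zero    = refl
  go x (suc y) = trans (cong pred (go x y)) (pred[m∸n]≡m∸[1+n] x y)

t ∸ᵗ u = monusᴿ · (t ∷ u ∷ [])

ifzᵗ : ∀ {n} → Tm n → Tm n → Tm n → Tm n
ifzᵗ c t u = recᵗ t (wk (wk u)) c

predᵗ : ∀ {n} → Tm n → Tm n
predᵗ t = predᴿ · (t ∷ [])

-- Formulas are compiled to terms whose value is zero exactly when they hold.
record Char (k : ℕ) (P : Baire → Env k → Set) : Set where
  field
    char  : Tm k
    holds : ∀ o ρ → ⟦ char ⟧ o ρ ≡ 0 ⇔ P o ρ
open Char

infix  30 _∙_
infix  21 _≤ᶠ_ _<ᶠ_ _≡ᶠ_
infixr 20 _∧ᶠ_
infixr 19 _⇒ᶠ_

data Fm : ℕ → Set₁ where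
  _≤ᶠ_ _≡ᶠ_ : ∀ {n} → Tm n → Tm n → Fm n
  _∧ᶠ_ _⇒ᶠ_ : ∀ {n} → Fm n → Fm n → Fm n
  ¬ᶠ        : ∀ {n} → Fm n → Fm n
  all< ex<  : ∀ {n} → Tm n → Fm (suc n) → Fm n
  _∙_       : ∀ {n k P} → Char k P → Tms n k → Fm n

_<ᶠ_ : ∀ {n} → Tm n → Tm n → Fm n
t <ᶠ u = sucᵗ t ≤ᶠ u

⟪_⟫ : ∀ {n} → Fm n → Baire → Env n → Set
⟪ t ≤ᶠ u ⟫   o ρ = ⟦ t ⟧ o ρ ≤ ⟦ u ⟧ o ρ
⟪ t ≡ᶠ u ⟫   o ρ = ⟦ t ⟧ o ρ ≡ ⟦ u ⟧ o ρ
⟪ φ ∧ᶠ ψ ⟫   o ρ = ⟪ φ ⟫ o ρ × ⟪ ψ ⟫ o ρ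
⟪ φ ⇒ᶠ ψ ⟫   o ρ = ⟪ φ ⟫ o ρ → ⟪ ψ ⟫ o ρ
⟪ ¬ᶠ φ ⟫     o ρ = ¬ ⟪ φ ⟫ o ρ
⟪ all< t φ ⟫ o ρ = ∀ i → i < ⟦ t ⟧ o ρ → ⟪ φ ⟫ o (i , ρ)
⟪ ex< t φ ⟫  o ρ = ∃[ i ] i < ⟦ t ⟧ o ρ × ⟪ φ ⟫ o (i , ρ)
⟪ _∙_ {P = P} _ ts ⟫ o ρ = P o (⟦ ts ⟧* o ρ)

χ : ∀ {n} → Fm n → Tm n
χ (t ≤ᶠ u)   = t ∸ᵗ u
χ (t ≡ᶠ u)   = (t ∸ᵗ u) +ᵗ (u ∸ᵗ t)
χ (φ ∧ᶠ ψ)   = χ φ +ᵗ χ ψ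
χ (φ ⇒ᶠ ψ)   = (lit 1 ∸ᵗ χ φ) *ᵗ χ ψ
χ (¬ᶠ φ)     = lit 1 ∸ᵗ χ φ
χ (all< t φ) = recᵗ (lit 0) (v0 +ᵗ wk (χ φ)) t
χ (ex< t φ)  = recᵗ (lit 1) (v0 *ᵗ wk (χ φ)) t
χ (P ∙ ts)   = app (char P) ts

≡0? : ∀ n → Dec (n ≡ 0)
≡0? zero    = yes refl
≡0? (suc n) = no λ ()

1∸n≡0 : ∀ {n} → ¬ n ≡ 0 → 1 ∸ n ≡ 0
1∸n≡0 {zero}  p = contradiction refl p
1∸n≡0 {suc n} p = 0∸n≡0 n

1∸n≢0 : ∀ {n} → 1 ∸ n ≡ 0 → ¬ n ≡ 0
1∸n≢0 {suc n} p ()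

χ-holds : ∀ {n} (φ : Fm n) o ρ → ⟦ χ φ ⟧ o ρ ≡ 0 ⇔ ⟪ φ ⟫ o ρ
χ-holds (t ≤ᶠ u)   o ρ = mk⇔ (m∸n≡0⇒m≤n) m≤n⇒m∸n≡0
χ-holds (t ≡ᶠ u)   o ρ = mk⇔ f g
  where
  f : _
  f eq = ≤-antisym (m∸n≡0⇒m≤n (m+n≡0⇒m≡0 _ eq)) (m∸n≡0⇒m≤n (m+n≡0⇒n≡0 (⟦ t ⟧ o ρ ∸ ⟦ u ⟧ o ρ) eq))
  g : _
  g eq = cong₂ _+_ (m≤n⇒m∸n≡0 (≤-reflexive eq)) (m≤n⇒m∸n≡0 (≤-reflexive (sym eq)))
χ-holds (φ ∧ᶠ ψ)   o ρ = mk⇔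
  (λ eq → χ-holds φ o ρ .to (m+n≡0⇒m≡0 _ eq) , χ-holds ψ o ρ .to (m+n≡0⇒n≡0 (⟦ χ φ ⟧ o ρ) eq))
  (λ (p , q) → cong₂ _+_ (χ-holds φ o ρ .from p) (χ-holds ψ o ρ .from q))
χ-holds (φ ⇒ᶠ ψ)   o ρ with ≡0? (⟦ χ φ ⟧ o ρ)
... | yes eq = mk⇔
  (λ e _ → χ-holds ψ o ρ .to (trans (sym (*-identityˡ _)) (subst (λ k → (1 ∸ k) * ⟦ χ ψ ⟧ o ρ ≡ 0) eq e)))
  (λ f → trans (cong (λ k → (1 ∸ ⟦ χ φ ⟧ o ρ) * k) (χ-holds ψ o ρ .from (f (χ-holds φ o ρ .to eq)))) (*-zeroʳ (1 ∸ ⟦ χ φ ⟧ o ρ)))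
... | no ne = mk⇔
  (λ _ p → contradiction (χ-holds φ o ρ .from p) ne)
  (λ _ → cong (_* ⟦ χ ψ ⟧ o ρ) (1∸n≡0 ne))
χ-holds (¬ᶠ φ)     o ρ = mk⇔
  (λ eq p → 1∸n≢0 eq (χ-holds φ o ρ .from p))
  (λ np → 1∸n≡0 (np ∘ χ-holds φ o ρ .to))
χ-holds (all< t φ) o ρ = mk⇔ (f (⟦ t ⟧ o ρ)) (g (⟦ t ⟧ o ρ))
  where
  s : ℕ → ℕ
  s = natrec 0 (λ i r → r + ⟦ χ φ ⟧ o (i , ρ))
  f : ∀ n → s n ≡ 0 → ∀ i → i < n → ⟪ φ ⟫ o (i , ρ)
  f (suc n) eq i i<1+n with m≤n⇒m<n∨m≡n (s≤s⁻¹ i<1+n)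
  ... | inj₁ i<n  = f n (m+n≡0⇒m≡0 _ eq) i i<n
  ... | inj₂ refl = χ-holds φ o (i , ρ) .to (m+n≡0⇒n≡0 (s n) eq)
  g : ∀ n → (∀ i → i < n → ⟪ φ ⟫ o (i , ρ)) → s n ≡ 0
  g zero    h = refl
  g (suc n) h = cong₂ _+_ (g n (λ i i<n → h i (m<n⇒m<1+n i<n))) (χ-holds φ o (n , ρ) .from (h n ≤-refl))
χ-holds (ex< t φ)  o ρ = mk⇔ (f (⟦ t ⟧ o ρ)) (λ (i , i<n , p) → g (⟦ t ⟧ o ρ) i i<n p)
  where
  s : ℕ → ℕ
  s = natrec 1 (λ i r → r * ⟦ χ φ ⟧ o (i , ρ))
  f : ∀ n → s n ≡ 0 → ∃[ i ] i < n × ⟪ φ ⟫ o (i , ρ)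
  f (suc n) eq with m*n≡0⇒m≡0∨n≡0 (s n) eq
  ... | inj₁ eq′ = case f n eq′ of λ (i , i<n , p) → i , m<n⇒m<1+n i<n , p
  ... | inj₂ eq′ = n , ≤-refl , χ-holds φ o (n , ρ) .to eq′
  g : ∀ n i → i < n → ⟪ φ ⟫ o (i , ρ) → s n ≡ 0
  g (suc n) i i<1+n p with m≤n⇒m<n∨m≡n (s≤s⁻¹ i<1+n)
  ... | inj₁ i<n  = cong (_* ⟦ χ φ ⟧ o (n , ρ)) (g n i i<n p)
  ... | inj₂ refl = trans (cong (s n *_) (χ-holds φ o (i , ρ) .from p)) (*-zeroʳ (s n))
χ-holds (P ∙ ts)   o ρ = holds P o (⟦ ts ⟧* o ρ)

⟪_⟫? : ∀ {n} (φ : Fm n) o ρ → Dec (⟪ φ ⟫ o ρ)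
⟪ φ ⟫? o ρ with ≡0? (⟦ χ φ ⟧ o ρ)
... | yes eq = yes (χ-holds φ o ρ .to eq)
... | no ne  = no (ne ∘ χ-holds φ o ρ .from)

toChar : ∀ {n P} (φ : Fm n) → (∀ o ρ → ⟪ φ ⟫ o ρ ⇔ P o ρ) → Char n P
toChar φ eq .char      = χ φ
toChar φ eq .holds o ρ = mk⇔ (eq o ρ .to ∘ χ-holds φ o ρ .to) (χ-holds φ o ρ .from ∘ eq o ρ .from)

iterate : (ℕ → ℕ) → ℕ → ℕ → ℕ
iterate f n s = natrec s (λ _ → f) n

iterate-stuck : ∀ f n {s} → f s ≡ s → iterate f n s ≡ s
iterate-stuck f zero    eq = refl
iterate-stuck f (suc n) eq = trans (cong f (iterate-stuck f n eq)) eq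

iterate-suc : ∀ f n s → iterate f (suc n) s ≡ iterate f n (f s)
iterate-suc f zero    s = refl
iterate-suc f (suc n) s = cong f (iterate-suc f n s)

iterate-+ : ∀ f m n s → iterate f (m + n) s ≡ iterate f m (iterate f n s)
iterate-+ f zero    n s = refl
iterate-+ f (suc m) n s = cong f (iterate-+ f m n s)

-- `f` is the less informed step function: where it differs from `f′`, it is stuck. If a run of `f`
-- has an output all the same, it got stuck only in a halting state, where `f′` rests too.
iterate-mono : ∀ {f f′ r : ℕ → ℕ} {v} → (∀ s → f s ≡ f′ s ⊎ f s ≡ s) → (∀ {s} → r s ≡ suc v → f′ s ≡ s) →
               ∀ n s → r (iterate f n s) ≡ suc v → iterate f n s ≡ iterate f′ n s
iterate-mono dich halt zero    s eq = refl
iterate-mono {f} {f′} {r} dich halt (suc n) s eq with dich s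
... | inj₁ same =
  trans (iterate-suc f n s) (trans (iterate-mono {r = r} dich halt n (f s) (trans (cong r (sym (iterate-suc f n s))) eq))
    (trans (cong (iterate f′ n) same) (sym (iterate-suc f′ n s))))
... | inj₂ stuck = trans (iterate-stuck f (suc n) stuck)
  (sym (iterate-stuck f′ (suc n) (halt (trans (cong r (sym (iterate-stuck f (suc n) stuck))) eq))))

-- A universal stack machine

-- Its states are numbers: evaluating the program c at x, or returning the
-- value v, on top of a stack of frames.  The oracle is given by a function ℓ,
-- where ℓ a = 0 if the answer to the query a is not known, and suc of the
-- answer otherwise; the machine loops forever on an unknown answer.
evaluating : ℕ → ℕ → ℕ → ℕ
evaluating c x K = pr 0 (pr (pr c x) K)

returning : ℕ → ℕ → ℕ
returning v K = pr 1 (pr v K)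

-- Tags of frames: 0 and 1 for the two halves of a pair, 2 for a composition, 3 for a primitive
-- recursion (step, parameter, round, rounds left), 4 for a minimisation (program with its argument,
-- parameter and candidate). The successor separates a nonempty stack from the empty stack 0.
push : ℕ → ℕ → ℕ → ℕ
push f d K = suc (pr (pr f d) K)

stepEval : (ℕ → ℕ) → ℕ → ℕ → ℕ → ℕ → ℕ → ℕ
stepEval ℓ s t m x K =
  ifz t       (returning 0 K) (
  ifz (t ∸ 1) (returning (suc x) K) (
  ifz (t ∸ 2) (returning x K) (
  ifz (t ∸ 3) (returning (fst x) K) (
  ifz (t ∸ 4) (returning (snd x) K) (
  ifz (t ∸ 5) (ifz (ℓ x) s (returning (pred (ℓ x)) K)) (
  ifz (t ∸ 6) (evaluating (fst m) x (push 0 (pr (snd m) x) K)) (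
  ifz (t ∸ 7) (evaluating (snd m) x (push 2 (fst m) K)) (
  ifz (t ∸ 8) (evaluating (fst m) (fst x) (push 3 (pr (snd m) (pr (fst x) (pr 0 (snd x)))) K))
              (evaluating m (pr x 0) (push 4 (pr m (pr x 0)) K))))))))))

stepReturn : ℕ → ℕ → ℕ → ℕ → ℕ
stepReturn v f d K =
  ifz f       (evaluating (fst d) (snd d) (push 1 v K)) (
  ifz (f ∸ 1) (returning (pr d v) K) (
  ifz (f ∸ 2) (evaluating d v K) (
  ifz (f ∸ 3) (stepRec (fst d) (fst (snd d)) (fst (snd (snd d))) (snd (snd (snd d))))
              (stepMin (fst d) (fst (snd d)) (snd (snd d))))))
  where
  stepRec : ℕ → ℕ → ℕ → ℕ → ℕ
  stepRec b y i r = ifz r (returning v K)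
    (evaluating b (pr y (pr i v)) (push 3 (pr b (pr y (pr (suc i) (pred r)))) K))
  stepMin : ℕ → ℕ → ℕ → ℕ
  stepMin a x i = ifz v (returning i K)
    (evaluating a (pr x (suc i)) (push 4 (pr a (pr x (suc i))) K))

tick : (ℕ → ℕ) → ℕ → ℕ
tick ℓ s = ifz (fst s)
  (stepEval ℓ s (fst (fst (fst (snd s)))) (snd (fst (fst (snd s)))) (snd (fst (snd s))) (snd (snd s)))
  (ifz (snd (snd s)) s
    (stepReturn (fst (snd s)) (fst (fst (pred (snd (snd s))))) (snd (fst (pred (snd (snd s))))) (snd (pred (snd (snd s))))))

ticks : (ℕ → ℕ) → ℕ → ℕ → ℕ
ticks ℓ = iterate (tick ℓ)

-- The value 0 means that there is no output yet; in this way `run` is total and can occur in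
-- formulas.
result : ℕ → ℕ
result s = ifz (fst s) 0 (ifz (snd (snd s)) (suc (fst (snd s))) 0)

opaque
  run : (ℕ → ℕ) → ℕ → ℕ → ℕ → ℕ
  run ℓ n e x = result (ticks ℓ n (evaluating e x 0))

evaluatingᵗ pushᵗ : ∀ {n} → Tm n → Tm n → Tm n → Tm n
evaluatingᵗ c x K = prᵗ (lit 0) (prᵗ (prᵗ c x) K)
pushᵗ f d K = sucᵗ (prᵗ (prᵗ f d) K)

returningᵗ : ∀ {n} → Tm n → Tm n → Tm n
returningᵗ v K = prᵗ (lit 1) (prᵗ v K)

module _ (lk : Tm 2) where

  stepEvalᵗ : Tm 6
  stepEvalᵗ =
    let s = v0 ; t = v1 ; m = v2 ; x = v3 ; K = v4 ; ℓx = app lk (x ∷ v5 ∷ []) in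
    ifzᵗ t            (returningᵗ (lit 0) K) (
    ifzᵗ (t ∸ᵗ lit 1) (returningᵗ (sucᵗ x) K) (
    ifzᵗ (t ∸ᵗ lit 2) (returningᵗ x K) (
    ifzᵗ (t ∸ᵗ lit 3) (returningᵗ (fstᵗ x) K) (
    ifzᵗ (t ∸ᵗ lit 4) (returningᵗ (sndᵗ x) K) (
    ifzᵗ (t ∸ᵗ lit 5) (ifzᵗ ℓx s (returningᵗ (predᵗ ℓx) K)) (
    ifzᵗ (t ∸ᵗ lit 6) (evaluatingᵗ (fstᵗ m) x (pushᵗ (lit 0) (prᵗ (sndᵗ m) x) K)) (
    ifzᵗ (t ∸ᵗ lit 7) (evaluatingᵗ (sndᵗ m) x (pushᵗ (lit 2) (fstᵗ m) K)) (
    ifzᵗ (t ∸ᵗ lit 8) (evaluatingᵗ (fstᵗ m) (fstᵗ x) (pushᵗ (lit 3) (prᵗ (sndᵗ m) (prᵗ (fstᵗ x) (prᵗ (lit 0) (sndᵗ x)))) K))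
                (evaluatingᵗ m (prᵗ x (lit 0)) (pushᵗ (lit 4) (prᵗ m (prᵗ x (lit 0))) K))))))))))

  stepReturnᵗ : Tm 4
  stepReturnᵗ =
    let v = v0 ; f = v1 ; d = v2 ; K = v3
        sr = λ (b y i r : Tm 4) → ifzᵗ r (returningᵗ v K)
               (evaluatingᵗ b (prᵗ y (prᵗ i v)) (pushᵗ (lit 3) (prᵗ b (prᵗ y (prᵗ (sucᵗ i) (predᵗ r)))) K))
        sm = λ (a x i : Tm 4) → ifzᵗ v (returningᵗ i K)
               (evaluatingᵗ a (prᵗ x (sucᵗ i)) (pushᵗ (lit 4) (prᵗ a (prᵗ x (sucᵗ i))) K))
    in
    ifzᵗ f            (evaluatingᵗ (fstᵗ d) (sndᵗ d) (pushᵗ (lit 1) v K)) (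
    ifzᵗ (f ∸ᵗ lit 1) (returningᵗ (prᵗ d v) K) (
    ifzᵗ (f ∸ᵗ lit 2) (evaluatingᵗ d v K) (
    ifzᵗ (f ∸ᵗ lit 3) (sr (fstᵗ d) (fstᵗ (sndᵗ d)) (fstᵗ (sndᵗ (sndᵗ d))) (sndᵗ (sndᵗ (sndᵗ d))))
                      (sm (fstᵗ d) (fstᵗ (sndᵗ d)) (sndᵗ (sndᵗ d))))))

  tickᵗ : Tm 2
  tickᵗ = let s = v0 ; K = sndᵗ (sndᵗ s) in
    ifzᵗ (fstᵗ s)
      (app stepEvalᵗ (s ∷ fstᵗ (fstᵗ (fstᵗ (sndᵗ s))) ∷ sndᵗ (fstᵗ (fstᵗ (sndᵗ s))) ∷ sndᵗ (fstᵗ (sndᵗ s)) ∷ K ∷ v1 ∷ []))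
      (ifzᵗ K s
        (app stepReturnᵗ (fstᵗ (sndᵗ s) ∷ fstᵗ (fstᵗ (predᵗ K)) ∷ sndᵗ (fstᵗ (predᵗ K)) ∷ sndᵗ (predᵗ K) ∷ [])))

  resultᵗ : Tm 1
  resultᵗ = let s = v0 in ifzᵗ (fstᵗ s) (lit 0) (ifzᵗ (sndᵗ (sndᵗ s)) (sucᵗ (fstᵗ (sndᵗ s))) (lit 0))

  runᵗ : Tm 4
  runᵗ = app resultᵗ (recᵗ (evaluatingᵗ v1 v2 (lit 0)) (app tickᵗ (v0 ∷ v5 ∷ [])) v0 ∷ [])

  opaque
    unfolding run

    runᴿ : Rec 4 (λ { o (n , e , x , u , _) → run (λ a → ⟦ lk ⟧ o (a , u , tt)) n e x })
    runᴿ = toRec runᵗ (λ o ρ → refl)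

tick-evaluating : ∀ ℓ t m x K → tick ℓ (evaluating (pr t m) x K) ≡ stepEval ℓ (evaluating (pr t m) x K) t m x K
tick-evaluating ℓ t m x K
  rewrite fst-pr 0 (pr (pr (pr t m) x) K) | snd-pr 0 (pr (pr (pr t m) x) K)
        | fst-pr (pr (pr t m) x) K | snd-pr (pr (pr t m) x) K | fst-pr (pr t m) x | snd-pr (pr t m) x
        | fst-pr t m | snd-pr t m = refl

tick-returning : ∀ ℓ v f d K → tick ℓ (returning v (push f d K)) ≡ stepReturn v f d K
tick-returning ℓ v f d K
  rewrite fst-pr 1 (pr v (push f d K)) | snd-pr 1 (pr v (push f d K))
        | fst-pr v (push f d K) | snd-pr v (push f d K) | fst-pr (pr f d) K | snd-pr (pr f d) K
        | fst-pr f d | snd-pr f d = refl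

-- `u` bounds the use and `n` is the running time. Both are fixed before `ℓ`, so every finite oracle
-- that is long enough performs the same computation.
Reach : Baire → ℕ → ℕ → Set
Reach g s s′ = ∃[ u ] ∃[ n ] ∀ ℓ → (∀ a → a < u → ℓ a ≡ suc (g a)) → ticks ℓ n s ≡ s′

reach-tick : ∀ {g s s′} → (∀ ℓ → tick ℓ s ≡ s′) → Reach g s s′
reach-tick eq = 0 , 1 , λ ℓ _ → eq ℓ

infixr 5 _⟫_
_⟫_ : ∀ {g s s′ s″} → Reach g s s′ → Reach g s′ s″ → Reach g s s″
_⟫_ {s = s} (u , n , p) (u′ , n′ , p′) = u ⊔ u′ , n′ + n , λ ℓ h →
  trans (iterate-+ (tick ℓ) n′ n s) (trans (cong (ticks ℓ n′) (p ℓ λ a a<u → h a (<-≤-trans a<u (m≤m⊔n u u′))))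
                                  (p′ ℓ λ a a<u → h a (<-≤-trans a<u (m≤n⊔m u u′))))

⟨⟩≡pr : ∀ x y → ⟨ x , y ⟩ ≡ pr x y
⟨⟩≡pr x y = sym (pr-def x y)

fst-⟨⟩ : ∀ x y → fst ⟨ x , y ⟩ ≡ x
fst-⟨⟩ x y = trans (fst-def _) (cong proj₁ (unpair-pair x y))

snd-⟨⟩ : ∀ x y → snd ⟨ x , y ⟩ ≡ y
snd-⟨⟩ x y = trans (snd-def _) (cong proj₂ (unpair-pair x y))

reach-from : ∀ {g s s′ t} → s ≡ s′ → Reach g s t → Reach g s′ t
reach-from refl r = r

start : ∀ {g} t m x K {s} → (∀ ℓ → stepEval ℓ (evaluating (pr t m) x K) t m x K ≡ s) → Reach g (evaluating ⟨ t , m ⟩ x K) s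
start t m x K eq = reach-from (cong (λ c → evaluating c x K) (pr-def t m))
  (reach-tick λ ℓ → trans (tick-evaluating ℓ t m x K) (eq ℓ))

resume : ∀ {g} v f d K {s} → stepReturn v f d K ≡ s → Reach g (returning v (push f d K)) s
resume v f d K eq = reach-tick λ ℓ → trans (tick-returning ℓ v f d K) eq

oracle-reach : ∀ g x K → Reach g (evaluating ⟨ 5 , 0 ⟩ x K) (returning (g x) K)
oracle-reach g x K = suc x , 1 , λ ℓ h →
  trans (cong (λ c → tick ℓ (evaluating c x K)) (sym (pr-def 5 0))) (trans (tick-evaluating ℓ 5 0 x K) (lem (h x ≤-refl)))
  where
  lem : ∀ {s l} → l ≡ suc (g x) → ifz l s (returning (pred l) K) ≡ returning (g x) K
  lem refl = refl

mutual
  eval-reach : ∀ {g c x v} → g ⊢ c · x ⇓ v → ∀ K → Reach g (evaluating (encode c) x K) (returning v K)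
  eval-reach {x = x} zer    K = start 0 0 x K λ _ → refl
  eval-reach {x = x} succ   K = start 1 0 x K λ _ → refl
  eval-reach {x = x} idn    K = start 2 0 x K λ _ → refl
  eval-reach {x = x} left   K = start 3 0 x K λ _ → cong (λ v → returning v K) (fst-def x)
  eval-reach {x = x} right  K = start 4 0 x K λ _ → cong (λ v → returning v K) (snd-def x)
  eval-reach {x = x} oracle K = oracle-reach _ x K
  eval-reach {x = x} (pair {a} {b} {v = v} {w} p q) K =
    start 6 ⟨ encode a , encode b ⟩ x K (λ _ → cong₂ (λ a b → evaluating a x (push 0 (pr b x) K)) (fst-⟨⟩ (encode a) (encode b)) (snd-⟨⟩ (encode a) (encode b))) ⟫
    eval-reach p (push 0 (pr (encode b) x) K) ⟫
    resume v 0 _ K (cong₂ (λ b x → evaluating b x (push 1 v K)) (fst-pr _ _) (snd-pr _ _)) ⟫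
    eval-reach q (push 1 v K) ⟫
    resume w 1 v K (cong (λ v → returning v K) (pr-def v w))
  eval-reach {x = x} (comp {a} {b} {v = v} {w} p q) K =
    start 7 ⟨ encode a , encode b ⟩ x K (λ _ → cong₂ (λ a b → evaluating b x (push 2 a K)) (fst-⟨⟩ (encode a) (encode b)) (snd-⟨⟩ (encode a) (encode b))) ⟫
    eval-reach p (push 2 (encode a) K) ⟫
    resume w 2 (encode a) K refl ⟫
    eval-reach q K
  eval-reach {x = x} (prec {a} {b} {v = v} p) K =
    start 8 ⟨ encode a , encode b ⟩ x K (λ _ → trans
      (cong₂ (λ a b → evaluating a (fst x) (push 3 (pr b (pr (fst x) (pr 0 (snd x)))) K)) (fst-⟨⟩ (encode a) (encode b)) (snd-⟨⟩ (encode a) (encode b)))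
      (cong₂ (λ y n → evaluating (encode a) y (push 3 (pr (encode b) (pr y (pr 0 n))) K)) (fst-def x) (trans (snd-def x) (sym (+-identityʳ _))))) ⟫
    rec-reach p 0 K ⟫
    resume v 3 _ K (unframe K (encode b) (π₁ x) (π₂ x))
    where
    unframe : ∀ K b y n → stepReturn v 3 (pr b (pr y (pr n 0))) K ≡ returning v K
    unframe K b y n rewrite snd-pr b (pr y (pr n 0)) | snd-pr y (pr n 0) | snd-pr n 0 = refl
  eval-reach {g} {x = x} (mini {a} {n = n} k f z) K =
    start 9 (encode a) x K (λ _ → refl) ⟫ go n 0 (+-identityʳ n)
    where
    unframe : ∀ v a x i → stepReturn v 4 (pr a (pr x i)) K ≡
              ifz v (returning i K) (evaluating a (pr x (suc i)) (push 4 (pr a (pr x (suc i))) K))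
    unframe v a x i rewrite fst-pr a (pr x i) | snd-pr a (pr x i) | fst-pr x i | snd-pr x i = refl
    go : ∀ d i → d + i ≡ n → Reach g (evaluating (encode a) (pr x i) (push 4 (pr (encode a) (pr x i)) K)) (returning n K)
    go zero i refl =
      reach-from (cong (λ y → evaluating (encode a) y (push 4 (pr (encode a) (pr x i)) K)) (⟨⟩≡pr x i)) (eval-reach z _) ⟫
      resume 0 4 _ K (unframe 0 (encode a) x i)
    go (suc d) i eq =
      reach-from (cong (λ y → evaluating (encode a) y (push 4 (pr (encode a) (pr x i)) K)) (⟨⟩≡pr x i)) (eval-reach (f (≤-trans (s≤s (m≤n+m i d)) (≤-reflexive eq))) _) ⟫
      resume (suc (k i)) 4 _ K (unframe (suc (k i)) (encode a) x i) ⟫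
      go d (suc i) (trans (+-suc d i) eq)

  -- The frame counts the rounds left, whereas the derivation peels off the last round; `r` stands
  -- for the rounds still to come after the first `n`.
  rec-reach : ∀ {g a b y n v} → g ⊢rec a , b · y , n ⇓ v → ∀ r K →
    Reach g (evaluating (encode a) y (push 3 (pr (encode b) (pr y (pr 0 (n + r)))) K))
            (returning v (push 3 (pr (encode b) (pr y (pr n r))) K))
  rec-reach (base p) r K = eval-reach p _
  rec-reach {g} {a} {b} {y} (step {n} {v} {w} p q) r K =
    reach-from (cong (λ k → evaluating (encode a) y (push 3 (pr (encode b) (pr y (pr 0 k))) K)) (+-suc n r))
      (rec-reach p (suc r) K) ⟫
    resume w 3 _ K (unframe (encode b)) ⟫
    reach-from (cong (λ z → evaluating (encode b) z (push 3 (pr (encode b) (pr y (pr (suc n) r))) K)) (trans (⟨⟩≡pr y ⟨ n , w ⟩) (cong (pr y) (⟨⟩≡pr n w)))) (eval-reach q _)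
    where
    unframe : ∀ b → stepReturn w 3 (pr b (pr y (pr n (suc r)))) K ≡
              evaluating b (pr y (pr n w)) (push 3 (pr b (pr y (pr (suc n) r))) K)
    unframe b rewrite fst-pr b (pr y (pr n (suc r))) | snd-pr b (pr y (pr n (suc r))) | fst-pr y (pr n (suc r))
      | snd-pr y (pr n (suc r)) | fst-pr n (suc r) | snd-pr n (suc r) = refl

halted : ∀ ℓ {s v} → result s ≡ suc v → tick ℓ s ≡ s
halted ℓ {s} eq = lem (fst s) (snd (snd s)) eq
  where
  lem : ∀ {v e s r t} m K → ifz m 0 (ifz K (suc t) 0) ≡ suc v → ifz m e (ifz K s r) ≡ s
  lem (suc m) zero eq = refl

infix 4 _⊑_
_⊑_ : (ℕ → ℕ) → (ℕ → ℕ) → Set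
ℓ ⊑ ℓ′ = ∀ a → ℓ a ≡ 0 ⊎ ℓ a ≡ ℓ′ a

tick-mono : ∀ {ℓ ℓ′} → ℓ ⊑ ℓ′ → ∀ s → tick ℓ s ≡ tick ℓ′ s ⊎ tick ℓ s ≡ s
tick-mono {ℓ} {ℓ′} ℓ⊑ℓ′ s = branch (fst s)
  (evalMono (fst (fst (fst (snd s)))) (snd (fst (fst (snd s)))) (snd (fst (snd s))) (snd (snd s))) (inj₁ refl)
  where
  branch : ∀ c {a a′ b b′} → a ≡ a′ ⊎ a ≡ s → b ≡ b′ ⊎ b ≡ s → ifz c a b ≡ ifz c a′ b′ ⊎ ifz c a b ≡ s
  branch zero    p q = p
  branch (suc c) p q = q
  query : ∀ x K → ifz (ℓ x) s (returning (pred (ℓ x)) K) ≡ ifz (ℓ′ x) s (returning (pred (ℓ′ x)) K)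
                ⊎ ifz (ℓ x) s (returning (pred (ℓ x)) K) ≡ s
  query x K with ℓ⊑ℓ′ x
  ... | inj₁ eq rewrite eq = inj₂ refl
  ... | inj₂ eq rewrite eq = inj₁ refl
  evalMono : ∀ t m x K → stepEval ℓ s t m x K ≡ stepEval ℓ′ s t m x K ⊎ stepEval ℓ s t m x K ≡ s
  evalMono t m x K =
    branch t (inj₁ refl) (branch (t ∸ 1) (inj₁ refl) (branch (t ∸ 2) (inj₁ refl) (branch (t ∸ 3) (inj₁ refl)
    (branch (t ∸ 4) (inj₁ refl) (branch (t ∸ 5) (query x K) (inj₁ refl))))))

opaque
  unfolding run

  run-mono : ∀ {ℓ ℓ′ n e x v} → ℓ ⊑ ℓ′ → run ℓ n e x ≡ suc v → run ℓ′ n e x ≡ suc v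
  run-mono {ℓ′ = ℓ′} {n = n} ℓ⊑ℓ′ eq = trans (cong result (sym (iterate-mono {r = result} (tick-mono ℓ⊑ℓ′) (halted ℓ′) n _ eq))) eq

  run-more : ∀ {ℓ n n′ e x v} → n ≤ n′ → run ℓ n e x ≡ suc v → run ℓ n′ e x ≡ suc v
  run-more {ℓ} {n} {n′} {e} {x} n≤n′ eq =
    trans (cong (λ k → run ℓ k e x) (sym (m∸n+n≡m n≤n′)))
      (trans (cong result (trans (iterate-+ (tick ℓ) (n′ ∸ n) n _) (iterate-stuck (tick ℓ) (n′ ∸ n) (halted ℓ eq)))) eq)

  run-complete : ∀ {g c x v} → g ⊢ c · x ⇓ v → ∃[ u ] ∃[ n ]
    ∀ ℓ → (∀ a → a < u → ℓ a ≡ suc (g a)) → ∀ n′ → n ≤ n′ → run ℓ n′ (encode c) x ≡ suc v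
  run-complete {c = c} {v = v} p with eval-reach p 0
  ... | u , n , r = u , n , λ ℓ h n′ n≤n′ → run-more {ℓ} {n} {n′} {encode c} n≤n′ (trans (cong result (r ℓ h)) res)
    where
    res : result (returning v 0) ≡ suc v
    res rewrite fst-pr 1 (pr v 0) | snd-pr 1 (pr v 0) | fst-pr v 0 | snd-pr v 0 = refl

  -- Neither further oracle answers nor more time change an output, so it can be compared with the
  -- run that the halting derivation provides.
  run-unique : ∀ {g c x v ℓ n w} → g ⊢ c · x ⇓ v → ℓ ⊑ (suc ∘ g) → run ℓ n (encode c) x ≡ suc w → w ≡ v
  run-unique {g} {c} {x} {ℓ = ℓ} {n} p ℓ⊑g eq with run-complete p
  ... | u , n′ , r = suc-injective (trans (sym (run-more {suc ∘ g} {n} {n ⊔ n′} {encode c} {x} (m≤m⊔n n n′) (run-mono {ℓ} {suc ∘ g} {n} {encode c} {x} ℓ⊑g eq)))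
    (r (suc ∘ g) (λ _ _ → refl) (n ⊔ n′) (m≤n⊔m n n′)))

-- Lists as oracles

tail : ℕ → ℕ
tail s = snd (pred s)

get : ℕ → ℕ → ℕ
get s a = ifz (iterate tail a s) 0 (suc (fst (pred (iterate tail a s))))

getᴿ : Rec 2 (λ { o (a , s , _) → get s a })
getᴿ = toRec (ifzᵗ drop (lit 0) (sucᵗ (fstᵗ (predᵗ drop)))) (λ o ρ → refl)
  where
  drop : Tm 2
  drop = recᵗ v1 (sndᵗ (predᵗ v0)) v0

get-[] : ∀ a → get 0 a ≡ 0
get-[] a rewrite iterate-stuck tail a {0} (snd-def 0) = refl

get-suc : ∀ x r a → get (suc ⟨ x , r ⟩) (suc a) ≡ get r a
get-suc x r a rewrite iterate-suc tail a (suc ⟨ x , r ⟩) | snd-⟨⟩ x r = refl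

get-↾-< : ∀ {n a} f → a < n → get (encodeList (f ↾ n)) a ≡ suc (f a)
get-↾-< {suc n} {zero}  f _         = cong suc (fst-⟨⟩ (f 0) _)
get-↾-< {suc n} {suc a} f (s≤s a<n) = trans (get-suc (f 0) _ a) (get-↾-< (f ∘ suc) a<n)

get-↾-≥ : ∀ {n a} f → n ≤ a → get (encodeList (f ↾ n)) a ≡ 0
get-↾-≥ {zero}  {a}     f _         = get-[] a
get-↾-≥ {suc n} {suc a} f (s≤s n≤a) = trans (get-suc (f 0) _ a) (get-↾-≥ (f ∘ suc) n≤a)

get-⊑ : ∀ f n → get (encodeList (f ↾ n)) ⊑ (suc ∘ f)
get-⊑ f n a with a <? n
... | yes a<n = inj₂ (get-↾-< f a<n)
... | no  a≮n = inj₁ (get-↾-≥ f (≮⇒≥ a≮n))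

-- Hence the code of `f ↾ n` itself can serve as a time bound and as a search bound.
n≤encodeList : ∀ f n → n ≤ encodeList (f ↾ n)
n≤encodeList f zero    = z≤n
n≤encodeList f (suc n) = s≤s (≤-trans (n≤encodeList (f ∘ suc) n) (m≤m+n _ _))

encodeList-mono : ∀ f n → encodeList (f ↾ n) ≤ encodeList (f ↾ suc n)
encodeList-mono f zero    = z≤n
encodeList-mono f (suc n) = s≤s
  (+-mono-≤ (encodeList-mono (f ∘ suc) n) (triangle-mono (+-monoʳ-≤ (f 0) (encodeList-mono (f ∘ suc) n))))

computable : ∀ {θ} (t : Tm 1) → (∀ σ → ⟦ t ⟧ (λ _ → 0) (encodeList σ , tt) ≡ θ σ) → Computable θ
computable t eq = comp (compile t) (pair idn zer) , λ σ →
  comp (pair idn zer) (subst (_ ⊢ compile t · _ ⇓_) (eq σ) (compile⇓ t _ (encodeList σ , tt)))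

-- The computable condition on f ↾ s runs the programs deciding φ for the
-- arguments n below (the code of) f ↾ s with f ↾ s as their oracle.
module _ (φ : Fm 1) where
  private
    program : Code
    program = compile (χ φ)

    unrefuted : Fm 1
    -- `run` yields 0 if undecided and 1 if `χ φ` has the value 0, so `≤ 1` rules out exactly a
    -- refutation. The argument `pr n 0` codes an environment with the single entry `n`.
    unrefuted = all< v0 (runᴿ (getᴿ · (v0 ∷ v1 ∷ [])) · (v1 ∷ lit (encode program) ∷ prᵗ v0 (lit 0) ∷ v1 ∷ []) ≤ᶠ lit 1)

    θ : List ℕ → ℕ
    θ σ = ⟦ χ unrefuted ⟧ (λ _ → 0) (encodeList σ , tt)

    program⇓ : ∀ f n → f ⊢ program · pr n 0 ⇓ ⟦ χ φ ⟧ f (n , tt)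
    program⇓ f n = subst (λ x → f ⊢ program · x ⇓ ⟦ χ φ ⟧ f (n , tt)) (⟨⟩≡pr n 0) (compile⇓ (χ φ) f (n , tt))

    sound : ∀ f → (∀ n → ⟪ φ ⟫ f (n , tt)) → ∀ s → θ (f ↾ s) ≡ 0
    sound f h s = χ-holds unrefuted (λ _ → 0) (encodeList (f ↾ s) , tt) .from bounded
      where
      bounded : ∀ n → n < encodeList (f ↾ s) →
                run (get (encodeList (f ↾ s))) (encodeList (f ↾ s)) (encode program) (pr n 0) ≤ 1
      bounded n _ with run (get (encodeList (f ↾ s))) (encodeList (f ↾ s)) (encode program) (pr n 0) in eq
      ... | zero  = z≤n
      ... | suc w = s≤s (≤-reflexive (trans
        (run-unique {c = program} {n = encodeList (f ↾ s)} (program⇓ f n) (get-⊑ f s) eq)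
        (χ-holds φ f (n , tt) .from (h n))))

    complete : ∀ f → (∀ s → θ (f ↾ s) ≡ 0) → ∀ n → ⟪ φ ⟫ f (n , tt)
    complete f h n with run-complete {c = program} (program⇓ f n)
    ... | u , k , r = χ-holds φ f (n , tt) .to (n≤0⇒n≡0 (s≤s⁻¹ (≤-trans
      (≤-reflexive (sym (r (get σ) (λ a a<u → get-↾-< f (<-≤-trans a<u (≤-trans (m≤m⊔n u k) (m≤m⊔n _ (suc n)))))
                            σ (≤-trans (≤-trans (m≤n⊔m u k) (m≤m⊔n _ (suc n))) (n≤encodeList f s)))))
      (χ-holds unrefuted (λ _ → 0) (σ , tt) .to (h s) n (≤-trans (m≤n⊔m (u ⊔ k) (suc n)) (n≤encodeList f s))))))
      where
      s = u ⊔ k ⊔ suc n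
      σ = encodeList (f ↾ s)

  isΠ⁰₁ : ∀ A → (∀ f → f ∈ A ⇔ (2^ℕ f × (∀ n → ⟪ φ ⟫ f (n , tt)))) → IsΠ⁰₁ A
  isΠ⁰₁ A eq = θ , computable (χ unrefuted) (λ σ → refl) , λ f → mk⇔
    (λ f∈A → proj₁ (eq f .to f∈A) , sound f (proj₂ (eq f .to f∈A)))
    (λ (bin , h) → eq f .from (bin , complete f h))

-- Turing reducibility

infix 4 _≤ᵀ_
_≤ᵀ_ : Baire → Baire → Set
f ≤ᵀ g = ∃[ c ] ∀ n → g ⊢ c · n ⇓ f n

relativize : Code → Code → Code
relativize zer        d = zer
relativize succ       d = succ
relativize idn        d = idn
relativize left       d = left
relativize right      d = right
relativize oracle     d = d
relativize (pair a b) d = pair (relativize a d) (relativize b d)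
relativize (comp a b) d = comp (relativize a d) (relativize b d)
relativize (prec a b) d = prec (relativize a d) (relativize b d)
relativize (mini a)   d = mini (relativize a d)

module _ {g h : Baire} {d : Code} (d⇓ : ∀ n → g ⊢ d · n ⇓ h n) where mutual

  relativize⇓ : ∀ {c x v} → h ⊢ c · x ⇓ v → g ⊢ relativize c d · x ⇓ v
  relativize⇓ zer          = zer
  relativize⇓ succ         = succ
  relativize⇓ idn          = idn
  relativize⇓ left         = left
  relativize⇓ right        = right
  relativize⇓ oracle       = d⇓ _
  relativize⇓ (pair p q)   = pair (relativize⇓ p) (relativize⇓ q)
  relativize⇓ (comp p q)   = comp (relativize⇓ p) (relativize⇓ q)
  relativize⇓ (prec p)     = prec (relativize-rec⇓ p)
  relativize⇓ (mini k f p) = mini k (λ m<n → relativize⇓ (f m<n)) (relativize⇓ p)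

  relativize-rec⇓ : ∀ {a b x n v} → h ⊢rec a , b · x , n ⇓ v → g ⊢rec relativize a d , relativize b d · x , n ⇓ v
  relativize-rec⇓ (base p)   = base (relativize⇓ p)
  relativize-rec⇓ (step p q) = step (relativize-rec⇓ p) (relativize⇓ q)

≤ᵀ-trans : ∀ {f g h} → f ≤ᵀ g → g ≤ᵀ h → f ≤ᵀ h
≤ᵀ-trans (c , c⇓) (d , d⇓) = relativize c d , λ n → relativize⇓ d⇓ (c⇓ n)

Φ⇒≤ᵀ : ∀ {e f g} → graph (Φ e) g f → f ≤ᵀ g
Φ⇒≤ᵀ (c , _ , c⇓) = c , c⇓

tm⇓ : ∀ (t : Tm 1) o n → o ⊢ comp (compile t) (pair idn zer) · n ⇓ ⟦ t ⟧ o (n , tt)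
tm⇓ t o n = comp (pair idn zer) (compile⇓ t o (n , tt))

tm-≤ᵀ : ∀ {f g} (t : Tm 1) → (∀ n → ⟦ t ⟧ g (n , tt) ≡ f n) → f ≤ᵀ g
tm-≤ᵀ {f} {g} t eq = comp (compile t) (pair idn zer) , λ n → subst (g ⊢ _ · n ⇓_) (eq n) (tm⇓ t g n)

recᶜ-cases⇓ : ∀ {o z s k x v w n} → o ⊢ z · x ⇓ v → o ⊢ s · x ⇓ w → o ⊢ k · x ⇓ n →
              o ⊢ recᶜ z (comp s (comp right right)) k · x ⇓ ifz n v w
recᶜ-cases⇓ zv sw kn = rec⇓ zv kn λ i r → comp (comp (right⇓ r _) (right⇓ i _)) sw

-- Binary digits

half parity : ℕ → ℕ
half zero          = 0
half (suc zero)    = 0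
half (suc (suc n)) = suc (half n)
parity zero          = 0
parity (suc zero)    = 1
parity (suc (suc n)) = parity n

parity-suc : ∀ n → parity (suc n) ≡ 1 ∸ parity n
parity-suc zero          = refl
parity-suc (suc zero)    = refl
parity-suc (suc (suc n)) = parity-suc n

half-suc : ∀ n → half (suc n) ≡ half n + parity n
half-suc zero          = refl
half-suc (suc zero)    = refl
half-suc (suc (suc n)) = cong suc (half-suc n)

parity<2 : ∀ n → parity n < 2
parity<2 zero          = s≤s z≤n
parity<2 (suc zero)    = s≤s (s≤s z≤n)
parity<2 (suc (suc n)) = parity<2 n

parityᴿ : Rec 1 (λ { o (n , _) → parity n })
parityᴿ = toRec (recᵗ (lit 0) (lit 1 ∸ᵗ v0) v0) (λ { o (n , _) → go n })
  where
  go : ∀ n → natrec 0 (λ _ r → 1 ∸ r) n ≡ parity n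
  go zero    = refl
  go (suc n) = trans (cong (1 ∸_) (go n)) (sym (parity-suc n))

halfᴿ : Rec 1 (λ { o (n , _) → half n })
halfᴿ = toRec (recᵗ (lit 0) (v0 +ᵗ parityᴿ · (v1 ∷ [])) v0) (λ { o (n , _) → go n })
  where
  go : ∀ n → natrec 0 (λ i r → r + parity i) n ≡ half n
  go zero    = refl
  go (suc n) = trans (cong (_+ parity n) (go n)) (sym (half-suc n))

double-suc : ∀ b y → b + (suc y + suc y) ≡ suc (suc (b + (y + y)))
double-suc b y = trans (cong (b +_) (cong suc (+-suc y y))) (trans (+-suc b _) (cong suc (+-suc b _)))

parity-double : ∀ {b} y → b < 2 → parity (b + (y + y)) ≡ b
parity-double {zero}     zero    _ = refl
parity-double {suc zero} zero    _ = refl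
parity-double {suc (suc b)} zero (s≤s (s≤s ()))
parity-double {b}        (suc y) p = trans (cong parity (double-suc b y)) (parity-double y p)

half-double : ∀ {b} y → b < 2 → half (b + (y + y)) ≡ y
half-double {zero}     zero    _ = refl
half-double {suc zero} zero    _ = refl
half-double {suc (suc b)} zero (s≤s (s≤s ()))
half-double {b}        (suc y) p = trans (cong half (double-suc b y)) (cong suc (half-double y p))

parity+half : ∀ n → parity n + (half n + half n) ≡ n
parity+half zero          = refl
parity+half (suc zero)    = refl
parity+half (suc (suc n)) = trans (double-suc (parity n) (half n)) (cong (λ k → suc (suc k)) (parity+half n))

bit : ℕ → ℕ → ℕ
bit c zero    = parity c
bit c (suc i) = bit (half c) i

bit<2 : ∀ c i → bit c i < 2
bit<2 c zero    = parity<2 c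
bit<2 c (suc i) = bit<2 (half c) i

bitᴿ : Rec 2 (λ { o (c , i , _) → bit c i })
bitᴿ = toRec (parityᴿ · (recᵗ v0 (halfᴿ · (v0 ∷ [])) v1 ∷ [])) (λ { o (c , i , _) → go c i })
  where
  go : ∀ c i → parity (iterate half i c) ≡ bit c i
  go c zero    = refl
  go c (suc i) = trans (cong parity (iterate-suc half i c)) (go (half c) i)

val : Baire → ℕ → ℕ
val x zero    = 0
val x (suc n) = x 0 + (val (x ∘ suc) n + val (x ∘ suc) n)

bit-val : ∀ {x n i} → (∀ i → i < n → x i < 2) → i < n → bit (val x n) i ≡ x i
bit-val {x} {suc n} {zero}  h _         = parity-double (val (x ∘ suc) n) (h 0 (s≤s z≤n))
bit-val {x} {suc n} {suc i} h (s≤s i<n) =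
  trans (cong (λ c → bit c i) (half-double (val (x ∘ suc) n) (h 0 (s≤s z≤n)))) (bit-val (λ i i<n → h (suc i) (s≤s i<n)) i<n)

val<2^ : ∀ {x} n → (∀ i → i < n → x i < 2) → val x n < 2 ^ n
val<2^ zero    h = s≤s z≤n
val<2^ {x} (suc n) h = ≤-trans (s≤s (+-monoˡ-≤ _ (s≤s⁻¹ (h 0 (s≤s z≤n)))))
  (≤-trans (≤-reflexive (sym (double-suc 0 (val (x ∘ suc) n))))
    (+-mono-≤ ih (≤-trans ih (≤-reflexive (sym (+-identityʳ _))))))
  where ih = val<2^ {x ∘ suc} n (λ i i<n → h (suc i) (s≤s i<n))

val-cong : ∀ {x y} n → (∀ i → i < n → x i ≡ y i) → val x n ≡ val y n
val-cong zero    h = refl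
val-cong (suc n) h = cong₂ (λ b c → b + (c + c)) (h 0 (s≤s z≤n)) (val-cong n λ i i<n → h (suc i) (s≤s i<n))

val-bit : ∀ {c} n → c < 2 ^ n → val (bit c) n ≡ c
val-bit {zero}  zero    _ = refl
val-bit {suc c} zero    (s≤s ())
val-bit {c}     (suc n) c<2^n = trans (cong (λ h → parity c + (h + h)) (val-bit n half<)) (parity+half c)
  where
  half< : half c < 2 ^ n
  half< with half c <? 2 ^ n
  ... | yes p = p
  ... | no ¬p = contradiction c<2^n (≤⇒≯ (≤-trans (+-mono-≤ (≮⇒≥ ¬p) (≤-trans (≤-reflexive (+-identityʳ _)) (≮⇒≥ ¬p)))
                  (≤-trans (m≤n+m _ (parity c)) (≤-reflexive (parity+half c)))))

powᴿ : Rec 1 (λ { o (n , _) → 2 ^ n })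
powᴿ = toRec (recᵗ (lit 1) (lit 2 *ᵗ v0) v0) (λ { o (n , _) → go n })
  where
  go : ∀ n → natrec 1 (λ _ r → 2 * r) n ≡ 2 ^ n
  go zero    = refl
  go (suc n) = cong (2 *_) (go n)

1≤2^ : ∀ n → 1 ≤ 2 ^ n
1≤2^ n = m^n>0 2 n

n<2^n : ∀ n → n < 2 ^ n
n<2^n zero    = s≤s z≤n
n<2^n (suc n) = +-mono-≤ (1≤2^ n) (≤-trans (n<2^n n) (m≤m+n _ 0))

-- Pigeonhole, by recursion on `κ`: the value `p κ` is cut out of the range by moving down what lies
-- above it, and the witness found there is moved back up.
fresh : ∀ κ (p : ℕ → ℕ) → ∃[ c ] c ≤ κ × ∀ k → k < κ → p k ≢ c
fresh zero    p = 0 , z≤n , λ _ ()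
fresh (suc κ) p = punchIn , bound , avoids
  where
  squash : ℕ → ℕ
  squash x with x ≤? p κ
  ... | yes _ = x
  ... | no  _ = pred x
  ih = fresh κ (squash ∘ p)
  c = proj₁ ih
  punchIn : ℕ
  punchIn with c <? p κ
  ... | yes _ = c
  ... | no  _ = suc c
  bound : punchIn ≤ suc κ
  bound with c <? p κ
  ... | yes _ = m≤n⇒m≤1+n (proj₁ (proj₂ ih))
  ... | no  _ = s≤s (proj₁ (proj₂ ih))
  new : punchIn ≢ p κ
  new with c <? p κ
  ... | yes c<p = <⇒≢ c<p
  ... | no  c≮p = ≢-sym (<⇒≢ (s≤s (≮⇒≥ c≮p)))
  squash-punchIn : squash punchIn ≡ c
  squash-punchIn with c <? p κ
  squash-punchIn | yes c<p with c ≤? p κ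
  ... | yes _   = refl
  ... | no  c≰p = contradiction (<⇒≤ c<p) c≰p
  squash-punchIn | no c≮p with suc c ≤? p κ
  ... | yes c<p = contradiction c<p c≮p
  ... | no  _   = refl
  avoids : ∀ k → k < suc κ → p k ≢ punchIn
  avoids k k<1+κ eq with m≤n⇒m<n∨m≡n (s≤s⁻¹ k<1+κ)
  ... | inj₁ k<κ  = proj₂ (proj₂ ih) k k<κ (trans (cong squash eq) squash-punchIn)
  ... | inj₂ refl = new (sym eq)

-- The addresses of Baire space are divided into levels B n, …, B (n + 1) - 1,
-- and level n into 2 ^ B n blocks of length L n, one for each binary string of
-- length B n.
L B : ℕ → ℕ
L n = 2 ^ n
B zero    = 0
B (suc n) = B n + 2 ^ B n * L n

addr : ℕ → ℕ → ℕ → ℕ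
addr n v j = B n + (v * L n + j)

level : ℕ → ℕ
level zero    = 0
level (suc a) with B (suc (level a)) ≤? suc a
... | yes _ = suc (level a)
... | no  _ = level a

B<B : ∀ n → B n < B (suc n)
B<B n = ≤-trans (≤-reflexive (+-comm 1 (B n))) (+-monoʳ-≤ (B n) (*-mono-≤ (1≤2^ (B n)) (1≤2^ n)))

B-mono : ∀ {m n} → m ≤ n → B m ≤ B n
B-mono {n = zero}  z≤n = ≤-refl
B-mono {m} {suc n} m≤1+n with m≤n⇒m<n∨m≡n m≤1+n
... | inj₁ m<1+n = ≤-trans (B-mono (s≤s⁻¹ m<1+n)) (<⇒≤ (B<B n))
... | inj₂ refl  = ≤-refl

n≤B : ∀ n → n ≤ B n
n≤B zero    = z≤n
n≤B (suc n) = ≤-trans (s≤s (n≤B n)) (B<B n)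

level-bounds : ∀ a → B (level a) ≤ a × a < B (suc (level a))
level-bounds zero    = z≤n , B<B 0
level-bounds (suc a) with B (suc (level a)) ≤? suc a
... | yes p = p , ≤-trans (s≤s (proj₂ (level-bounds a))) (B<B (suc (level a)))
... | no ¬p = m≤n⇒m≤1+n (proj₁ (level-bounds a)) , ≰⇒> ¬p

level-unique : ∀ {a n} → B n ≤ a → a < B (suc n) → level a ≡ n
level-unique {a} {n} p q with <-cmp (level a) n
... | tri< l<n _ _ = contradiction (≤-trans (proj₂ (level-bounds a)) (≤-trans (B-mono l<n) p)) (<-irrefl refl)
... | tri≈ _ eq _  = eq
... | tri> _ _ n<l = contradiction (≤-trans q (≤-trans (B-mono n<l) (proj₁ (level-bounds a)))) (<-irrefl refl)

<B⇒level< : ∀ {a n} → a < B n → level a < n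
<B⇒level< {a} {n} a<B with level a <? n
... | yes p = p
... | no ¬p = contradiction (≤-trans a<B (≤-trans (B-mono (≮⇒≥ ¬p)) (proj₁ (level-bounds a)))) (<-irrefl refl)

addr-< : ∀ {n v j} → v < 2 ^ B n → j < L n → addr n v j < B (suc n)
addr-< {n} {v} {j} v< j< = ≤-trans (≤-reflexive (sym (+-suc (B n) _))) (+-monoʳ-≤ (B n)
  (≤-trans (≤-trans (≤-reflexive (sym (+-suc (v * L n) j))) (+-monoʳ-≤ (v * L n) j<))
    (≤-trans (≤-reflexive (+-comm (v * L n) (L n))) (*-monoˡ-≤ (L n) v<))))

B≤addr : ∀ n v j → B n ≤ addr n v j
B≤addr n v j = m≤m+n (B n) _

level-addr : ∀ {n v j} → v < 2 ^ B n → j < L n → level (addr n v j) ≡ n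
level-addr {n} {v} {j} v< j< = level-unique {n = n} (B≤addr n v j) (addr-< {n} v< j<)

Bᴿ : Rec 1 (λ { o (n , _) → B n })
Bᴿ = toRec (recᵗ (lit 0) (v0 +ᵗ powᴿ · (v0 ∷ []) *ᵗ powᴿ · (v1 ∷ [])) v0) (λ { o (n , _) → go n })
  where
  go : ∀ n → natrec 0 (λ n r → r + 2 ^ r * 2 ^ n) n ≡ B n
  go zero    = refl
  go (suc n) = cong (λ r → r + 2 ^ r * 2 ^ n) (go n)

addrᴿ : Rec 3 (λ { o (n , v , j , _) → addr n v j })
addrᴿ = toRec (Bᴿ · (v0 ∷ []) +ᵗ (v1 *ᵗ powᴿ · (v0 ∷ []) +ᵗ v2)) (λ o ρ → refl)

levelᴿ : Rec 1 (λ { o (a , _) → level a })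
levelᴿ = toRec (recᵗ (lit 0) (ifzᵗ (Bᴿ · (sucᵗ v0 ∷ []) ∸ᵗ sucᵗ v1) (sucᵗ v0) v0) v0) (λ { o (a , _) → go a })
  where
  go : ∀ a → natrec 0 (λ a r → ifz (B (suc r) ∸ suc a) (suc r) r) a ≡ level a
  go zero    = refl
  go (suc a) rewrite go a with B (suc (level a)) ≤? suc a
  ... | yes p rewrite m≤n⇒m∸n≡0 p = refl
  ... | no ¬p with B (suc (level a)) ∸ suc a in eq
  ...   | zero  = contradiction (m∸n≡0⇒m≤n eq) ¬p
  ...   | suc _ = refl

/-≡ : ∀ d .{{_ : NonZero d}} q {r} → r < d → (q * d + r) / d ≡ q
/-≡ d q {r} r<d = trans (cong (_/ d) (+-comm (q * d) r))
  (trans (+-distrib-/-∣ʳ r (divides-refl q)) (cong₂ _+_ (m<n⇒m/n≡0 r<d) (m*n/n≡m q d)))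

%-≡ : ∀ d .{{_ : NonZero d}} q {r} → r < d → (q * d + r) % d ≡ r
%-≡ d q {r} r<d = trans (cong (_% d) (+-comm (q * d) r)) (trans ([m+kn]%n≡m%n r q d) (m<n⇒m%n≡m r<d))

digit : (ℕ → ℕ → ℕ) → ℕ → ℕ → ℕ
digit c n r = bit (c n (r / 2 ^ n)) (r % 2 ^ n)
  where instance _ = m^n≢0 2 n

-- The point whose block (n, v) consists of the binary digits of c n v.
blocks : (ℕ → ℕ → ℕ) → Baire
blocks c a = digit c (level a) (a ∸ B (level a))

digit-≡ : ∀ c n v {j} → j < 2 ^ n → digit c n (v * 2 ^ n + j) ≡ bit (c n v) j
digit-≡ c n v j< = cong₂ (λ w i → bit (c n w) i) (/-≡ (2 ^ n) v j<) (%-≡ (2 ^ n) v j<)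
  where instance _ = m^n≢0 2 n

blocks<2 : ∀ c a → blocks c a < 2
blocks<2 c a = bit<2 (c (level a) (r / 2 ^ n)) (r % 2 ^ n)
  where
  n = level a
  r = a ∸ B n
  instance _ = m^n≢0 2 n

blocks-addr : ∀ c {n v j} → v < 2 ^ B n → j < L n → blocks c (addr n v j) ≡ bit (c n v) j
blocks-addr c {n} {v} {j} v< j< = trans
  (cong₂ (digit c) (level-addr {n} {v} {j} v< j<)
    (trans (cong (λ l → addr n v j ∸ B l) (level-addr {n} {v} {j} v< j<)) (m+n∸m≡n (B n) _)))
  (digit-≡ c n v j<)

-- The independent classes X i

-- The largest number of patterns that can be forbidden on a block of length `L n` while one of the
-- `2 ^ L n` patterns remains.
K : ℕ → ℕ
K n = 2 ^ L n ∸ 1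

Kᵗ Lᵗ Bᵗ powᵗ : ∀ {n} → Tm n → Tm n
powᵗ t = powᴿ · (t ∷ [])
Lᵗ t = powᵗ t
Kᵗ t = powᵗ (Lᵗ t) ∸ᵗ lit 1
Bᵗ t = Bᴿ · (t ∷ [])

bitᵗ : ∀ {n} → Tm n → Tm n → Tm n
bitᵗ c i = bitᴿ · (c ∷ i ∷ [])

addrᵗ : ∀ {n} → Tm n → Tm n → Tm n → Tm n
addrᵗ n v j = addrᴿ · (n ∷ v ∷ j ∷ [])

SameBlock : Baire → Baire → ℕ → ℕ → Set
SameBlock x y n v = ∀ j → j < L n → x (addr n v j) ≡ y (addr n v j)

column : ℕ → ℕ → Baire
column δ k a = bit δ (pr k a)

known : ℕ → ℕ → ℕ → ℕ
known τ M a = ifz (suc a ∸ B M) (suc (bit τ a)) 0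

run-known : ℕ → ℕ → ℕ → ℕ → ℕ
run-known τ M e x = run (known τ M) M e x

runKnownᴿ : Rec 4 (λ { o (τ , M , e , x , _) → run-known τ M e x })
runKnownᴿ = toRec (runᴿ known-query · (v1 ∷ v2 ∷ v3 ∷ prᵗ v0 v1 ∷ [])) λ o (τ , M , e , x , _) →
  cong₂ (λ σ N → run (known σ N) M e x) (fst-pr τ M) (snd-pr τ M)
  where
  known-query : Tm 2
  known-query = ifzᵗ (sucᵗ v0 ∸ᵗ Bᵗ (sndᵗ v1)) (sucᵗ (bitᵗ (fstᵗ v1) v0)) (lit 0)

-- Level n is devoted to the program with code program n, which is to compute a
-- member of X (class n).
class program : ℕ → ℕ
class n   = fst (fst n)
program n = snd (fst n)

-- Against any K n forbidden patterns per block on the levels n + 1, …, M - 1,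
-- given by the columns of δ, the binary string v has an extension τ of length
-- B M that avoids them and makes the program of level n output the digits of
-- c on the block (n, v).
Big : ℕ → ℕ → ℕ → ℕ → Set
Big n v c M = n < M × (∀ δ → δ < 2 ^ pr (K n) (B M) → ∃[ τ ] τ < 2 ^ B M ×
  (∀ i → i < B n → bit τ i ≡ bit v i) ×
  (∀ n′ → n′ < M → n < n′ → ∀ v′ → v′ < 2 ^ B n′ → ∀ k → k < K n → ¬ SameBlock (bit τ) (column δ k) n′ v′) ×
  (∀ j → j < L n → run-known τ M (program n) (addr n v j) ≡ suc (bit c j)))

bigᶜ : Char 4 (λ { o (n , v , c , M , _) → Big n v c M })
bigᶜ = toChar
  (v0 <ᶠ v3 ∧ᶠ all< (powᵗ (prᵗ (Kᵗ v0) (Bᵗ v3))) (ex< (powᵗ (Bᵗ v4)) (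
    all< (Bᵗ v2) (bitᵗ v1 v0 ≡ᶠ bitᵗ v4 v0) ∧ᶠ
    all< v5 (v3 <ᶠ v0 ⇒ᶠ all< (powᵗ (Bᵗ v0)) (all< (Kᵗ v4) (¬ᶠ (all< (Lᵗ v2)
      (bitᵗ v4 (addrᵗ v3 v2 v0) ≡ᶠ bitᵗ v5 (prᵗ v1 (addrᵗ v3 v2 v0))))))) ∧ᶠ
    all< (Lᵗ v2) (runKnownᴿ · (v1 ∷ v6 ∷ sndᵗ (fstᵗ v3) ∷ addrᵗ v3 v4 v0 ∷ []) ≡ᶠ sucᵗ (bitᵗ v5 v0)))))
  (λ o ρ → mk⇔ id id)

opaque
  -- `w` codes a bound `fst w` and a pattern `snd w`. Minimality leaves at most one forbidden
  -- pattern per block and is a bounded condition, so the relation is decidable although finding `w`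
  -- is an unbounded search.
  Forbids : ℕ → ℕ → ℕ → Set
  Forbids n v w = Big n v (snd w) (fst w) × (∀ w′ → w′ < w → ¬ Big n v (snd w′) (fst w′))

  forbidsᶜ : Char 3 (λ { o (n , v , w , _) → Forbids n v w })
  forbidsᶜ = toChar
    (bigᶜ ∙ (v0 ∷ v1 ∷ sndᵗ v2 ∷ fstᵗ v2 ∷ []) ∧ᶠ all< v2 (¬ᶠ (bigᶜ ∙ (v1 ∷ v2 ∷ sndᵗ v0 ∷ fstᵗ v0 ∷ []))))
    (λ o ρ → mk⇔ id id)

  forbids-big : ∀ {n v w} → Forbids n v w → Big n v (snd w) (fst w)
  forbids-big = proj₁

  forbids-unique : ∀ {n v w w′} → Forbids n v w → Forbids n v w′ → w ≡ w′
  forbids-unique {w = w} {w′} (p , min) (p′ , min′) with <-cmp w w′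
  ... | tri< w<w′ _ _ = contradiction p (min′ w w<w′)
  ... | tri≈ _ eq _   = eq
  ... | tri> _ _ w′<w = contradiction p′ (min w′ w′<w)

  big-forbids : ∀ {n v w} → Big n v (snd w) (fst w) → ∃[ w ] Forbids n v w
  big-forbids {n} {v} {w} p = search w 0 (λ _ ()) (subst (λ u → Big n v (snd u) (fst u)) (sym (+-identityʳ w)) p)
    where
    search : ∀ d m → (∀ w′ → w′ < m → ¬ Big n v (snd w′) (fst w′)) → Big n v (snd (d + m)) (fst (d + m)) →
             ∃[ w ] Forbids n v w
    search zero    m min p = m , p , min
    search (suc d) m min p with ⟪ bigᶜ ∙ (v0 ∷ v1 ∷ v2 ∷ v3 ∷ []) ⟫? (λ _ → 0) (n , v , snd m , fst m , tt)
    ... | yes q = m , q , min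
    ... | no ¬q = search d (suc m) min′ (subst (λ u → Big n v (snd u) (fst u)) (sym (+-suc d m)) p)
      where
      min′ : ∀ w′ → w′ < suc m → ¬ Big n v (snd w′) (fst w′)
      min′ w′ w′<1+m with m≤n⇒m<n∨m≡n (s≤s⁻¹ w′<1+m)
      ... | inj₁ w′<m = min w′ w′<m
      ... | inj₂ refl = ¬q

Pattern : Baire → ℕ → ℕ → ℕ → Set
Pattern x n v c = ∀ j → j < L n → x (addr n v j) ≡ bit c j

Θ′ : ℕ → Baire → ℕ → ℕ → ℕ → ℕ → Set
Θ′ i x s n v w = addr n v (L n) ≤ s → class n ≡ i → v < 2 ^ B n → Forbids n v w → ¬ Pattern x n v (snd w)

-- The first s digits of x do not exclude x from X i.
Θ : ℕ → Baire → ℕ → Set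
Θ i x s = ∀ y → y < s → Θ′ i x s (fst y) (fst (snd y)) (snd (snd y))

Θᶜ : (lk : Tm 2) → Char 3 (λ { o (i , s , u , _) → Θ i (λ a → ⟦ lk ⟧ o (a , u , tt)) s })
Θᶜ lk = toChar
  (let n = fstᵗ v0 ; v = fstᵗ (sndᵗ v0) ; w = sndᵗ (sndᵗ v0) in
   all< v1 (addrᵗ n v (Lᵗ n) ≤ᶠ v2 ⇒ᶠ fstᵗ (fstᵗ n) ≡ᶠ v1 ⇒ᶠ v <ᶠ powᵗ (Bᵗ n) ⇒ᶠ forbidsᶜ ∙ (n ∷ v ∷ w ∷ []) ⇒ᶠ
     ¬ᶠ (all< (Lᵗ n) (app lk (addrᵗ (fstᵗ v1) (fstᵗ (sndᵗ v1)) v0 ∷ v4 ∷ []) ≡ᶠ bitᵗ (sndᵗ (sndᵗ (sndᵗ v1))) v0))))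
  (λ o ρ → mk⇔ id id)

X : ℕ → Baire → Set
X i x = 2^ℕ x × (∀ s → Θ i x s)

X-elim : ∀ {i x n v w} → X i x → class n ≡ i → v < 2 ^ B n → Forbids n v w → ¬ Pattern x n v (snd w)
X-elim {i} {x} {n} {v} {w} (_ , h) = subst (λ (n , v , w) → Θ′ i x s n v w) triple (h s y (m≤m⊔n (suc y) (addr n v (L n)))) bound
  where
  y = pr n (pr v w)
  s = suc y ⊔ addr n v (L n)
  triple : (fst y , fst (snd y) , snd (snd y)) ≡ (n , v , w)
  triple rewrite fst-pr n (pr v w) | snd-pr n (pr v w) | fst-pr v w | snd-pr v w = refl
  bound : addr n v (L n) ≤ s
  bound = m≤n⊔m (suc y) (addr n v (L n))

Θ-local : ∀ {i x y s} → (∀ a → a < s → x a ≡ y a) → Θ i x s → Θ i y s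
Θ-local {s = s} eq h z z< end c v< f p = h z z< end c v< f λ j j<L →
  trans (eq _ (<-≤-trans (+-monoʳ-< (B (fst z)) (+-monoʳ-< (fst (snd z) * L (fst z)) j<L)) end)) (p j j<L)

Θ-mono : ∀ {i x s s′} → s ≤ s′ → Θ i x s′ → Θ i x s
Θ-mono s≤s′ h y y<s end = h y (<-≤-trans y<s s≤s′) (≤-trans end s≤s′)

Avoid : Baire → Baire → ℕ → Set
Avoid x δ n = ∀ v → v < 2 ^ B n → ¬ SameBlock x δ n v

avoid-cong : ∀ {x y δ ε n} → (∀ a → a < B (suc n) → x a ≡ y a) → (∀ a → a < B (suc n) → δ a ≡ ε a) →
             Avoid x δ n → Avoid y ε n
avoid-cong {n = n} x≡y δ≡ε av v v< same = av v v< λ j j<L →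
  trans (x≡y _ (addr-< {n} v< j<L)) (trans (same j j<L) (sym (δ≡ε _ (addr-< {n} v< j<L))))

-- The levels in S are changed so as to avoid κ forbidden patterns per block.
module Extend {S : ℕ → Set} (S? : ∀ n → Dec (S n)) (δ : ℕ → Baire) (κ : ℕ)
              (κ< : ∀ n → S n → κ < 2 ^ L n) (x : Baire) where

  choice : ℕ → ℕ → ℕ
  choice n v = proj₁ (fresh κ (λ k → val (λ j → δ k (addr n v j)) (L n)))

  extend : Baire
  extend a with S? (level a)
  ... | yes _ = blocks choice a
  ... | no  _ = x a

  extend-binary : 2^ℕ x → 2^ℕ extend
  extend-binary bin a with S? (level a)
  ... | yes _ = blocks<2 choice a
  ... | no  _ = bin a

  extend-off : ∀ {a} → ¬ S (level a) → extend a ≡ x a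
  extend-off {a} ¬s with S? (level a)
  ... | yes s = contradiction s ¬s
  ... | no  _ = refl

  extend-on : ∀ {a} → S (level a) → extend a ≡ blocks choice a
  extend-on {a} s with S? (level a)
  ... | yes _ = refl
  ... | no ¬s = contradiction s ¬s

  extend-avoid : ∀ {n k} → S n → k < κ → Avoid extend (δ k) n
  extend-avoid {n} {k} s k<κ v v< same = proj₂ (proj₂ f) k k<κ (trans
    (val-cong (L n) λ j j<L → trans (sym (same j j<L)) (trans
      (extend-on (subst S (sym (level-addr {n} v< j<L)) s)) (blocks-addr choice {n} v< j<L)))
    (val-bit (L n) (≤-<-trans (proj₁ (proj₂ f)) (κ< n s))))
    where f = fresh κ (λ k → val (λ j → δ k (addr n v j)) (L n))

0<K : ∀ n → 0 < K n
0<K n = ∸-monoˡ-≤ 1 (≤-trans (s≤s (1≤2^ n)) (n<2^n (L n)))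

K<2^L : ∀ {m n} → m ≤ n → K m < 2 ^ L n
K<2^L {m} {n} m≤n = ≤-trans (≤-reflexive (trans (+-comm 1 (K m)) (m∸n+n≡m (1≤2^ (L m))))) (^-monoʳ-≤ 2 (^-monoʳ-≤ 2 m≤n))

K-mono : ∀ {m n} → m ≤ n → K m ≤ K n
K-mono m≤n = ∸-monoˡ-≤ 1 (^-monoʳ-≤ 2 (^-monoʳ-≤ 2 m≤n))

-- Here the doubling of the block lengths is used: with T = `2 ^ L n`, `K (suc n)` is T² - 1 = (T +
-- 1)(T - 1). This is room for T + 1 families of `K n` patterns: the old one, and one for each of
-- the T outputs possible on a block of level `n`.
K-suc : ∀ {n q r} → q ≤ 2 ^ L n → r < K n → q * K n + r < K (suc n)
K-suc {n} {q} {r} q≤ r<K = ≤-trans (≤-trans (≤-reflexive (sym (+-suc (q * K n) r))) (+-mono-≤ (*-monoˡ-≤ (K n) q≤) r<K))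
  (≤-reflexive (sym (trans (cong (_∸ 1) (trans (^-distribˡ-+-* 2 (L n) (L n + 0)) (cong (λ l → 2 ^ L n * 2 ^ l) (+-identityʳ (L n))))) (square (2 ^ L n)))))
  where
  square : ∀ T → T * T ∸ 1 ≡ T * (T ∸ 1) + (T ∸ 1)
  square zero    = refl
  square (suc T) = trans (+-comm T (T * suc T)) (cong (_+ T) (*-comm T (suc T)))

-- Generic points

module Generic (dec : ∀ {P : Set} → Dec P) where

  ¬∀⇒∃¬ : ∀ {A : Set} {P : A → Set} → ¬ (∀ a → P a) → ∃[ a ] ¬ P a
  ¬∀⇒∃¬ {A} {P} ¬∀ with dec {∃[ a ] ¬ P a}
  ... | yes p = p
  ... | no ¬∃ = contradiction (λ a → case dec {P a} of λ { (yes p) → p ; (no ¬p) → contradiction (a , ¬p) ¬∃ }) ¬∀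

  module Cluster (s : ℕ → Baire) (s<2 : ∀ m → 2^ℕ (s m)) where

    Near : Baire → ℕ → Set
    Near t l = ∀ k → ∃[ m ] k ≤ m × (∀ a → a < l → s m a ≡ t a)

    update : Baire → ℕ → ℕ → Baire
    update t l b a with a ≟ l
    ... | yes _ = b
    ... | no  _ = t a

    update-≡ : ∀ t l b → update t l b l ≡ b
    update-≡ t l b with l ≟ l
    ... | yes _ = refl
    ... | no ¬p = contradiction refl ¬p

    update-< : ∀ t l b {a} → a < l → update t l b a ≡ t a
    update-< t l b {a} a<l with a ≟ l
    ... | yes refl = contradiction a<l (<-irrefl refl)
    ... | no  _    = refl

    agree : ∀ {t l b m} → (∀ a → a < l → s m a ≡ t a) → s m l ≡ b → ∀ a → a < suc l → s m a ≡ update t l b a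
    agree {t} {l} {b} h eq a a<1+l with m≤n⇒m<n∨m≡n (s≤s⁻¹ a<1+l)
    ... | inj₁ a<l  = trans (h a a<l) (sym (update-< t l b a<l))
    ... | inj₂ refl = trans eq (sym (update-≡ t l b))

    -- Compactness: if the digit 0 does not recur for ever, then all terms from `k₀` on that agree
    -- with `t` below `l` have the digit 1 at `l`.
    extension : ∀ t l → Near t l → ∃[ b ] Near (update t l b) (suc l)
    extension t l near with dec {Near (update t l 0) (suc l)}
    ... | yes p = 0 , p
    ... | no ¬p with ¬∀⇒∃¬ ¬p
    ...   | k₀ , none = 1 , λ k → case near (k ⊔ k₀) of λ (m , k≤m , eq) →
      m , ≤-trans (m≤m⊔n k k₀) k≤m , agree {m = m} eq
        (≤-antisym (s≤s⁻¹ (s<2 m l)) (n≢0⇒n>0 λ z → none (m , ≤-trans (m≤n⊔m k k₀) k≤m , agree {m = m} eq z)))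

    approximation : ∀ l → ∃[ t ] Near t l
    approximation zero    = (λ _ → 0) , λ k → k , ≤-refl , λ _ ()
    approximation (suc l) = let t , near = approximation l ; b , near′ = extension t l near in update t l b , near′

    limit : Baire
    limit a = proj₁ (approximation (suc a)) a

    approximation-limit : ∀ {l a} → a < l → proj₁ (approximation l) a ≡ limit a
    approximation-limit {suc l} {a} a<1+l with m≤n⇒m<n∨m≡n (s≤s⁻¹ a<1+l)
    ... | inj₂ refl = refl
    ... | inj₁ a<l  = trans (update-< (proj₁ (approximation l)) l _ a<l) (approximation-limit a<l)

    limit-near : ∀ l → Near limit l
    limit-near l k = let m , k≤m , eq = proj₂ (approximation l) k in
      m , k≤m , λ a a<l → trans (eq a a<l) (approximation-limit a<l)

    limit<2 : 2^ℕ limit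
    limit<2 a = let m , _ , eq = limit-near (suc a) 0 in subst (_< 2) (eq a ≤-refl) (s<2 m a)

  forbidden : ℕ → ℕ → ℕ
  forbidden n v with dec {∃[ w ] Forbids n v w}
  ... | yes (w , _) = snd w
  -- A block without a forbidden pattern receives an arbitrary one; avoiding it as well does no
  -- harm.
  ... | no  _       = 0

  D : Baire
  D = blocks forbidden

  D-pattern : ∀ {n v w} → v < 2 ^ B n → Forbids n v w → Pattern D n v (snd w)
  D-pattern {n} {v} {w} v< f j j<L = trans (blocks-addr forbidden {n} v< j<L) (cong (λ c → bit c j) eq)
    where
    eq : forbidden n v ≡ snd w
    eq with dec {∃[ w ] Forbids n v w}
    ... | yes (w′ , f′) = cong snd (forbids-unique f′ f)
    ... | no  none      = contradiction (w , f) none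

  avoid⇒X : ∀ {x} i → 2^ℕ x → (∀ n → Avoid x D n) → X i x
  avoid⇒X i bin av = bin , λ s y y<s end c v< f p → av (fst y) (fst (snd y)) v< λ j j<L → trans (p j j<L) (sym (D-pattern {fst y} v< f j j<L))

-- `Big` does not restrict level `n` of `τ`. That level can be repaired afterwards without affecting
-- the output only if the program does not depend on it.
Ignores : ℕ → Code → Set
Ignores i c = ∀ (y y′ h : Baire) → (∀ a → class (level a) ≢ i → y a ≡ y′ a) →
              (∀ a → y ⊢ c · a ⇓ h a) → ∀ a → y′ ⊢ c · a ⇓ h a

Fails : ℕ → Baire → Set
Fails n y = ∀ c → encode c ≡ program n → Ignores (class n) c → ∀ h → (∀ a → y ⊢ c · a ⇓ h a) → ¬ X (class n) h

eventually-bounded : ∀ {P : ℕ → ℕ → Set} n → (∀ j → j < n → ∃[ u ] ∀ u′ → u ≤ u′ → P j u′) →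
                     ∃[ u ] ∀ j → j < n → ∀ u′ → u ≤ u′ → P j u′
eventually-bounded zero    h = 0 , λ _ ()
eventually-bounded {P} (suc n) h =
  let u , p = h n ≤-refl ; u′ , p′ = eventually-bounded n (λ j j<n → h j (m<n⇒m<1+n j<n)) in
  u ⊔ u′ , λ j j<1+n u″ le → case m≤n⇒m<n∨m≡n (s≤s⁻¹ j<1+n) of λ
    { (inj₁ j<n)  → p′ j j<n u″ (≤-trans (m≤n⊔m u u′) le)
    ; (inj₂ refl) → p u″ (≤-trans (m≤m⊔n u u′) le) }

known-< : ∀ {τ M a} → a < B M → known τ M a ≡ suc (bit τ a)
known-< {τ} {M} {a} a<B = cong (λ d → ifz d (suc (bit τ a)) 0) (m≤n⇒m∸n≡0 a<B)

K<2^L-at : ∀ n m → m ≡ n → K n < 2 ^ L m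
K<2^L-at n m refl = K<2^L {n} ≤-refl

-- Forcing with finite stems and families of forbidden patterns.

module Forcing (dec : ∀ {P : Set} → Dec P) where
  open Generic dec

  -- F 0 = D consists of the patterns forbidden by the classes X i; the other F k
  -- prevent the programs of some earlier levels from producing any output.
  record Condition (N : ℕ) : Set where
    field
      stem      : Baire
      stem<2    : 2^ℕ stem
      stemAvoid : ∀ n → n < N → Avoid stem D n
      F         : ℕ → Baire
      F<2       : ∀ k → 2^ℕ (F k)
      F0        : ∀ a → F 0 a ≡ D a
  open Condition

  infix 4 _allows_
  record _allows_ {N} (C : Condition N) (y : Baire) : Set where
    field
      binary : 2^ℕ y
      agrees : ∀ a → a < B N → y a ≡ stem C a
      avoids : ∀ n → N ≤ n → ∀ k → k < K N → Avoid y (F C k) n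
  open _allows_

  -- `K N` forbidden patterns do not exhaust a block on any level from `N` on.
  allowed : ∀ {N} (C : Condition N) → ∃[ y ] C allows y
  allowed {N} C = extend , record
    { binary = extend-binary (stem<2 C)
    ; agrees = λ a a<B → extend-off (<⇒≱ (<B⇒level< a<B))
    ; avoids = λ n N≤n k k<K → extend-avoid N≤n k<K }
    where open Extend (N ≤?_) (F C) (K N) (λ n → K<2^L) (stem C)

  avoid-same : ∀ x y δ {n N} → n < N → (∀ a → a < B N → x a ≡ y a) → Avoid x δ n → Avoid y δ n
  avoid-same x y δ {n} n<N eq = avoid-cong {x} {y} {δ} {δ} {n} (λ a a< → eq a (<-≤-trans a< (B-mono n<N))) (λ _ _ → refl)

  avoid-≗ : ∀ x δ ε {n} → (∀ a → δ a ≡ ε a) → Avoid x δ n → Avoid x ε n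
  avoid-≗ x δ ε {n} eq = avoid-cong {x} {x} {δ} {ε} {n} (λ _ _ → refl) (λ a _ → eq a)

  allows-D : ∀ {N} {C : Condition N} {y} → C allows y → ∀ n → Avoid y D n
  allows-D {N} {C} {y} al n with n <? N
  ... | yes n<N = avoid-same (stem C) y D n<N (λ a a<B → sym (agrees al a a<B)) (stemAvoid C n n<N)
  ... | no  n≮N = avoid-≗ y (F C 0) D {n} (F0 C) (avoids al n (≮⇒≥ n≮N) 0 (0<K N))

  -- The levels up to `n` are filled from an allowed point. From then on more of the `F k` are in
  -- force, which only shrinks the set of allowed points.
  lift : ∀ {N} (C : Condition N) {n} → N ≤ n → ∃[ C′ ] ∀ {y} → _allows_ {n} C′ y → C allows y
  lift {N} C {n} N≤n = C′ , λ {y} al → record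
    { binary = binary al
    ; agrees = λ a a<B → trans (agrees al a (<-≤-trans a<B (B-mono N≤n))) (agrees x∈C a a<B)
    ; avoids = λ m N≤m k k<K → case m <? n of λ
      { (yes m<n) → avoid-same x y (F C k) m<n (λ a a<B → sym (agrees al a a<B)) (avoids x∈C m N≤m k k<K)
      ; (no  m≮n) → avoids al m (≮⇒≥ m≮n) k (<-≤-trans k<K (K-mono N≤n)) } }
    where
    x = proj₁ (allowed C)
    x∈C = proj₂ (allowed C)
    C′ : Condition n
    C′ = record { stem = x ; stem<2 = binary x∈C ; stemAvoid = λ m _ → allows-D x∈C m ; F = F C ; F<2 = F<2 C ; F0 = F0 C }

  module Decide {n : ℕ} (C : Condition n) where

    -- The stem below `B n` names the block of level `n` on which the program is attacked.
    v : ℕ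
    v = val (stem C) (B n)

    v< : v < 2 ^ B n
    v< = val<2^ (B n) (λ i _ → stem<2 C i)

    Refined : Set
    Refined = ∃[ N ] n < N × ∃[ C′ ] ∀ {y} → _allows_ {N} C′ y → C allows y × Fails n y

    module Found (w : ℕ) (forb : Forbids n v w) where
      c = snd w
      M = fst w

      n<M : n < M
      n<M = proj₁ (forbids-big {n} forb)

      E = pr (K n) (B M)

      -- The families in force, cut off at `B M` and coded by one number, are the opponent's move
      -- that `Big` answers by `τ`.
      δ = val (λ a → F C (fst a) (snd a)) E

      δ-column : ∀ {k a} → k < K n → a < B M → column δ k a ≡ F C k a
      δ-column {k} {a} k<K a<B = trans (bit-val (λ i _ → F<2 C (fst i) (snd i)) (pr-mono-< (<⇒≤ k<K) a<B))
        (cong₂ (F C) (fst-pr k a) (snd-pr k a))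

      response = proj₂ (forbids-big {n} forb) δ (val<2^ E λ i _ → F<2 C (fst i) (snd i))
      τ = proj₁ response
      τ-extends = proj₁ (proj₂ (proj₂ response))
      τ-avoids = proj₁ (proj₂ (proj₂ (proj₂ response)))
      τ-output = proj₂ (proj₂ (proj₂ (proj₂ response)))

      open Extend (_≟ n) (F C) (K n) (K<2^L-at n) (bit τ)

      off : ∀ {a} → level a ≢ n → extend a ≡ bit τ a
      off {a} = extend-off {a}

      extend-stem : ∀ a → a < B n → extend a ≡ stem C a
      extend-stem a a<B = trans (off {a} (<⇒≢ (<B⇒level< a<B)))
        (trans (τ-extends a a<B) (bit-val (λ i _ → stem<2 C i) a<B))

      avoid : ∀ m → n ≤ m → m < M → ∀ k → k < K n → Avoid extend (F C k) m
      avoid m n≤m m<M k k<K with m≤n⇒m<n∨m≡n n≤m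
      ... | inj₂ refl = extend-avoid refl k<K
      ... | inj₁ n<m = λ v′ v′< same → τ-avoids m m<M n<m v′ v′< k k<K λ j j<L →
        trans (sym (off {addr m v′ j} (λ eq → <⇒≢ n<m (trans (sym eq) (level-addr {m} v′< j<L)))))
          (trans (same j j<L) (sym (δ-column k<K (<-≤-trans (addr-< {m} v′< j<L) (B-mono m<M)))))

      C′ : Condition M
      C′ = record
        { stem      = extend
        ; stem<2    = extend-binary (bit<2 τ)
        ; stemAvoid = λ m m<M → case m <? n of λ
          { (yes m<n) → avoid-same (stem C) extend D m<n (λ a a<B → sym (extend-stem a a<B)) (stemAvoid C m m<n)
          ; (no  m≮n) → avoid-≗ extend (F C 0) D {m} (F0 C) (avoid m (≮⇒≥ m≮n) m<M 0 (0<K n)) }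
        ; F = F C ; F<2 = F<2 C ; F0 = F0 C }

      included : ∀ {y} → C′ allows y → C allows y
      included {y} al = record
        { binary = binary al
        ; agrees = λ a a<B → trans (agrees al a (<-≤-trans a<B (B-mono (<⇒≤ n<M)))) (extend-stem a a<B)
        ; avoids = λ m n≤m k k<K → case m <? M of λ
          { (yes m<M) → avoid-same extend y (F C k) m<M (λ a a<B → sym (agrees al a a<B)) (avoid m n≤m m<M k k<K)
          ; (no  m≮M) → avoids al m (≮⇒≥ m≮M) k (<-≤-trans k<K (K-mono (<⇒≤ n<M))) } }

      -- Level n of τ may not be permitted, but the program ignores this level.
      fails : ∀ {y} → C′ allows y → Fails n y
      fails {y} al ce ce-code ignores h ce⇓ h∈X = X-elim {n = n} h∈X refl v< forb λ j j<L →
        sym (run-unique {c = ce} {n = M} (ignores y z h same ce⇓ (addr n v j)) known⊑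
          (trans (cong (λ e → run-known τ M e (addr n v j)) ce-code) (τ-output j j<L)))
        where
        z : Baire
        z a with level a ≟ n
        ... | yes _ = bit τ a
        ... | no  _ = y a
        same : ∀ a → class (level a) ≢ class n → y a ≡ z a
        same a ne with level a ≟ n
        ... | yes eq = contradiction (cong class eq) ne
        ... | no  _  = refl
        z-τ : ∀ a → a < B M → z a ≡ bit τ a
        z-τ a a<B with level a ≟ n
        ... | yes _ = refl
        ... | no ne = trans (agrees al a a<B) (off {a} ne)
        known⊑ : known τ M ⊑ (suc ∘ z)
        known⊑ a with suc a ∸ B M in eq
        ... | zero  = inj₂ (cong suc (sym (z-τ a (m∸n≡0⇒m≤n eq))))
        ... | suc _ = inj₁ refl

      refined : Refined
      refined = M , n<M , C′ , λ al → included al , fails al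

    -- Forbidden patterns to which there is no response for c have a cluster point
    -- δ c; the program never outputs the digits of c on a point avoiding δ c.
    module NotFound (none : ¬ (∃[ w ] Big n v (snd w) (fst w))) where

      Response : ℕ → ℕ → ℕ → Set
      Response δ c M = ∃[ τ ] τ < 2 ^ B M ×
        (∀ i → i < B n → bit τ i ≡ bit v i) ×
        (∀ m → m < M → n < m → ∀ v′ → v′ < 2 ^ B m → ∀ k → k < K n → ¬ SameBlock (bit τ) (column δ k) m v′) ×
        (∀ j → j < L n → run-known τ M (program n) (addr n v j) ≡ suc (bit c j))

      -- The bound `suc n + m` exceeds `n`, so `Big` can fail only for want of a response to some
      -- move.
      unanswered : ∀ c m → ∃[ δ ] ¬ Response δ c (suc n + m)
      unanswered c m with ¬∀⇒∃¬ {P = λ δ → δ < 2 ^ pr (K n) (B (suc n + m)) → Response δ c (suc n + m)}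
        (λ all → none (pr (suc n + m) c , subst₂ (Big n v) (sym (snd-pr _ c)) (sym (fst-pr (suc n + m) c))
          (s≤s (m≤m+n n m) , all)))
      ... | δ , ¬p = δ , λ r → ¬p (λ _ → r)

      bad : ℕ → ℕ → ℕ
      bad c m = proj₁ (unanswered c m)

      -- The moves for all `c` are packed into one point, so that a single cluster point serves
      -- every `c`.
      sequence : ℕ → Baire
      sequence m a = bit (bad (fst a) m) (snd a)

      open Cluster sequence (λ m a → bit<2 (bad (fst a) m) (snd a))

      δ : ℕ → ℕ → Baire
      δ c k a = limit (pr c (pr k a))

      instance
        K-nonZero : NonZero (K n)
        K-nonZero = >-nonZero (0<K n)

      family : ℕ → ℕ → Baire
      family zero    = F C
      family (suc c) = δ c

      F′ : ℕ → Baire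
      -- Index `q * K n + r` is member `r` of family `q`: the old family for `q = 0`, the cluster
      -- point belonging to the output `c` for `q = suc c`.
      F′ i = family (i / K n) (i % K n)

      F′-≡ : ∀ q {r} → r < K n → ∀ a → F′ (q * K n + r) a ≡ family q r a
      F′-≡ q r<K a = cong₂ (λ q r → family q r a) (/-≡ (K n) q r<K) (%-≡ (K n) q r<K)

      family<2 : ∀ q r → 2^ℕ (family q r)
      family<2 zero    r   = F<2 C r
      family<2 (suc c) r a = limit<2 (pr c (pr r a))

      open Extend (_≟ n) (F C) (K n) (K<2^L-at n) (stem C)

      extend-stem : ∀ a → a < B n → extend a ≡ stem C a
      extend-stem a a<B = extend-off {a} (<⇒≢ (<B⇒level< a<B))

      C′ : Condition (suc n)
      C′ = record
        { stem      = extend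
        ; stem<2    = extend-binary (stem<2 C)
        ; stemAvoid = λ m m<1+n → case m≤n⇒m<n∨m≡n (s≤s⁻¹ m<1+n) of λ
          { (inj₁ m<n)  → avoid-same (stem C) extend D m<n (λ a a<B → sym (extend-stem a a<B)) (stemAvoid C m m<n)
          ; (inj₂ refl) → avoid-≗ extend (F C 0) D {m} (F0 C) (extend-avoid {m} refl (0<K n)) }
        ; F         = F′
        ; F<2       = λ i → family<2 (i / K n) (i % K n)
        ; F0        = λ a → trans (F′-≡ 0 (0<K n) a) (F0 C a) }

      avoids-family : ∀ {y} → C′ allows y → ∀ m → n < m → ∀ q → q ≤ 2 ^ L n → ∀ {k} → k < K n → Avoid y (family q k) m
      avoids-family {y} al m n<m q q≤ {k} k<K =
        avoid-≗ y (F′ (q * K n + k)) (family q k) {m} (F′-≡ q k<K) (avoids al m n<m (q * K n + k) (K-suc {n} q≤ k<K))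

      included : ∀ {y} → C′ allows y → C allows y
      included {y} al = record
        { binary = binary al
        ; agrees = λ a a<B → trans (agrees al a (<-trans a<B (B<B n))) (extend-stem a a<B)
        ; avoids = λ m n≤m k k<K → case m≤n⇒m<n∨m≡n n≤m of λ
          { (inj₁ n<m)  → avoids-family al m n<m 0 z≤n k<K
          ; (inj₂ refl) → avoid-same extend y (F C k) {m} {suc n} ≤-refl (λ a a<B → sym (agrees al a a<B)) (extend-avoid {m} refl k<K) } }

      -- An output `c` on the block would need only finitely much of `y`. Some late move `bad c m`
      -- agrees with `δ c` below level `N`, where `y` avoids it already; changing `y` from level `N`
      -- on so as to avoid the rest gives a response to a move that has none.
      fails : ∀ {y} → C′ allows y → Fails n y
      fails {y} al ce ce-code ignores h ce⇓ (h<2 , _) = proj₂ (unanswered c m)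
        ( val z (B M) , val<2^ (B M) (λ i _ → z<2 i)
        , (λ i i<B → trans (bits (<-≤-trans i<B (B-mono (<⇒≤ n<M)))) (trans (off (<-≤-trans i<B (B-mono (≤-trans (n≤1+n n) n<N))))
            (trans (trans (agrees al i (<-trans i<B (B<B n))) (extend-stem i i<B)) (sym (bit-val (λ i _ → stem<2 C i) i<B)))))
        , (λ i i<M n<i v′ v′< k k<K same → avoided i n<i k k<K v′ v′< λ j j<L →
            trans (sym (bits (<-≤-trans (addr-< {i} v′< j<L) (B-mono i<M)))) (same j j<L))
        , λ j j<L → trans (cong (λ e → run-known (val z (B M)) M e (addr n v j)) (sym ce-code))
            (trans (proj₂ halts j j<L U ≤-refl (known (val z (B M)) M) knows M U≤M) (cong suc (sym (bit-val (λ i _ → h<2 _) j<L)))) )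
        where
        c = val (λ j → h (addr n v j)) (L n)
        Halts : ℕ → ℕ → Set
        Halts j u = ∀ ℓ → (∀ a → a < u → ℓ a ≡ suc (y a)) →
                    ∀ t → u ≤ t → run ℓ t (encode ce) (addr n v j) ≡ suc (h (addr n v j))
        halts : ∃[ u ] ∀ j → j < L n → ∀ u′ → u ≤ u′ → Halts j u′
        halts = eventually-bounded {Halts} (L n) λ j _ → case run-complete {c = ce} (ce⇓ (addr n v j)) of λ
          (u , t , r) → u ⊔ t , λ u′ le ℓ eq t′ u′≤t′ →
            r ℓ (λ a a<u → eq a (<-≤-trans a<u (≤-trans (m≤m⊔n u t) le))) t′ (≤-trans (m≤n⊔m u t) (≤-trans le u′≤t′))
        U = proj₁ halts
        -- As `U ≤ N ≤ B N`, all queries of the computation lie below the levels that are going to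
        -- be changed.
        N = suc n + U
        near = limit-near (pr c (pr (K n) (B N))) U
        m = proj₁ near
        M = suc n + m
        n<N : n < N
        n<N = s≤s (m≤m+n n U)
        n<M : n < M
        n<M = s≤s (m≤m+n n m)
        U≤M : U ≤ M
        U≤M = ≤-trans (proj₁ (proj₂ near)) (m≤n+m m (suc n))
        open Extend (N ≤?_) (column (bad c m)) (K n) (λ i N≤i → K<2^L (≤-trans (<⇒≤ n<N) N≤i)) y
          renaming (extend to z; extend-binary to z-binary; extend-off to z-off; extend-avoid to z-avoid) using ()
        z<2 : 2^ℕ z
        z<2 = z-binary (binary al)
        bits : ∀ {a} → a < B M → bit (val z (B M)) a ≡ z a
        bits = bit-val (λ i _ → z<2 i)
        off : ∀ {a} → a < B N → z a ≡ y a
        off {a} a<B = z-off {a} (<⇒≱ (<B⇒level< a<B))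
        column-δ : ∀ {k a} → k < K n → a < B N → δ c k a ≡ column (bad c m) k a
        column-δ {k} {a} k<K a<B = trans (sym (proj₂ (proj₂ near) (pr c (pr k a)) (pr-mono-< {c} ≤-refl (pr-mono-< (<⇒≤ k<K) a<B))))
          (cong₂ (λ c i → bit (bad c m) i) (fst-pr c (pr k a)) (snd-pr c (pr k a)))
        avoided : ∀ i → n < i → ∀ k → k < K n → Avoid z (column (bad c m) k) i
        avoided i n<i k k<K = case i <? N of λ
          { (no  i≮N) → z-avoid {i} (≮⇒≥ i≮N) k<K
          ; (yes i<N) → avoid-cong {y} {z} {δ c k} {column (bad c m) k} {i}
            (λ a a<B → sym (off (<-≤-trans a<B (B-mono i<N))))
            (λ a a<B → column-δ k<K (<-≤-trans a<B (B-mono i<N)))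
            (avoids-family al i n<i (suc c) (val<2^ (L n) λ j _ → h<2 (addr n v j)) k<K) }
        knows : ∀ a → a < U → known (val z (B M)) M a ≡ suc (y a)
        knows a a<U = trans (known-< {val z (B M)} {M} (<-≤-trans a<U (≤-trans U≤M (n≤B M)))) (cong suc (trans (bits (<-≤-trans a<U (≤-trans U≤M (n≤B M)))) (off (<-≤-trans a<U (≤-trans (m≤n+m U (suc n)) (n≤B N))))))

      refined : Refined
      refined = suc n , ≤-refl , C′ , λ al → included al , fails al

    refined : Refined
    refined with dec {∃[ w ] Big n v (snd w) (fst w)}
    ... | yes (w , big) = let w′ , forb = big-forbids {w = w} big in Found.refined w′ forb
    ... | no  none      = NotFound.refined none

  opaque
    stage : ∀ (j : ℕ) {N} (C : Condition N) → ∃[ N′ ] N < N′ × ∃[ C′ ] ∀ {y} → _allows_ {N′} C′ y →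
            C allows y × (∃[ N ] Fails (pr j N) y)
    -- The second component `N` picks, among the levels for task `j`, one that the stem has not yet
    -- passed.
    stage j {N} C with lift C {pr j N} (y≤pr j N)
    ... | C₁ , sub₁ with Decide.refined C₁
    ...   | N′ , lt , C′ , sub = N′ , ≤-<-trans (y≤pr j N) lt , C′ , λ al → sub₁ (proj₁ (sub al)) , N , proj₂ (sub al)

  initial : Condition 0
  initial = record { stem = λ _ → 0 ; stem<2 = λ _ → s≤s z≤n ; stemAvoid = λ _ () ; F = λ _ → D
                   ; F<2 = λ _ → blocks<2 forbidden ; F0 = λ _ → refl }

  chain : ℕ → ∃ Condition
  chain zero    = 0 , initial
  chain (suc j) = let N , C = chain j ; N′ , _ , C′ , _ = stage j C in N′ , C′

  levels : ℕ → ℕ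
  levels j = proj₁ (chain j)

  condition : ∀ j → Condition (levels j)
  condition j = proj₂ (chain j)

  levels-< : ∀ j → levels j < levels (suc j)
  levels-< j = proj₁ (proj₂ (stage j (condition j)))

  j≤levels : ∀ j → j ≤ levels j
  j≤levels zero    = z≤n
  j≤levels (suc j) = ≤-trans (s≤s (j≤levels j)) (levels-< j)

  included : ∀ {j k y} → j ≤ k → condition k allows y → condition j allows y
  included {j} {k} j≤k al with m≤n⇒m<n∨m≡n j≤k
  ... | inj₂ refl = al
  included {j} {suc k} j≤k al | inj₁ j<1+k =
    included (s≤s⁻¹ j<1+k) (proj₁ (proj₂ (proj₂ (proj₂ (stage k (condition k)))) al))

  member : ℕ → Baire
  member j = proj₁ (allowed (condition j))

  member∈ : ∀ j → condition j allows member j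
  member∈ j = proj₂ (allowed (condition j))

  member-agrees : ∀ {j k} → j ≤ k → ∀ a → a < B (levels j) → member k a ≡ stem (condition j) a
  member-agrees {j} {k} j≤k = agrees (included {j} {k} j≤k (member∈ k))

  -- Stage `suc a` has settled the digit `a`, because `a < suc a ≤ levels (suc a) ≤ B (levels (suc
  -- a))`.
  G : Baire
  G a = member (suc a) a

  G-member : ∀ j a → a < B (levels j) → G a ≡ member j a
  G-member j a a<B with ≤-total j (suc a)
  ... | inj₁ j≤ = trans (member-agrees j≤ a a<B) (sym (member-agrees {j} {j} ≤-refl a a<B))
  ... | inj₂ ≤j = trans (member-agrees {suc a} ≤-refl a a<B′) (sym (member-agrees ≤j a a<B′))
    where a<B′ = ≤-trans (j≤levels (suc a)) (n≤B (levels (suc a)))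

  G-allowed : ∀ j → condition j allows G
  G-allowed j = record
    { binary = λ a → binary (member∈ (suc a)) a
    ; agrees = λ a a<B → trans (G-member j a a<B) (member-agrees {j} {j} ≤-refl a a<B)
    -- Avoidance on level `n` concerns finitely many digits, so it passes from a member of a late
    -- stage to the limit.
    ; avoids = λ n le k k<K → let i = j ⊔ suc n in
        avoid-same (member i) G (F (condition j) k) {n} {levels i} (≤-trans (m≤n⊔m j (suc n)) (j≤levels i))
          (λ a a<B → sym (G-member i a a<B)) (avoids (included (m≤m⊔n j (suc n)) (member∈ i)) n le k k<K) }

  G∈X : ∀ i → X i G
  G∈X i = avoid⇒X i (binary (G-allowed 0)) (allows-D (G-allowed 0))

  G-fails : ∀ j → ∃[ N ] Fails (pr j N) G
  G-fails j = proj₂ (proj₂ (proj₂ (proj₂ (stage j (condition j)))) (G-allowed (suc j)))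

-- Independence

distance : ℕ → ℕ → ℕ
distance m n = (m ∸ n) + (n ∸ m)

distance≡0 : ∀ {m n} → distance m n ≡ 0 → m ≡ n
distance≡0 {m} {n} eq = ≤-antisym (m∸n≡0⇒m≤n (m+n≡0⇒m≡0 _ eq)) (m∸n≡0⇒m≤n (m+n≡0⇒n≡0 (m ∸ n) eq))

distance-refl : ∀ n → distance n n ≡ 0
distance-refl n rewrite n∸n≡0 n = refl

only mask : ℕ → Baire → Baire
only i x a = ifz (distance (class (level a)) i) (x a) 0
mask i x a = ifz (distance (class (level a)) i) 0 (x a)

classDistanceᵗ : ℕ → Tm 1
classDistanceᵗ i = (c ∸ᵗ lit i) +ᵗ (lit i ∸ᵗ c)
  where
  c : Tm 1
  c = fstᵗ (fstᵗ (levelᴿ · (v0 ∷ [])))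

onlyᵗ maskᵗ : ℕ → Tm 1
onlyᵗ i = ifzᵗ (classDistanceᵗ i) (orc v0) (lit 0)
maskᵗ i = ifzᵗ (classDistanceᵗ i) (lit 0) (orc v0)

only-≡ : ∀ {i} x {a} → class (level a) ≡ i → only i x a ≡ x a
only-≡ x {a} refl rewrite distance-refl (class (level a)) = refl

mask-cong : ∀ {i x y} → (∀ a → class (level a) ≢ i → x a ≡ y a) → ∀ a → mask i x a ≡ mask i y a
mask-cong {i} eq a with distance (class (level a)) i in d
... | zero  = refl
... | suc _ = eq a λ e → case trans (sym d) (trans (cong (distance (class (level a))) (sym e)) (distance-refl (class (level a)))) of λ ()

only-mask : ∀ {i j} x → i ≢ j → ∀ a → only i (mask j x) a ≡ only i x a
only-mask {i} {j} x i≢j a with distance (class (level a)) i in d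
... | suc _ = refl
... | zero with distance (class (level a)) j in e
...   | suc _ = refl
...   | zero  = contradiction (trans (sym (distance≡0 {class (level a)} d)) (distance≡0 {class (level a)} e)) i≢j

-- Membership in `X i` beyond being binary inspects blocks of levels of class `i` only.
X-only : ∀ {i x} → X i x → X i (only i x)
X-only {i} {x} (x<2 , θ) = binary , λ s y y<s end c v< f p → θ s y y<s end c v< f λ j j<L →
  trans (sym (only-≡ x (trans (cong class (level-addr {fst y} v< j<L)) c))) (p j j<L)
  where
  binary : 2^ℕ (only i x)
  binary a with distance (class (level a)) i
  ... | zero  = x<2 a
  ... | suc _ = s≤s z≤n

module _ {g g′ : Baire} {d : Code} (transfer : ∀ n v → g ⊢ d · n ⇓ v → g′ ⊢ d · n ⇓ v) where mutual

  relativize-transfer : ∀ c {x v} → g ⊢ relativize c d · x ⇓ v → g′ ⊢ relativize c d · x ⇓ v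
  relativize-transfer zer        zer          = zer
  relativize-transfer succ       succ         = succ
  relativize-transfer idn        idn          = idn
  relativize-transfer left       left         = left
  relativize-transfer right      right        = right
  relativize-transfer oracle     p            = transfer _ _ p
  relativize-transfer (pair a b) (pair p q)   = pair (relativize-transfer a p) (relativize-transfer b q)
  relativize-transfer (comp a b) (comp p q)   = comp (relativize-transfer b p) (relativize-transfer a q)
  relativize-transfer (prec a b) (prec p)     = prec (relativize-rec-transfer a b p)
  relativize-transfer (mini a)   (mini k f p) = mini k (λ m<n → relativize-transfer a (f m<n)) (relativize-transfer a p)

  relativize-rec-transfer : ∀ a b {x n v} → g ⊢rec relativize a d , relativize b d · x , n ⇓ v →
                            g′ ⊢rec relativize a d , relativize b d · x , n ⇓ v
  relativize-rec-transfer a b (base p)   = base (relativize-transfer a p)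
  relativize-rec-transfer a b (step p q) = step (relativize-rec-transfer a b p) (relativize-transfer b q)

maskᶜ : ℕ → Code
maskᶜ i = comp (compile (maskᵗ i)) (pair idn zer)

relativize-ignores : ∀ i c → Ignores i (relativize c (maskᶜ i))
relativize-ignores i c y y′ h eq h⇓ a = relativize-transfer transfer c (h⇓ a)
  where
  transfer : ∀ n v → y ⊢ maskᶜ i · n ⇓ v → y′ ⊢ maskᶜ i · n ⇓ v
  transfer n v p = subst (y′ ⊢ maskᶜ i · n ⇓_)
    (trans (sym (mask-cong {i} {y} {y′} eq n)) (⇓-functional (tm⇓ (maskᵗ i) y n) p)) (tm⇓ (maskᵗ i) y′ n)

fails⇒¬X : ∀ {i N d x h} → Fails (pr (pr i (encode d)) N) x → Ignores i d → (∀ a → x ⊢ d · a ⇓ h a) → ¬ X i h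
fails⇒¬X {i} {N} {d} {h = h} fails ignores d⇓ h∈X =
  fails d (sym program≡) (subst (λ j → Ignores j d) (sym class≡) ignores) h d⇓ (subst (λ j → X j h) (sym class≡) h∈X)
  where
  class≡ : class (pr (pr i (encode d)) N) ≡ i
  class≡ = trans (cong fst (fst-pr _ N)) (fst-pr i _)
  program≡ : program (pr (pr i (encode d)) N) ≡ encode d
  program≡ = trans (cong snd (fst-pr _ N)) (snd-pr i _)

module Independence (dec : ∀ {P : Set} → Dec P) where
  private
    module 𝔽 = Forcing dec

  opaque
    G : Baire
    G = 𝔽.G

    G<2 : 2^ℕ G
    G<2 = proj₁ (𝔽.G∈X 0)

    generic : ∀ i → X i (only i G)
    generic i = X-only (𝔽.G∈X i)

    -- Masking the oracle inside the program turns it into one that ignores class `i`, and every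
    -- such program has been defeated on some level.
    independent : ∀ i {h} → h ≤ᵀ mask i G → ¬ X i h
    independent i (c , c⇓) = fails⇒¬X (proj₂ (𝔽.G-fails (pr i (encode (relativize c (maskᶜ i))))))
      (relativize-ignores i c) (λ a → relativize⇓ (tm⇓ (maskᵗ i) G) (c⇓ a))

-- The sets p, q and the sets s b

-- suc of the least i < n with a i ≢ 0, and 0 if there is none
first : Baire → ℕ → ℕ
first a = natrec 0 (λ i r → ifz r (ifz (a i) 0 (suc i)) r)

-- The i with t i ≡ 1 are the marks of a binary sequence t; last t n is the
-- position after the last mark below n.
count last : Baire → ℕ → ℕ
count t = natrec 0 (λ i r → r + t i)
last  t = natrec 0 (λ i r → ifz (t i) r (suc i))

module _ (lk : Tm 2) where
  firstᴿ : Rec 2 (λ { o (n , u , _) → first (λ a → ⟦ lk ⟧ o (a , u , tt)) n })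
  firstᴿ = toRec (recᵗ (lit 0) (ifzᵗ v0 (ifzᵗ (app lk (v1 ∷ v3 ∷ [])) (lit 0) (sucᵗ v1)) v0) v0) (λ o ρ → refl)

  countᴿ : Rec 2 (λ { o (n , u , _) → count (λ a → ⟦ lk ⟧ o (a , u , tt)) n })
  countᴿ = toRec (recᵗ (lit 0) (v0 +ᵗ app lk (v1 ∷ v3 ∷ [])) v0) (λ o ρ → refl)

  lastᴿ : Rec 2 (λ { o (n , u , _) → last (λ a → ⟦ lk ⟧ o (a , u , tt)) n })
  lastᴿ = toRec (recᵗ (lit 0) (ifzᵗ (app lk (v1 ∷ v3 ∷ [])) v0 (sucᵗ v1)) v0) (λ o ρ → refl)

first-cong : ∀ {a b} n → (∀ i → i < n → a i ≡ b i) → first a n ≡ first b n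
first-cong zero    eq = refl
first-cong (suc n) eq = cong₂ (λ r d → ifz r (ifz d 0 (suc n)) r) (first-cong n (λ i i<n → eq i (m<n⇒m<1+n i<n))) (eq n ≤-refl)

first-none : ∀ {a} n → (∀ i → i < n → a i ≡ 0) → first a n ≡ 0
first-none {a} n eq = trans (first-cong n eq) (go n)
  where
  go : ∀ n → first (λ _ → 0) n ≡ 0
  go zero    = refl
  go (suc n) rewrite go n = refl

first-≡0 : ∀ {a} n → first a n ≡ 0 → ∀ i → i < n → a i ≡ 0
first-≡0 {a} (suc n) eq i i<1+n with first a n in e | a n in d
... | zero | zero with m≤n⇒m<n∨m≡n (s≤s⁻¹ i<1+n)
...   | inj₁ i<n  = first-≡0 {a} n e i i<n
...   | inj₂ refl = d

first-≤ : ∀ {a} n {m} → first a n ≡ suc m → m < n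
first-≤ {a} (suc n) eq with first a n in e
... | suc _ = m<n⇒m<1+n (first-≤ {a} n (trans e eq))
... | zero with a n
...   | suc _ = ≤-reflexive (sym eq)

first-stable : ∀ {a n n′ m} → n ≤ n′ → first a n ≡ suc m → first a n′ ≡ suc m
first-stable {n′ = zero}  z≤n eq = eq
first-stable {a} {n} {suc n′} n≤ eq with m≤n⇒m<n∨m≡n n≤
... | inj₂ refl = eq
... | inj₁ n<1+n′ rewrite first-stable {a} (s≤s⁻¹ n<1+n′) eq = refl

first-unique : ∀ {a n n′ m m′} → first a n ≡ suc m → first a n′ ≡ suc m′ → m ≡ m′
first-unique {a} {n} {n′} eq eq′ =
  suc-injective (trans (sym (first-stable {a} (m≤m⊔n n n′) eq)) (first-stable {a} (m≤n⊔m n n′) eq′))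

distance-≢ : ∀ {i m x y} → i ≢ m → ifz (distance i m) x y ≡ y
distance-≢ {i} {m} ne with distance i m in eq
... | zero  = contradiction (distance≡0 {i} eq) ne
... | suc _ = refl

first-indicator : ∀ {m n} → m < n → first (λ i → ifz (distance i m) 1 0) n ≡ suc m
first-indicator {m} m<n = first-stable {λ i → ifz (distance i m) 1 0} m<n at
  where
  at : first (λ i → ifz (distance i m) 1 0) (suc m) ≡ suc m
  at rewrite first-none {λ i → ifz (distance i m) 1 0} m
       (λ i i<m → distance-≢ (<⇒≢ i<m))
     | distance-refl m = refl

count-cong : ∀ {t t′} n → (∀ i → i < n → t i ≡ t′ i) → count t n ≡ count t′ n
count-cong zero    eq = refl
count-cong (suc n) eq = cong₂ _+_ (count-cong n (λ i i<n → eq i (m<n⇒m<1+n i<n))) (eq n ≤-refl)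

count-mono : ∀ {t t′ n n′} → (∀ i → t i ≤ t′ i) → n ≤ n′ → count t n ≤ count t′ n′
count-mono {n = zero} le n≤ = z≤n
count-mono {t} {t′} {suc n} {suc n′} le n≤ with m≤n⇒m<n∨m≡n n≤
... | inj₁ n<n′ = ≤-trans (count-mono {t} {t′} {suc n} {n′} le (s≤s⁻¹ n<n′)) (m≤m+n _ _)
... | inj₂ refl = +-mono-≤ (count-mono {t} {t′} {n} {n} le ≤-refl) (le n)

last-cong : ∀ {t t′} n → (∀ i → i < n → t i ≡ t′ i) → last t n ≡ last t′ n
last-cong zero    eq = refl
last-cong (suc n) eq = cong₂ (λ d r → ifz d r (suc n)) (eq n ≤-refl) (last-cong n (λ i i<n → eq i (m<n⇒m<1+n i<n)))

last-≤ : ∀ t n → last t n ≤ n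
last-≤ t zero = z≤n
last-≤ t (suc n) with t n
... | zero  = m≤n⇒m≤1+n (last-≤ t n)
... | suc _ = ≤-refl

count-last : ∀ t n → count t (last t n) ≡ count t n
count-last t zero = refl
count-last t (suc n) with t n in eq
... | zero  = trans (count-last t n) (sym (+-identityʳ (count t n)))
... | suc _ = cong (count t n +_) eq

count-<last : ∀ {t} n {l} → l < last t n → count t l < count t n
count-<last {t} (suc n) {l} l< with t n in eq
... | zero  = <-≤-trans (count-<last {t} n l<) (m≤m+n (count t n) 0)
... | suc k = ≤-<-trans (count-mono {t} {t} (λ _ → ≤-refl) (s≤s⁻¹ l<)) (m<m+n (count t n) (s≤s z≤n))

row : ℕ → Baire → Baire
row c f n = f (pr c n)

-- Indices of the classes for the digits called z, w, x and y below
iz : ℕ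
iz = pr 0 0

iw iy : ℕ → ℕ
iw m = pr 1 m
iy b = pr 3 b

ix : ℕ → ℕ → ℕ
ix m k = pr 2 (pr m k)

Subset-of : Fm 1 → Subset
Subset-of φ = record
  { mem  = λ f → 2^ℕ f × (∀ u → ⟪ φ ⟫ f (u , tt))
  -- Programs do not distinguish pointwise equal oracles, so `χ φ` has the same value for `f` and
  -- `g`.
  ; resp = λ {f} {g} f≗g (f<2 , h) → (λ n → subst (_< 2) (f≗g n) (f<2 n)) , λ u → χ-holds φ g (u , tt) .to
      (trans (⇓-functional (compile⇓ (χ φ) g (u , tt)) (⇓-resp-≗ f≗g (compile⇓ (χ φ) f (u , tt)))) (χ-holds φ f (u , tt) .from (h u))) }

Subset-of-Π⁰₁ : ∀ φ → IsΠ⁰₁ (Subset-of φ)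
Subset-of-Π⁰₁ φ = isΠ⁰₁ φ (Subset-of φ) (λ f → mk⇔ id id)

-- A member of q has rows a, z, t, w, y.  If a = 0^ω then z ∈ X iz.  If a starts
-- with 0^m 1 then w ∈ X (iw m), t has k ≤ m marks, and y becomes a member of
-- X (ix m k) when the digits before the last mark are deleted.  To be closed,
-- q also requires that this looks correct at each moment.
Atq : Baire → ℕ → ℕ → Set
Atq f n n′ =
  (first (row 0 f) n ≡ 0 → Θ iz (row 1 f) n) ×
  (¬ first (row 0 f) n ≡ 0 →
    Θ (iw m) (row 3 f) n′ × count (row 2 f) n′ ≤ m ×
    Θ (ix m (count (row 2 f) n′)) (λ i → f (pr 4 (last (row 2 f) n′ + i))) (n′ ∸ last (row 2 f) n′))
  where m = pred (first (row 0 f) n)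

-- A member of p has rows a, z, κ, w, x, d.  If a = 0^ω then z ∈ X iz.  If a
-- starts with 0^m 1 then w ∈ X (iw m), and x is in X (ix m k) or X (iy k), where
-- the k ≤ m is read off κ, according to the digit d 0.
label : Baire → ℕ → ℕ
label h m = count (row 2 h) m

kind : Baire → ℕ → ℕ
kind h m = ifz (h (pr 5 0)) (ix m (label h m)) (iy (label h m))

Atp : Baire → ℕ → ℕ → Set
Atp h n n′ =
  (first (row 0 h) n ≡ 0 → Θ iz (row 1 h) n) ×
  (¬ first (row 0 h) n ≡ 0 → Θ (iw m) (row 3 h) n′ × Θ (kind h m) (row 4 h) n′)
  where m = pred (first (row 0 h) n)

rowᵗ : ℕ → Tm 2
rowᵗ c = orc (prᵗ (lit c) v0)

module _ {k : ℕ} (n n′ : Tm k) where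
  private
    f₀ m ct lt : Tm k
    f₀ = firstᴿ (rowᵗ 0) · (n ∷ lit 0 ∷ [])
    m  = predᵗ f₀
    ct = countᴿ (rowᵗ 2) · (n′ ∷ lit 0 ∷ [])
    lt = lastᴿ (rowᵗ 2) · (n′ ∷ lit 0 ∷ [])

  qᶠ pᶠ : Fm k
  qᶠ = (f₀ ≡ᶠ lit 0 ⇒ᶠ Θᶜ (rowᵗ 1) ∙ (lit iz ∷ n ∷ lit 0 ∷ [])) ∧ᶠ
       (¬ᶠ (f₀ ≡ᶠ lit 0) ⇒ᶠ Θᶜ (rowᵗ 3) ∙ (prᵗ (lit 1) m ∷ n′ ∷ lit 0 ∷ []) ∧ᶠ (ct ≤ᶠ m) ∧ᶠ
         Θᶜ (orc (prᵗ (lit 4) (v1 +ᵗ v0))) ∙ (prᵗ (lit 2) (prᵗ m ct) ∷ n′ ∸ᵗ lt ∷ lt ∷ []))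
  pᶠ = (f₀ ≡ᶠ lit 0 ⇒ᶠ Θᶜ (rowᵗ 1) ∙ (lit iz ∷ n ∷ lit 0 ∷ [])) ∧ᶠ
       (¬ᶠ (f₀ ≡ᶠ lit 0) ⇒ᶠ Θᶜ (rowᵗ 3) ∙ (prᵗ (lit 1) m ∷ n′ ∷ lit 0 ∷ []) ∧ᶠ
         Θᶜ (rowᵗ 4) ∙ (ifzᵗ (orc (prᵗ (lit 5) (lit 0))) (prᵗ (lit 2) (prᵗ m lb)) (prᵗ (lit 3) lb) ∷ n′ ∷ lit 0 ∷ []))
    where
    lb : Tm k
    lb = countᴿ (rowᵗ 2) · (m ∷ lit 0 ∷ [])

p q : Subset
p = Subset-of (pᶠ (fstᵗ v0) (sndᵗ v0))
q = Subset-of (qᶠ (fstᵗ v0) (sndᵗ v0))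

s : ℕ → Subset
s b = Subset-of (Θᶜ (orc v0) ∙ (lit (iy b) ∷ v0 ∷ lit 0 ∷ []))

p-elim : ∀ {h} → h ∈ p → ∀ n n′ → Atp h n n′
p-elim {h} (_ , at) n n′ = subst₂ (Atp h) (fst-pr n n′) (snd-pr n n′) (at (pr n n′))

q-elim : ∀ {f} → f ∈ q → ∀ n n′ → Atq f n n′
q-elim {f} (_ , at) n n′ = subst₂ (Atq f) (fst-pr n n′) (snd-pr n n′) (at (pr n n′))

p-intro : ∀ {h} → 2^ℕ h → (∀ n n′ → Atp h n n′) → h ∈ p
p-intro h<2 at = h<2 , λ u → at (fst u) (snd u)

q-intro : ∀ {f} → 2^ℕ f → (∀ n n′ → Atq f n n′) → f ∈ q
q-intro f<2 at = f<2 , λ u → at (fst u) (snd u)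

p-Π⁰₁ : IsΠ⁰₁ p
p-Π⁰₁ = Subset-of-Π⁰₁ (pᶠ (fstᵗ v0) (sndᵗ v0))

q-Π⁰₁ : IsΠ⁰₁ q
q-Π⁰₁ = Subset-of-Π⁰₁ (qᶠ (fstᵗ v0) (sndᵗ v0))

s-Π⁰₁ : ∀ b → IsΠ⁰₁ (s b)
s-Π⁰₁ b = Subset-of-Π⁰₁ (Θᶜ (orc v0) ∙ (lit (iy b) ∷ v0 ∷ lit 0 ∷ []))

s-intro : ∀ {b g} → X (iy b) g → g ∈ s b
s-intro g∈X = g∈X

-- p is reducible to q ⊗ s b

even odd : Baire → Baire
even F n = F (2 * n)
odd  F n = F (suc (2 * n))

even∈q : ∀ {F b} → F ∈ q ⊗ s b → even F ∈ q
even∈q (f , g , f∈q , _ , eq) = Subset.resp q (λ n → sym (trans (eq (2 * n)) (⊕-even f g n))) f∈q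

odd∈s : ∀ {F b} → F ∈ q ⊗ s b → odd F ∈ s b
odd∈s {b = b} (f , g , _ , g∈s , eq) = Subset.resp (s b) (λ n → sym (trans (eq (suc (2 * n))) (⊕-odd f g n))) g∈s

searchᶜ : Tm 1 → Code
searchᶜ t = mini (comp (compile t) (pair right zer))

search⇓ : ∀ (t : Tm 1) o n x → ⟦ t ⟧ o (n , tt) ≡ 0 → (∀ m → m < n → ⟦ t ⟧ o (m , tt) ≢ 0) → o ⊢ searchᶜ t · x ⇓ n
search⇓ t o n x z nz = mini (λ m → pred (⟦ t ⟧ o (m , tt)))
  (λ {m} m<n → subst (o ⊢ _ · ⟨ x , m ⟩ ⇓_) (sym (suc-pred _ {{≢-nonZero (nz m m<n)}})) (value m))
  (subst (o ⊢ _ · ⟨ x , n ⟩ ⇓_) z (value n))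
  where
  value : ∀ m → o ⊢ comp (compile t) (pair right zer) · ⟨ x , m ⟩ ⇓ ⟦ t ⟧ o (m , tt)
  value m = comp (pair (right⇓ x m) zer) (compile⇓ t o (m , tt))

select : ℕ → ℕ → ℕ → ℕ → ℕ → ℕ → ℕ → ℕ
select c x₀ x₁ x₂ x₃ x₄ x₅ = ifz c x₀ (ifz (c ∸ 1) x₁ (ifz (c ∸ 2) x₂ (ifz (c ∸ 3) x₃ (ifz (c ∸ 4) x₄ x₅))))

ifz-< : ∀ c {x y n} → x < n → y < n → ifz c x y < n
ifz-< zero    p q = p
ifz-< (suc _) p q = q

select-< : ∀ c {n x₀ x₁ x₂ x₃ x₄ x₅} → x₀ < n → x₁ < n → x₂ < n → x₃ < n → x₄ < n → x₅ < n → select c x₀ x₁ x₂ x₃ x₄ x₅ < n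
select-< c p₀ p₁ p₂ p₃ p₄ p₅ =
  ifz-< c p₀ (ifz-< (c ∸ 1) p₁ (ifz-< (c ∸ 2) p₂ (ifz-< (c ∸ 3) p₃ (ifz-< (c ∸ 4) p₄ p₅))))

below : ℕ → ℕ → ℕ
below i k = ifz (suc i ∸ k) 1 0

below<2 : ∀ i k → below i k < 2
below<2 i k = ifz-< (suc i ∸ k) (s≤s (s≤s z≤n)) (s≤s z≤n)

count-below-≤ : ∀ {k} m → m ≤ k → count (λ i → below i k) m ≡ m
count-below-≤ zero    _ = refl
count-below-≤ {k} (suc m) m<k rewrite count-below-≤ {k} m (<⇒≤ m<k) | m≤n⇒m∸n≡0 m<k = +-comm m 1

count-below : ∀ {k} m → k ≤ m → count (λ i → below i k) m ≡ k
count-below {k} m k≤m with m≤n⇒m<n∨m≡n k≤m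
... | inj₂ refl = count-below-≤ m ≤-refl
count-below {k} (suc m) k≤m | inj₁ k<1+m rewrite count-below {k} m (s≤s⁻¹ k<1+m) with suc m ∸ k in eq
... | zero  = contradiction (m∸n≡0⇒m≤n eq) (<⇒≱ k<1+m)
... | suc _ = +-identityʳ k

opaque
  outʸ : ℕ → Baire → Baire
  outʸ b F a = select (fst a) (even F (pr 0 (snd a))) (even F (pr 1 (snd a))) (below (snd a) b) (even F (pr 3 (snd a)))
    (odd F (snd a)) 1

  outˣ : ℕ → ℕ → Baire → Baire
  outˣ k l F a = select (fst a) (even F (pr 0 (snd a))) (even F (pr 1 (snd a))) (below (snd a) k) (even F (pr 3 (snd a)))
    (even F (pr 4 (l + snd a))) 0

module _ (b : ℕ) (F : Baire) where opaque
  unfolding outʸ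

  outʸ-row₀ : ∀ i → row 0 (outʸ b F) i ≡ row 0 (even F) i
  outʸ-row₀ i rewrite fst-pr 0 i | snd-pr 0 i = refl
  outʸ-row₁ : ∀ i → row 1 (outʸ b F) i ≡ row 1 (even F) i
  outʸ-row₁ i rewrite fst-pr 1 i | snd-pr 1 i = refl
  outʸ-row₂ : ∀ i → row 2 (outʸ b F) i ≡ below i b
  outʸ-row₂ i rewrite fst-pr 2 i | snd-pr 2 i = refl
  outʸ-row₃ : ∀ i → row 3 (outʸ b F) i ≡ row 3 (even F) i
  outʸ-row₃ i rewrite fst-pr 3 i | snd-pr 3 i = refl
  outʸ-row₄ : ∀ i → row 4 (outʸ b F) i ≡ odd F i
  outʸ-row₄ i rewrite fst-pr 4 i | snd-pr 4 i = refl
  outʸ-row₅ : outʸ b F (pr 5 0) ≡ 1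
  outʸ-row₅ rewrite fst-pr 5 0 = refl

module _ (k l : ℕ) (F : Baire) where opaque
  unfolding outˣ

  outˣ-row₀ : ∀ i → row 0 (outˣ k l F) i ≡ row 0 (even F) i
  outˣ-row₀ i rewrite fst-pr 0 i | snd-pr 0 i = refl
  outˣ-row₁ : ∀ i → row 1 (outˣ k l F) i ≡ row 1 (even F) i
  outˣ-row₁ i rewrite fst-pr 1 i | snd-pr 1 i = refl
  outˣ-row₂ : ∀ i → row 2 (outˣ k l F) i ≡ below i k
  outˣ-row₂ i rewrite fst-pr 2 i | snd-pr 2 i = refl
  outˣ-row₃ : ∀ i → row 3 (outˣ k l F) i ≡ row 3 (even F) i
  outˣ-row₃ i rewrite fst-pr 3 i | snd-pr 3 i = refl
  outˣ-row₄ : ∀ i → row 4 (outˣ k l F) i ≡ even F (pr 4 (l + i))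
  outˣ-row₄ i rewrite fst-pr 4 i | snd-pr 4 i = refl
  outˣ-row₅ : outˣ k l F (pr 5 0) ≡ 0
  outˣ-row₅ rewrite fst-pr 5 0 = refl

opaque
  unfolding outʸ outˣ

  outʸ-< : ∀ {b F} → 2^ℕ F → 2^ℕ (outʸ b F)
  outʸ-< {b} F<2 a = select-< (fst a) (F<2 _) (F<2 _) (below<2 (snd a) b) (F<2 _) (F<2 _) (s≤s (s≤s z≤n))

  outˣ-< : ∀ {k l F} → 2^ℕ F → 2^ℕ (outˣ k l F)
  outˣ-< {k} F<2 a = select-< (fst a) (F<2 _) (F<2 _) (below<2 (snd a) k) (F<2 _) (F<2 _) (s≤s z≤n)

module _ {n : ℕ} where
  evenᵗ oddᵗ : Tm n → Tm n
  evenᵗ t = orc (lit 2 *ᵗ t)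
  oddᵗ t = orc (sucᵗ (lit 2 *ᵗ t))

  selectᵗ : Tm n → Tm n → Tm n → Tm n → Tm n → Tm n → Tm n → Tm n
  selectᵗ c x₀ x₁ x₂ x₃ x₄ x₅ =
    ifzᵗ c x₀ (ifzᵗ (c ∸ᵗ lit 1) x₁ (ifzᵗ (c ∸ᵗ lit 2) x₂ (ifzᵗ (c ∸ᵗ lit 3) x₃ (ifzᵗ (c ∸ᵗ lit 4) x₄ x₅))))

  outᵗ : ℕ → Tm n → Tm n → Tm n → Tm n
  outᵗ k a x d = selectᵗ (fstᵗ a) (evenᵗ (prᵗ (lit 0) i)) (evenᵗ (prᵗ (lit 1) i)) (ifzᵗ (sucᵗ i ∸ᵗ lit k) (lit 1) (lit 0))
    (evenᵗ (prᵗ (lit 3) i)) x d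
    where i = sndᵗ a

-- Its least zero is the position just after the `k`-th mark (0 if `k = 0`), where the usable digits
-- of row `y` begin.
missingᵗ : ℕ → Tm 1
missingᵗ k = lit k ∸ᵗ countᴿ (evenᵗ (prᵗ (lit 2) v0)) · (v0 ∷ lit 0 ∷ [])

outʸᶜ outˣᶜ : ℕ → Code
outʸᶜ b = comp (compile (outᵗ {1} b v0 (oddᵗ (sndᵗ v0)) (lit 1))) (pair idn zer)
outˣᶜ k = comp (compile (outᵗ {2} k v0 (evenᵗ (prᵗ (lit 4) (v1 +ᵗ sndᵗ v0))) (lit 0)))
               (pair idn (pair (searchᶜ (missingᵗ k)) zer))

opaque
  unfolding outʸ outˣ

  outʸ⇓ : ∀ b F a → F ⊢ outʸᶜ b · a ⇓ outʸ b F a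
  outʸ⇓ b F a = tm⇓ (outᵗ b v0 (oddᵗ (sndᵗ v0)) (lit 1)) F a

  outˣ⇓ : ∀ k l F a → k ∸ count (row 2 (even F)) l ≡ 0 → (∀ m → m < l → k ∸ count (row 2 (even F)) m ≢ 0) →
          F ⊢ outˣᶜ k · a ⇓ outˣ k l F a
  outˣ⇓ k l F a z nz = comp (pair idn (pair (search⇓ (missingᵗ k) F l a z nz) zer))
    (compile⇓ (outᵗ {2} k v0 (evenᵗ (prᵗ (lit 4) (v1 +ᵗ sndᵗ v0))) (lit 0)) F (a , l , tt))

-- Program 0 uses the member of s b; program k + 1 assumes that there are k marks.
programs : ℕ → ℕ → Code
programs b zero    = outʸᶜ b
programs b (suc k) = outˣᶜ k

-- Both the number of the program to be used and the counter of mind changes: on oracles from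
-- `q ⊗ s b` it never decreases and stays at most `b`, since `m < b` permits at most `m` marks.
rank : ℕ → Baire → ℕ → ℕ
rank b F n = ifz (first (row 0 (even F)) b) 0 (suc (count (row 2 (even F)) n))

last-stable : ∀ {t n} n′ → n ≤ n′ → count t n′ ≡ count t n → last t n′ ≡ last t n
last-stable {t} n′ n≤ eq with m≤n⇒m<n∨m≡n n≤
... | inj₂ refl = refl
last-stable {t} {n} (suc n′) n≤ eq | inj₁ n<1+n′ with t n′ in d
... | zero  = last-stable n′ (s≤s⁻¹ n<1+n′) (trans (sym (+-identityʳ _)) eq)
... | suc k = contradiction (trans (sym (+-suc (count t n′) k)) eq) (>⇒≢ (s≤s (≤-trans (count-mono {t} (λ _ → ≤-refl) (s≤s⁻¹ n<1+n′)) (m≤m+n _ k))))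

first-hit : ∀ {a} n {m} → first a n ≡ suc m → a m ≢ 0
first-hit {a} (suc n) eq with first a n in e
first-hit {a} (suc n) refl | suc m = first-hit {a} n e
... | zero with a n in d
...   | suc _ = λ z → case trans (sym d) (trans (cong a (suc-injective eq)) z) of λ ()

stabilises : (∀ {P : Set} → Dec P) → ∀ (u : ℕ → ℕ) → (∀ {m n} → m ≤ n → u m ≤ u n) → ∀ M → (∀ n → u n ≤ M) →
             ∃[ n ] ∀ n′ → n ≤ n′ → u n′ ≡ u n
stabilises dec u mono M bound = go M 0 (m≤n+m M (u 0))
  where
  go : ∀ d n → M ≤ u n + d → ∃[ n ] ∀ n′ → n ≤ n′ → u n′ ≡ u n
  go d n M≤ with dec {∃[ n′ ] n ≤ n′ × u n < u n′}
  ... | no none = n , λ n′ n≤n′ → ≤-antisym (≮⇒≥ λ lt → none (n′ , n≤n′ , lt)) (mono n≤n′)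
  go zero    n M≤ | yes (n′ , _ , lt) = contradiction (≤-trans (bound n′) (≤-trans M≤ (≤-reflexive (+-identityʳ (u n))))) (<⇒≱ lt)
  go (suc d) n M≤ | yes (n′ , _ , lt) = go d n′ (≤-trans M≤ (≤-trans (≤-reflexive (+-suc (u n) d)) (+-monoˡ-≤ d lt)))

module Upper (dec : ∀ {P : Set} → Dec P) (b : ℕ) where

  record Solution (F : Baire) : Set where
    field
      κ        : ℕ
      κ≤b      : κ ≤ b
      rank≤κ   : ∀ n → rank b F n ≤ κ
      n*       : ℕ
      rank≡κ   : ∀ n → n* ≤ n → rank b F n ≡ κ
      solution : Baire
      solves   : solution ∈ p
      computes : ∀ n → F ⊢ programs b κ · n ⇓ solution n

  module _ {F : Baire} (F∈ : F ∈ q ⊗ s b) where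
    f = even F
    f∈q : f ∈ q
    f∈q = even∈q {F} {b} F∈
    g∈s : odd F ∈ s b
    g∈s = odd∈s {F} {b} F∈
    f<2 = proj₁ f∈q
    F<2 : 2^ℕ F
    F<2 a = subst (λ i → F i < 2) (parity+half a) (digit< (parity a) (half a) (parity<2 a))
      where
      digit< : ∀ c i → c < 2 → F (c + (i + i)) < 2
      digit< zero       i _ = subst (λ j → F (i + j) < 2) (+-identityʳ i) (f<2 i)
      digit< (suc zero) i _ = subst (λ j → F (suc (i + j)) < 2) (+-identityʳ i) (proj₁ g∈s i)
      digit< (suc (suc c)) i (s≤s (s≤s ()))

    first-row0 : ∀ {h} n → (∀ i → row 0 h i ≡ row 0 f i) → first (row 0 h) n ≡ first (row 0 f) n
    first-row0 n eq = first-cong n (λ i _ → eq i)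

    atp : ∀ {h} → (∀ i → row 0 h i ≡ row 0 f i) → (∀ i → row 1 h i ≡ row 1 f i) → (∀ i → row 3 h i ≡ row 3 f i) →
          (∀ n n′ m → first (row 0 f) n ≡ suc m → Θ (kind h m) (row 4 h) n′) → ∀ n n′ → Atp h n n′
    atp {h} eq₀ eq₁ eq₃ θ n n′ =
      (λ z → Θ-local (λ i _ → sym (eq₁ i)) (proj₁ (q-elim f∈q n 0) (trans (sym (first-row0 {h} n eq₀)) z))) ,
      (λ nz → subst (λ r → ¬ r ≡ 0 → Θ (iw (pred r)) (row 3 h) n′ × Θ (kind h (pred r)) (row 4 h) n′)
                    (sym (first-row0 {h} n eq₀)) (found (first (row 0 f) n) refl) nz)
      where
      found : ∀ r → first (row 0 f) n ≡ r → ¬ r ≡ 0 → Θ (iw (pred r)) (row 3 h) n′ × Θ (kind h (pred r)) (row 4 h) n′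
      found zero    eq nz = contradiction refl nz
      found (suc m) eq nz =
        subst (λ r → Θ (iw (pred r)) (row 3 h) n′) eq
          (Θ-local (λ i _ → sym (eq₃ i)) (proj₁ (proj₂ (q-elim f∈q n n′) (λ z → case trans (sym eq) z of λ ())))) ,
        θ n n′ m eq

    solve₀ : first (row 0 f) b ≡ 0 → Solution F
    solve₀ eq = record
      { κ = 0 ; κ≤b = z≤n ; rank≤κ = λ n → ≤-reflexive (rank≡ n) ; n* = 0 ; rank≡κ = λ n _ → rank≡ n
      ; solution = h
      ; solves   = p-intro h<2 (atp {h} (outʸ-row₀ b F) (outʸ-row₁ b F) (outʸ-row₃ b F) θ)
      ; computes = outʸ⇓ b F }
      where
      rank≡ : ∀ n → rank b F n ≡ 0
      rank≡ n rewrite eq = refl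
      h = outʸ b F
      h<2 : 2^ℕ h
      h<2 = outʸ-< {b} F<2
      θ : ∀ n n′ m → first (row 0 f) n ≡ suc m → Θ (kind h m) (row 4 h) n′
      θ n n′ m found = subst (λ i → Θ i (row 4 h) n′) (sym kind≡) (Θ-local (λ i _ → sym ((outʸ-row₄ b F) i)) (proj₂ g∈s n′))
        where
        -- Row 0 vanishes below `b`, so an `m` found later is large enough for the label `b`.
        b≤m : b ≤ m
        b≤m = ≮⇒≥ λ m<b → first-hit {row 0 f} n found (first-≡0 {row 0 f} b eq m m<b)
        kind≡ : kind h m ≡ iy b
        kind≡ = trans (cong (λ d → ifz d (ix m (label h m)) (iy (label h m))) (outʸ-row₅ b F))
                      (cong iy (trans (count-cong m (λ i _ → (outʸ-row₂ b F) i)) (count-below m b≤m)))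
    solve₁ : ∀ m → first (row 0 f) b ≡ suc m → Solution F
    solve₁ m eq = record
      { κ = suc k ; κ≤b = ≤-trans (s≤s (marks≤m n*)) (first-≤ {row 0 f} b eq) ; rank≤κ = rank≤ ; n* = n* ; rank≡κ = rank≡
      ; solution = h
      ; solves   = p-intro h<2 (atp {h} (outˣ-row₀ k l F) (outˣ-row₁ k l F) (outˣ-row₃ k l F) θ)
      ; computes = λ n → outˣ⇓ k l F n (m≤n⇒m∸n≡0 (≤-reflexive (sym (count-last t n*))))
                           (λ i i<l z → <⇒≱ (count-<last {t} n* i<l) (m∸n≡0⇒m≤n z)) }
      where
      t = row 2 f
      at : ∀ n′ → Θ (iw m) (row 3 f) n′ × count t n′ ≤ m ×
                  Θ (ix m (count t n′)) (λ i → f (pr 4 (last t n′ + i))) (n′ ∸ last t n′)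
      at n′ = subst (λ r → Θ (iw (pred r)) (row 3 f) n′ × count t n′ ≤ pred r ×
                           Θ (ix (pred r) (count t n′)) (λ i → f (pr 4 (last t n′ + i))) (n′ ∸ last t n′))
                    eq (proj₂ (q-elim f∈q b n′) (λ z → case trans (sym eq) z of λ ()))
      marks≤m : ∀ n → count t n ≤ m
      marks≤m n = proj₁ (proj₂ (at n))
      stable = stabilises dec (count t) (count-mono {t} (λ _ → ≤-refl)) m marks≤m
      n* = proj₁ stable
      k = count t n*
      l = last t n*
      h = outˣ k l F
      rank-suc : ∀ n → rank b F n ≡ suc (count t n)
      rank-suc n rewrite eq = refl
      rank≡ : ∀ n → n* ≤ n → rank b F n ≡ suc k
      rank≡ n n*≤n = trans (rank-suc n) (cong suc (proj₂ stable n n*≤n))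
      rank≤ : ∀ n → rank b F n ≤ suc k
      rank≤ n = ≤-trans (≤-reflexive (rank-suc n)) (s≤s (≤-trans (count-mono {t} (λ _ → ≤-refl) (m≤m⊔n n n*))
        (≤-reflexive (proj₂ stable (n ⊔ n*) (m≤n⊔m n n*)))))
      h<2 : 2^ℕ h
      h<2 = outˣ-< {k} {l} F<2
      θ : ∀ n n′ m′ → first (row 0 f) n ≡ suc m′ → Θ (kind h m′) (row 4 h) n′
      θ n n′ m′ found = subst (λ i → Θ i (row 4 h) n′) (sym kind≡) (Θ-local (λ i _ → sym ((outˣ-row₄ k l F) i)) valid)
        where
        -- From `n*` on the last mark stays put; the summand `l + n′` leaves at least `n′` digits
        -- after it.
        N = n* ⊔ (l + n′)
        n*≤N = m≤m⊔n n* (l + n′)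
        last≡ : last t N ≡ l
        last≡ = last-stable {t} N n*≤N (proj₂ stable N n*≤N)
        valid : Θ (ix m k) (λ i → f (pr 4 (l + i))) n′
        valid = Θ-mono {ix m k} {λ i → f (pr 4 (l + i))} (m+n≤o⇒m≤o∸n n′ (≤-trans (≤-reflexive (+-comm n′ l)) (m≤n⊔m n* (l + n′))))
          (subst₂ (λ c j → Θ (ix m c) (λ i → f (pr 4 (j + i))) (N ∸ j)) (proj₂ stable N n*≤N) last≡ (proj₂ (proj₂ (at N))))
        kind≡ : kind h m′ ≡ ix m k
        kind≡ = trans (cong (λ d → ifz d (ix m′ (label h m′)) (iy (label h m′))) (outˣ-row₅ k l F))
          (trans (cong (λ m → ix m (label h m)) (first-unique {row 0 f} {n} {b} found eq))
            (cong (ix m) (trans (count-cong m (λ i _ → (outˣ-row₂ k l F) i)) (count-below m (marks≤m n*)))))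

    solve : Solution F
    solve = cases (first (row 0 f) b) refl
      where
      cases : ∀ r → first (row 0 f) b ≡ r → Solution F
      cases zero    = solve₀
      cases (suc m) = solve₁ m

-- The learner that follows the rank.

pad : ℕ → Baire
pad σ a = pred (get σ a)

opaque
  index : ℕ → ℕ → ℕ
  index b κ = encode (programs b κ)

  index-graph : ∀ {b κ F h} → (∀ n → F ⊢ programs b κ · n ⇓ h n) → graph (Φ (index b κ)) F h
  index-graph h⇓ = _ , refl , h⇓

tableᵗ : ℕ → ℕ → Tm 1
tableᵗ b zero    = lit (index b 0)
tableᵗ b (suc n) = ifzᵗ (lit (suc n) ∸ᵗ v0) (lit (index b (suc n))) (tableᵗ b n)

table : ∀ b n {o κ} → κ ≤ n → ⟦ tableᵗ b n ⟧ o (κ , tt) ≡ index b κ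
table b zero    z≤n = refl
table b (suc n) {o} {κ} κ≤ with m≤n⇒m<n∨m≡n κ≤
... | inj₂ refl rewrite n∸n≡0 n = refl
... | inj₁ κ<1+n rewrite +-∸-assoc 1 (s≤s⁻¹ κ<1+n) = table b n (s≤s⁻¹ κ<1+n)

module _ (b : ℕ) where
  private
    rowᵖ : ℕ → Tm 2
    rowᵖ c = predᵗ (getᴿ · (lit 2 *ᵗ prᵗ (lit c) v0 ∷ v1 ∷ []))

  rankᵗ : Tm 1
  rankᵗ = ifzᵗ (firstᴿ (rowᵖ 0) · (lit b ∷ v0 ∷ [])) (lit 0) (sucᵗ (countᴿ (rowᵖ 2) · (v0 ∷ v0 ∷ [])))

  -- Continuing the list by zeros can only lower the rank, so the guessed rank never falls as more
  -- of the oracle is read. The code of the list doubles as the search bound.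
  rankᵖ : ℕ → ℕ
  rankᵖ σ = rank b (pad σ) σ

  learner : Learner
  learner = record
    { guess      = λ σ → ⟦ tableᵗ b b ⟧ (λ _ → 0) (rankᵖ (encodeList σ) , tt)
    ; computable = computable (app (tableᵗ b b) (rankᵗ ∷ [])) (λ σ → refl) }

rank-mono : ∀ b {F F′ n n′} → (∀ a → F a ≤ F′ a) → n ≤ n′ → rank b F n ≤ rank b F′ n′
rank-mono b {F} {F′} {n} {n′} F≤F′ n≤n′ = cases (first (row 0 (even F′)) b) refl
  where
  below-suc : ∀ r c → ifz r 0 (suc c) ≤ suc c
  below-suc zero    c = z≤n
  below-suc (suc _) c = ≤-refl
  cases : ∀ r → first (row 0 (even F′)) b ≡ r → rank b F n ≤ ifz r 0 (suc (count (row 2 (even F′)) n′))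
  cases zero eq = ≤-reflexive (cong (λ r → ifz r 0 (suc (count (row 2 (even F)) n)))
    (first-none {row 0 (even F)} b λ i i<b → n≤0⇒n≡0 (≤-trans (F≤F′ _) (≤-reflexive (first-≡0 {row 0 (even F′)} b eq i i<b)))))
  cases (suc r) eq = ≤-trans (below-suc (first (row 0 (even F)) b) _)
    (s≤s (count-mono {row 2 (even F)} {row 2 (even F′)} (λ i → F≤F′ (2 * pr 2 i)) n≤n′))

rank-cong : ∀ b {F F′} n → (∀ a → a ≤ 2 * pr 2 (b + n) → F a ≡ F′ a) → rank b F n ≡ rank b F′ n
rank-cong b {F} {F′} n eq = cong₂ (λ r c → ifz r 0 (suc c))
  (first-cong b λ i i<b → eq _ (*-monoʳ-≤ 2 (pr-mono-≤ z≤n (≤-trans (<⇒≤ i<b) (m≤m+n b n)))))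
  (count-cong n λ i i<n → eq _ (*-monoʳ-≤ 2 (pr-mono-≤ ≤-refl (≤-trans (<⇒≤ i<n) (m≤n+m n b)))))

pad-< : ∀ F {n a} → a < n → pad (encodeList (F ↾ n)) a ≡ F a
pad-< F a<n = cong pred (get-↾-< F a<n)

pad-mono : ∀ F n a → pad (encodeList (F ↾ n)) a ≤ pad (encodeList (F ↾ suc n)) a
pad-mono F n a with a <? n
... | yes a<n = ≤-reflexive (trans (pad-< F a<n) (sym (pad-< F (m<n⇒m<1+n a<n))))
... | no  a≮n = ≤-trans (≤-reflexive (cong pred (get-↾-≥ F (≮⇒≥ a≮n)))) z≤n

pad-≤ : ∀ F n a → pad (encodeList (F ↾ n)) a ≤ F a
pad-≤ F n a with a <? n
... | yes a<n = ≤-reflexive (pad-< F a<n)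
... | no  a≮n = ≤-trans (≤-reflexive (cong pred (get-↾-≥ F (≮⇒≥ a≮n)))) z≤n

-- `v` changes only together with `u`, and each change of `u` raises it by at least one.
changes : ∀ {u v : ℕ → ℕ} → (∀ n → u n ≤ u (suc n)) → (∀ n → u (suc n) ≡ u n → v (suc n) ≡ v n) →
          ∀ n* → (∀ n → n* ≤ n → u (suc n) ≡ u n) → # (λ n → v (suc n) ≢ v n) ≤ u n*
changes {u} {v} mono imp n* stable = list n* , ≤-trans (m≤m+n _ (u 0)) (length-≤ n*) , λ {n} ne →
  ∈-list n* n ne (≰⇒> λ le → ne (imp n (stable n le)))
  where
  add : ℕ → ∀ {P : Set} → Dec P → List ℕ → List ℕ
  add n (yes _) xs = xs
  add n (no  _) xs = n ∷ xs
  list : ℕ → List ℕ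
  list zero    = []
  list (suc n) = add n (u (suc n) ≟ u n) (list n)
  length-≤ : ∀ n → length (list n) + u 0 ≤ u n
  length-≤ zero = ≤-refl
  length-≤ (suc n) with u (suc n) ≟ u n
  ... | yes eq = ≤-trans (length-≤ n) (mono n)
  ... | no  ne = ≤-trans (s≤s (length-≤ n)) (≤∧≢⇒< (mono n) (ne ∘ sym))
  ∈-list : ∀ m n → v (suc n) ≢ v n → n < m → n ∈ˡ list m
  ∈-list (suc m) n ne n<1+m with m≤n⇒m<n∨m≡n (s≤s⁻¹ n<1+m) | u (suc m) ≟ u m
  ... | inj₁ n<m  | yes _  = ∈-list m n ne n<m
  ... | inj₁ n<m  | no  _  = there (∈-list m n ne n<m)
  ... | inj₂ refl | yes eq = contradiction (imp n eq) ne
  ... | inj₂ refl | no  _  = here refl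

indices : ℕ → ℕ → List ℕ
indices b zero    = index b 0 ∷ []
indices b (suc n) = index b (suc n) ∷ indices b n

length-indices : ∀ b n → length (indices b n) ≡ suc n
length-indices b zero    = refl
length-indices b (suc n) = cong suc (length-indices b n)

∈-indices : ∀ b n {κ} → κ ≤ n → index b κ ∈ˡ indices b n
∈-indices b zero    z≤n = here refl
∈-indices b (suc n) κ≤ with m≤n⇒m<n∨m≡n κ≤
... | inj₂ refl  = here refl
... | inj₁ κ<1+n = there (∈-indices b n (s≤s⁻¹ κ<1+n))

∈⇒≤sum : ∀ {x xs} → x ∈ˡ xs → x ≤ sum xs
∈⇒≤sum {xs = y ∷ xs} (here refl) = m≤m+n y (sum xs)
∈⇒≤sum {xs = y ∷ xs} (there x∈)  = ≤-trans (∈⇒≤sum x∈) (m≤n+m (sum xs) y)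

-- One partial function for all three notions.

module Reduction (dec : ∀ {P : Set} → Dec P) (b : ℕ) where
  open Upper dec b
  open Solution

  Rank : Baire → ℕ → Set
  Rank F κ = ∃[ n ] ∀ n′ → n ≤ n′ → rank b F n′ ≡ κ

  Rank-unique : ∀ F {κ κ′} → Rank F κ → Rank F κ′ → κ ≡ κ′
  Rank-unique F (n , eq) (n′ , eq′) = trans (sym (eq _ (m≤m⊔n n n′))) (eq′ _ (m≤n⊔m n n′))

  -- The final rank selects the program, which makes the graph single-valued. The domain is confined
  -- to `q ⊗ s b` because the bounds on mind changes and guesses must hold throughout it.
  Γ : PartialFunction
  Γ = record
    { graph      = λ F h → F ∈ q ⊗ s b × ∃[ κ ] Rank F κ × graph (Φ (index b κ)) F h
    ; respˡ      = λ { {h} {F} {F′} eq (F∈ , κ , (n , r) , φ) → Subset.resp (q ⊗ s b) eq F∈ , κ ,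
                     (n , λ n′ le → trans (sym (rank-cong b {F} {F′} n′ λ a _ → eq a)) (r n′ le)) ,
                     PartialFunction.respˡ (Φ (index b κ)) eq φ }
    ; respʳ      = λ { eq (F∈ , κ , r , φ) → F∈ , κ , r , PartialFunction.respʳ (Φ (index b κ)) eq φ }
    ; functional = λ { {F} (_ , κ , r , φ) (_ , κ′ , r′ , φ′) →
                     PartialFunction.functional (Φ (index b κ)) φ (subst (λ κ → graph (Φ (index b κ)) _ _) (Rank-unique F r′ r) φ′) } }

  module _ {F : Baire} (F∈ : F ∈ q ⊗ s b) where
    private
      sol = solve F∈

    Rank-κ : Rank F (κ sol)
    Rank-κ = n* sol , rank≡κ sol

    graph-solution : graph Γ F (solution sol)
    graph-solution = F∈ , κ sol , Rank-κ , index-graph (computes sol)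

    guessedRank : ℕ → ℕ
    guessedRank n = rankᵖ b (encodeList (F ↾ n))

    guessedRank-mono : ∀ n → guessedRank n ≤ guessedRank (suc n)
    guessedRank-mono n = rank-mono b {pad (encodeList (F ↾ n))} {pad (encodeList (F ↾ suc n))} (pad-mono F n) (encodeList-mono F n)

    guessedRank-≤ : ∀ n → guessedRank n ≤ κ sol
    guessedRank-≤ n = ≤-trans (rank-mono b {pad (encodeList (F ↾ n))} {F} {encodeList (F ↾ n)} (pad-≤ F n) ≤-refl) (rank≤κ sol (encodeList (F ↾ n)))

    correct : ℕ
    correct = suc (2 * pr 2 (b + n* sol)) ⊔ n* sol

    guessedRank-≡ : ∀ n → correct ≤ n → guessedRank n ≡ κ sol
    guessedRank-≡ n le = ≤-antisym (guessedRank-≤ n) (≤-trans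
      (≤-reflexive (trans (sym (rank≡κ sol (n* sol) ≤-refl)) (rank-cong b {F} {pad (encodeList (F ↾ n))} (n* sol) λ a a≤ →
        sym (pad-< F (<-≤-trans (s≤s a≤) (≤-trans (m≤m⊔n (suc (2 * pr 2 (b + n* sol))) (n* sol)) le))))))
      (rank-mono b {pad (encodeList (F ↾ n))} {pad (encodeList (F ↾ n))} (λ _ → ≤-refl) (≤-trans (≤-trans (m≤n⊔m (suc (2 * pr 2 (b + n* sol))) (n* sol)) le) (n≤encodeList F n))))

    guess≡ : ∀ n → guess (learner b) (F ↾ n) ≡ index b (guessedRank n)
    guess≡ n = table b b (≤-trans (guessedRank-≤ n) (κ≤b sol))

  identifies : Identifies (learner b) Γ
  identifies {F} {h} (F∈ , κ′ , r , φ) = index b (κ (solve F∈)) ,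
    (correct F∈ , λ n le → trans (guess≡ F∈ n) (cong (index b) (guessedRank-≡ F∈ n le))) ,
    subst (λ κ → graph (Φ (index b κ)) F h) (Rank-unique F r (Rank-κ F∈)) φ

  mindChanges : ∀ F → dom Γ F → # MindChanges (learner b) F ≤ b
  mindChanges F (_ , F∈ , _) =
    let xs , len , all = changes {guessedRank F∈} {λ n → guess (learner b) (F ↾ n)} (guessedRank-mono F∈)
          (λ n eq → trans (guess≡ F∈ (suc n)) (trans (cong (index b) eq) (sym (guess≡ F∈ n)))) (correct F∈)
          (λ n le → trans (guessedRank-≡ F∈ (suc n) (m≤n⇒m≤1+n le)) (sym (guessedRank-≡ F∈ n le)))
    in xs , ≤-trans len (≤-trans (guessedRank-≤ F∈ (correct F∈)) (κ≤b (solve F∈))) , all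

  guesses : ∀ F → dom Γ F → # Guesses (learner b) F ≤ suc b
  guesses F (_ , F∈ , _) = indices b b , ≤-reflexive (length-indices b b) , λ { (n , refl) →
    subst (_∈ˡ indices b b) (sym (guess≡ F∈ n)) (∈-indices b b (≤-trans (guessedRank-≤ F∈ n) (κ≤b (solve F∈)))) }

  finitelyMany : ⟨<ω,1⟩ Γ
  finitelyMany = suc (sum (indices b b)) , λ { {F} (F∈ , κ′ , r , φ) → index b κ′ ,
    s≤s (∈⇒≤sum (∈-indices b b (subst (_≤ b) (sym (Rank-unique F r (Rank-κ F∈))) (κ≤b (solve F∈))))) , φ }

  Γ-⟨1,<ω⟩ : ⟨1,<ω⟩ Γ
  Γ-⟨1,<ω⟩ = learner b , identifies , b , mindChanges

  Γ-⟨1,ω|<ω⟩ : ⟨1,ω|<ω⟩ Γ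
  Γ-⟨1,ω|<ω⟩ = learner b , identifies , suc b , guesses

  reduces : ∀ {N} → N Γ → Reducible N p (q ⊗ s b)
  reduces NΓ = Γ , NΓ , λ F F∈ → (_ , graph-solution F∈) , λ f φ →
    Subset.resp p (PartialFunction.functional Γ (graph-solution F∈) φ) (solves (solve F∈))

-- Finitely many guesses do not suffice

-- What the three notions of computability have in common: the values of Γ are
-- computed by programs used during the computation, of which there is a bounded
-- number.
record FewGuesses (Γ : PartialFunction) : Set₁ where
  field
    bound  : ℕ
    Used   : Baire → Pred ℕ 0ℓ
    local  : ∀ {F e} → Used F e → ∃[ u ] ∀ F′ → (∀ a → a < u → F a ≡ F′ a) → Used F′ e
    covers : ∀ {F h} → graph Γ F h → ∃[ e ] Used F e × graph (Φ e) F h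
    few    : ∀ F → dom Γ F → # Used F ≤ bound

↾-cong : ∀ {f g : Baire} n → (∀ a → a < n → f a ≡ g a) → f ↾ n ≡ g ↾ n
↾-cong zero    eq = refl
↾-cong (suc n) eq = cong₂ _∷_ (eq 0 (s≤s z≤n)) (↾-cong n (λ a a<n → eq (suc a) (s≤s a<n)))

learner-few : ∀ {Γ} Ψ → Identifies Ψ Γ → ∀ b → (∀ F → dom Γ F → # Guesses Ψ F ≤ b) → FewGuesses Γ
learner-few Ψ ident b few = record
  { bound  = b
  ; Used   = Guesses Ψ
  ; local  = λ { (n , eq) → n , λ F′ agree → n , trans (cong (guess Ψ) (sym (↾-cong n agree))) eq }
  ; covers = λ φ → let e , (n , lim) , φ′ = ident φ in e , (n , lim n ≤-refl) , φ′
  ; few    = few }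

⟨1,ω|<ω⟩-few : ∀ {Γ} → ⟨1,ω|<ω⟩ Γ → FewGuesses Γ
⟨1,ω|<ω⟩-few (Ψ , ident , b , few) = learner-few Ψ ident b few

-- Every guess is the initial one or was adopted at a mind change, hence the bound `suc b`.
⟨1,<ω⟩-few : ∀ {Γ} → ⟨1,<ω⟩ Γ → FewGuesses Γ
⟨1,<ω⟩-few (Ψ , ident , b , few) = learner-few Ψ ident (suc b) λ F F∈ →
  let xs , len , all = few F F∈ in
  guess Ψ [] ∷ map (λ n → guess Ψ (F ↾ suc n)) xs , s≤s (≤-trans (≤-reflexive (length-map _ xs)) len) ,
  λ { (n , refl) → visited F xs all n }
  where
  visited : ∀ F xs → (∀ {n} → MindChanges Ψ F n → n ∈ˡ xs) → ∀ n →
            guess Ψ (F ↾ n) ∈ˡ guess Ψ [] ∷ map (λ n → guess Ψ (F ↾ suc n)) xs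
  visited F xs all zero = here refl
  visited F xs all (suc n) with guess Ψ (F ↾ suc n) ≟ guess Ψ (F ↾ n)
  ... | yes eq = subst (_∈ˡ guess Ψ [] ∷ map (λ n → guess Ψ (F ↾ suc n)) xs) (sym eq) (visited F xs all n)
  ... | no  ne = there (∈-map⁺ (λ n → guess Ψ (F ↾ suc n)) (all ne))

⟨<ω,1⟩-few : ∀ {Γ} → ⟨<ω,1⟩ Γ → FewGuesses Γ
⟨<ω,1⟩-few (b , cover) = record
  { bound  = b
  -- Without a learner, every admissible index counts as used on every oracle.
  ; Used   = λ _ e → e < b
  ; local  = λ e<b → 0 , λ _ _ → e<b
  ; covers = cover
  ; few    = λ _ _ → upTo b , ≤-reflexive (length-upTo b) , ∈-upTo⁺ }

-- A halting computation reads a finite part of `F` and can be replayed on any `F′` with the same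
-- part.
Φ-local : ∀ {e F h} → graph (Φ e) F h → ∀ n →
          ∃[ u ] ∀ {F′ h′} → (∀ a → a < u → F a ≡ F′ a) → graph (Φ e) F′ h′ → h n ≡ h′ n
Φ-local {e} {F} {h} (c , code≡ , c⇓) n with run-complete (c⇓ n)
... | u , k , halts = u , λ { {F′} {h′} agree (c′ , code′≡ , c′⇓) → agreeing F′ h′ agree
        (subst (λ c → F′ ⊢ c · n ⇓ h′ n) (encode-injective c′ c (trans code′≡ (sym code≡))) (c′⇓ n)) }
  where
  agreeing : ∀ F′ h′ → (∀ a → a < u → F a ≡ F′ a) → F′ ⊢ c · n ⇓ h′ n → h n ≡ h′ n
  agreeing F′ h′ agree p = run-unique {c = c} {n = k} p (λ a → inj₂ refl)
    (halts (suc ∘ F′) (λ a a<u → cong suc (sym (agree a a<u))) k ≤-refl)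

label-local : ∀ {e F h} → graph (Φ e) F h → ∀ m →
              ∃[ u ] ∀ {F′ h′} → (∀ a → a < u → F a ≡ F′ a) → graph (Φ e) F′ h′ → label h m ≡ label h′ m
label-local {e} {F} {h} φ m = let u , same = eventually-bounded {Same} m at in
  u , λ agree φ′ → count-cong m λ i i<m → same i i<m u ≤-refl agree φ′
  where
  Same : ℕ → ℕ → Set
  Same i u = ∀ {F′ h′} → (∀ a → a < u → F a ≡ F′ a) → graph (Φ e) F′ h′ → row 2 h i ≡ row 2 h′ i
  at : ∀ i → i < m → ∃[ u ] ∀ u′ → u ≤ u′ → Same i u′
  at i _ = let u , same = Φ-local φ (pr 2 i) in
    u , λ u′ u≤u′ agree φ′ → same (λ a a<u → agree a (<-≤-trans a<u u≤u′)) φ′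

⊕-< : ∀ {f f′} g {u} → (∀ a → a < u → f a ≡ f′ a) → ∀ a → a < u → (f ⊕ g) a ≡ (f′ ⊕ g) a
⊕-<′ : ∀ {g g′} f {u} → (∀ a → a < u → g a ≡ g′ a) → ∀ a → a < u → (f ⊕ g) a ≡ (f ⊕ g′) a
⊕-< g eq zero    a<u = eq 0 a<u
⊕-< g {suc u} eq (suc a) (s≤s a<u) = ⊕-<′ g (λ i i<u → eq (suc i) (s≤s i<u)) a a<u
⊕-<′ f eq zero    a<u = refl
⊕-<′ {g} {g′} f {suc u} eq (suc a) (s≤s a<u) = ⊕-< (f ∘ suc) {u} (λ i i<u → eq i (m<n⇒m<1+n i<u)) a a<u

⊕-≤ᵀ : ∀ {f g x} → f ≤ᵀ x → g ≤ᵀ x → f ⊕ g ≤ᵀ x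
⊕-≤ᵀ {f} {g} {x} (c , c⇓) (d , d⇓) = e , λ n → subst (x ⊢ e · n ⇓_) (sym (split {f} {g} n)) (cases n)
  where
  halfᶜ = comp (compile {1} (halfᴿ · (v0 ∷ []))) (pair idn zer)
  parityᶜ = comp (compile {1} (parityᴿ · (v0 ∷ []))) (pair idn zer)
  e = recᶜ (comp c halfᶜ) (comp (comp d halfᶜ) (comp right right)) parityᶜ
  cases : ∀ n → x ⊢ e · n ⇓ ifz (parity n) (f (half n)) (g (half n))
  cases n = recᶜ-cases⇓ (comp (tm⇓ (halfᴿ · (v0 ∷ [])) x n) (c⇓ (half n)))
                        (comp (tm⇓ (halfᴿ · (v0 ∷ [])) x n) (d⇓ (half n)))
                        (tm⇓ (parityᴿ · (v0 ∷ [])) x n)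
  split : ∀ {f g} n → (f ⊕ g) n ≡ ifz (parity n) (f (half n)) (g (half n))
  split zero          = refl
  split (suc zero)    = refl
  split {f} {g} (suc (suc n)) = split {f ∘ suc} {g ∘ suc} n

snd-≤ : ∀ a → snd a ≤ a
snd-≤ a = ≤-trans (≤-reflexive (snd-def a)) (≤-trans (m≤n+m (π₂ a) (π₁ a)) (sum≤ a))
  where
  sum≤ : ∀ a → π₁ a + π₂ a ≤ a
  sum≤ zero = z≤n
  sum≤ (suc a) with unpair a | sum≤ a
  ... | zero  , y | le = s≤s (≤-trans (≤-reflexive (+-identityʳ y)) le)
  ... | suc x , y | le = ≤-trans (≤-reflexive (+-suc x y)) (m≤n⇒m≤1+n le)

patch : Baire → ℕ → ℕ → ℕ → ℕ
patch x zero    i d = d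
patch x (suc l) i d = ifz (distance i l) (x l) (patch x l i d)

patch-< : ∀ x {l i d} → i < l → patch x l i d ≡ x i
patch-< x {suc l} {i} i<1+l with m≤n⇒m<n∨m≡n (s≤s⁻¹ i<1+l)
... | inj₁ i<l  = trans (distance-≢ (<⇒≢ i<l)) (patch-< x i<l)
... | inj₂ refl rewrite distance-refl i = refl

patch-≥ : ∀ x {l i d} → l ≤ i → patch x l i d ≡ d
patch-≥ x {zero}  l≤i = refl
patch-≥ x {suc l} l≤i = trans (distance-≢ (≢-sym (<⇒≢ l≤i))) (patch-≥ x (<⇒≤ l≤i))

-- The first `l` values of `x` become constants of the program, so finite pieces of incomputable
-- points may be used in `point-≤ᵀ`.
patchᵗ : ∀ {n} → Baire → ℕ → Tm n → Tm n → Tm n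
patchᵗ x zero    i d = d
patchᵗ x (suc l) i d = ifzᵗ ((i ∸ᵗ lit l) +ᵗ (lit l ∸ᵗ i)) (lit (x l)) (patchᵗ x l i d)

⟦patchᵗ⟧ : ∀ {n} x l (i d : Tm n) o ρ → ⟦ patchᵗ x l i d ⟧ o ρ ≡ patch x l (⟦ i ⟧ o ρ) (⟦ d ⟧ o ρ)
⟦patchᵗ⟧ x zero    i d o ρ = refl
⟦patchᵗ⟧ x (suc l) i d o ρ = cong (ifz (distance (⟦ i ⟧ o ρ) l) (x l)) (⟦patchᵗ⟧ x l i d o ρ)

count-const : ∀ {t l} n → (∀ i → l ≤ i → t i ≡ 0) → l ≤ n → count t n ≡ count t l
count-const n zeros l≤n with m≤n⇒m<n∨m≡n l≤n
... | inj₂ refl = refl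
count-const {t} (suc n) zeros l≤n | inj₁ l<1+n =
  trans (cong (count t n +_) (zeros n (s≤s⁻¹ l<1+n))) (trans (+-identityʳ _) (count-const {t} n zeros (s≤s⁻¹ l<1+n)))

-- The member of q with row a = 0^m 1 and k marks below l.  Its rows z, t and y
-- are given by finite tables, continued by zeros and by a member of X (ix m k).
module _ (m k l : ℕ) (t y z : Baire) where
  opaque
    point : Baire → Baire
    -- Row 1 is inspected only as long as row 0 shows no 1, so `m` digits of `z` suffice and no full
    -- member of `X iz` is stored.
    point x a = select (fst a) (ifz (distance (snd a) m) 1 0) (patch z m (snd a) 0) (patch t l (snd a) 0) (only (iw m) x (snd a))
      (patch y l (snd a) (only (ix m k) x (snd a ∸ l))) 0

    point-row₀ : ∀ x i → row 0 (point x) i ≡ ifz (distance i m) 1 0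
    point-row₀ x i rewrite fst-pr 0 i | snd-pr 0 i = refl
    point-row₁ : ∀ x i → row 1 (point x) i ≡ patch z m i 0
    point-row₁ x i rewrite fst-pr 1 i | snd-pr 1 i = refl
    point-row₂ : ∀ x i → row 2 (point x) i ≡ patch t l i 0
    point-row₂ x i rewrite fst-pr 2 i | snd-pr 2 i = refl
    point-row₃ : ∀ x i → row 3 (point x) i ≡ only (iw m) x i
    point-row₃ x i rewrite fst-pr 3 i | snd-pr 3 i = refl
    point-row₄ : ∀ x i → row 4 (point x) i ≡ patch y l i (only (ix m k) x (i ∸ l))
    point-row₄ x i rewrite fst-pr 4 i | snd-pr 4 i = refl

    point-≤ᵀ : ∀ {j} x → iw m ≢ j → ix m k ≢ j → point x ≤ᵀ mask j x
    point-≤ᵀ {j} x w≢ x≢ = tm-≤ᵀ pointᵗ λ a → trans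
      (cong₂ (λ b c → select (fst a) (ifz (distance (snd a) m) 1 0) b c (only (iw m) (mask j x) (snd a)) _ 0)
        (⟦patchᵗ⟧ z m (sndᵗ v0) (lit 0) (mask j x) (a , tt)) (⟦patchᵗ⟧ t l (sndᵗ v0) (lit 0) (mask j x) (a , tt)))
      (cong₂ (λ d e → select (fst a) (ifz (distance (snd a) m) 1 0) (patch z m (snd a) 0) (patch t l (snd a) 0) d e 0)
        (only-mask x w≢ (snd a))
        (trans (⟦patchᵗ⟧ y l (sndᵗ v0) (app (onlyᵗ (ix m k)) (sndᵗ v0 ∸ᵗ lit l ∷ [])) (mask j x) (a , tt))
               (cong (patch y l (snd a)) (only-mask x x≢ (snd a ∸ l)))))
      where
      pointᵗ : Tm 1
      pointᵗ = selectᵗ (fstᵗ v0) (ifzᵗ ((sndᵗ v0 ∸ᵗ lit m) +ᵗ (lit m ∸ᵗ sndᵗ v0)) (lit 1) (lit 0)) (patchᵗ z m (sndᵗ v0) (lit 0))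
        (patchᵗ t l (sndᵗ v0) (lit 0)) (app (onlyᵗ (iw m)) (sndᵗ v0 ∷ []))
        (patchᵗ y l (sndᵗ v0) (app (onlyᵗ (ix m k)) (sndᵗ v0 ∸ᵗ lit l ∷ []))) (lit 0)

patch<2 : ∀ {x} l i {d} → 2^ℕ x → d < 2 → patch x l i d < 2
patch<2 zero    i x<2 d<2 = d<2
patch<2 (suc l) i x<2 d<2 = ifz-< (distance i l) (x<2 l) (patch<2 l i x<2 d<2)

only<2 : ∀ {i x} → 2^ℕ x → 2^ℕ (only i x)
only<2 {i} x<2 a = ifz-< (distance (class (level a)) i) (x<2 a) (s≤s z≤n)

opaque
  unfolding point

  point<2 : ∀ {m k l t y z x} → 2^ℕ t → 2^ℕ y → 2^ℕ z → 2^ℕ x → 2^ℕ (point m k l t y z x)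
  point<2 {m} {k} {l} {t} {y} {z} t<2 y<2 z<2 x<2 a =
    select-< (fst a) (ifz-< (distance (snd a) m) (s≤s (s≤s z≤n)) (s≤s z≤n)) (patch<2 {z} m (snd a) z<2 (s≤s z≤n))
      (patch<2 {t} l (snd a) t<2 (s≤s z≤n)) (only<2 {iw m} x<2 _) (patch<2 {y} l (snd a) y<2 (only<2 {ix m k} x<2 _)) (s≤s z≤n)

  point-agree : ∀ {m z x u} k l t y k′ l′ t′ y′ →
    (∀ i → i < u → patch t l i 0 ≡ patch t′ l′ i 0) →
    (∀ i → i < u → patch y l i (only (ix m k) x (i ∸ l)) ≡ patch y′ l′ i (only (ix m k′) x (i ∸ l′))) →
    ∀ a → a < u → point m k l t y z x a ≡ point m k′ l′ t′ y′ z x a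
  point-agree {m} {z} {x} k l t y k′ l′ t′ y′ eqᵗ eqʸ a a<u =
    cong₂ (λ b c → select (fst a) (ifz (distance (snd a) m) 1 0) (patch z m (snd a) 0) b (only (iw m) x (snd a)) c 0)
      (eqᵗ _ (≤-<-trans (snd-≤ a) a<u)) (eqʸ _ (≤-<-trans (snd-≤ a) a<u))

iw≢ix : ∀ {m m′ k} → iw m ≢ ix m′ k
iw≢ix {m} {m′} {k} eq = case trans (sym (fst-pr 1 m)) (trans (cong fst eq) (fst-pr 2 (pr m′ k))) of λ ()

iw≢iy : ∀ {m b} → iw m ≢ iy b
iw≢iy {m} {b} eq = case trans (sym (fst-pr 1 m)) (trans (cong fst eq) (fst-pr 3 b)) of λ ()

ix≢iy : ∀ {m k b} → ix m k ≢ iy b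
ix≢iy {m} {k} {b} eq = case trans (sym (fst-pr 2 (pr m k))) (trans (cong fst eq) (fst-pr 3 b)) of λ ()

iw≢iz : ∀ {m} → iw m ≢ iz
iw≢iz {m} eq = case trans (sym (fst-pr 1 m)) (trans (cong fst eq) (fst-pr 0 0)) of λ ()

ix≢iz : ∀ {m k} → ix m k ≢ iz
ix≢iz {m} {k} eq = case trans (sym (fst-pr 2 (pr m k))) (trans (cong fst eq) (fst-pr 0 0)) of λ ()

iy≢iz : ∀ {b} → iy b ≢ iz
iy≢iz {b} eq = case trans (sym (fst-pr 3 b)) (trans (cong fst eq) (fst-pr 0 0)) of λ ()

iw-injective : ∀ {m m′} → iw m ≡ iw m′ → m ≡ m′
iw-injective {m} {m′} eq = trans (sym (snd-pr 1 m)) (trans (cong snd eq) (snd-pr 1 m′))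

iy-injective : ∀ {b b′} → iy b ≡ iy b′ → b ≡ b′
iy-injective {b} {b′} eq = trans (sym (snd-pr 3 b)) (trans (cong snd eq) (snd-pr 3 b′))

ix-injective : ∀ {m k k′} → ix m k ≡ ix m k′ → k ≡ k′
ix-injective {m} {k} {k′} eq = trans (sym (snd-pr m k)) (trans (cong snd (trans (sym (snd-pr 2 _)) (trans (cong snd eq) (snd-pr 2 _)))) (snd-pr m k′))

row-≤ᵀ : ∀ c h → row c h ≤ᵀ h
row-≤ᵀ c h = tm-≤ᵀ (orc (prᵗ (lit c) v0)) (λ _ → refl)

only-≤ᵀ : ∀ {i j} x → i ≢ j → only i x ≤ᵀ mask j x
only-≤ᵀ {i} {j} x i≢j = tm-≤ᵀ (onlyᵗ i) (only-mask x i≢j)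

count-≤ : ∀ {t} n → 2^ℕ t → count t n ≤ n
count-≤ zero    t<2 = z≤n
count-≤ {t} (suc n) t<2 = ≤-trans (+-mono-≤ (count-≤ {t} n t<2) (s≤s⁻¹ (t<2 n))) (≤-reflexive (+-comm n 1))

-- Forcing more programs than the bound permits.

module Lower (dec : ∀ {P : Set} → Dec P) {Γ : PartialFunction} (guesses : FewGuesses Γ) {r : Subset}
             (reduces : ∀ F → F ∈ q ⊗ r → dom Γ F × (∀ h → graph Γ F h → h ∈ p)) where
  open Independence dec
  open FewGuesses guesses

  m b : ℕ
  m = bound
  b = suc m

  module _ {h₀ : Baire} (h₀∈r : h₀ ∈ r) (h₀≤ : h₀ ≤ᵀ only (iy b) G) where

    module At (k l : ℕ) (t y : Baire) where
      T Y f F : Baire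
      T i = patch t l i 0
      Y i = patch y l i (only (ix m k) G (i ∸ l))
      f   = point m k l t y (only iz G) G
      F   = f ⊕ h₀

      f≤ᵀ : ∀ {j} → iw m ≢ j → ix m k ≢ j → f ≤ᵀ mask j G
      f≤ᵀ = point-≤ᵀ m k l t y (only iz G) G

      F≤ᵀ : ∀ {j} → iw m ≢ j → ix m k ≢ j → iy b ≢ j → F ≤ᵀ mask j G
      F≤ᵀ w≢ x≢ y≢ = ⊕-≤ᵀ (f≤ᵀ w≢ x≢) (≤ᵀ-trans h₀≤ (only-≤ᵀ G y≢))

      -- A member of p computed from F = f ⊕ h₀ has label k, as F computes no
      -- member of X j for j other than iw m, ix m k and iy b.
      label≡k : ∀ {h} → h ∈ p → h ≤ᵀ F → label h m ≡ k
      label≡k {h} h∈p h≤F = cases dec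
        where
        h<2 : 2^ℕ h
        h<2 = proj₁ h∈p
        impossible : ∀ {j} → iw m ≢ j → ix m k ≢ j → iy b ≢ j → ∀ c → ¬ (∀ n → Θ j (row c h) n)
        impossible {j} w≢ x≢ y≢ c θ =
          independent j (≤ᵀ-trans (row-≤ᵀ c h) (≤ᵀ-trans h≤F (F≤ᵀ w≢ x≢ y≢))) ((λ n → h<2 (pr c n)) , θ)
        positive : ∀ n {m′} → first (row 0 h) n ≡ suc m′ → ∀ n′ → Θ (iw m′) (row 3 h) n′ × Θ (kind h m′) (row 4 h) n′
        positive n eq n′ = subst (λ r → Θ (iw (pred r)) (row 3 h) n′ × Θ (kind h (pred r)) (row 4 h) n′) eq
          (proj₂ (p-elim h∈p n n′) λ z → case trans (sym eq) z of λ ())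
        kinds : ∀ d → h (pr 5 0) ≡ d → (∀ n′ → Θ (ifz d (ix m (label h m)) (iy (label h m))) (row 4 h) n′) → label h m ≡ k
        kinds zero eq θ with label h m ≟ k
        ... | yes label≡ = label≡
        ... | no  label≢ = contradiction θ
          (impossible iw≢ix (λ e → label≢ (sym (ix-injective e))) (λ e → ix≢iy (sym e)) 4)
        -- The label is at most `m < b`, so row 4 would be in a class `X (iy k)` with `k ≢ b`, of
        -- which `F` computes no member.
        kinds (suc d) eq θ = contradiction θ
          (impossible iw≢iy ix≢iy (λ e → <⇒≢ (s≤s (count-≤ {row 2 h} m λ i → h<2 (pr 2 i))) (sym (iy-injective e))) 4)
        found : ∀ n {m′} → Dec (m′ ≡ m) → first (row 0 h) n ≡ suc m′ → label h m ≡ k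
        found n (yes refl) eq = kinds (h (pr 5 0)) refl (λ n′ → proj₂ (positive n eq n′))
        -- A wrong `m′` is refuted by row 3, which would have to be in `X (iw m′)`.
        found n (no  m′≢m) eq = contradiction (λ n′ → proj₁ (positive n eq n′))
          (impossible (λ e → m′≢m (sym (iw-injective e))) (λ e → iw≢ix (sym e)) (λ e → iw≢iy (sym e)) 3)
        some : ∀ n d → first (row 0 h) n ≡ d → d ≢ 0 → label h m ≡ k
        some n zero     eq nz = contradiction refl nz
        some n (suc m′) eq nz = found n (m′ ≟ m) eq
        cases : Dec (∃[ n ] first (row 0 h) n ≢ 0) → label h m ≡ k
        cases (yes (n , nz)) = some n (first (row 0 h) n) refl nz
        cases (no  none) = contradiction
          (λ n → proj₁ (p-elim h∈p n 0) (case first (row 0 h) n ≟ 0 of λ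
            { (yes z) → z ; (no nz) → contradiction (n , nz) none }))
          (impossible iw≢iz ix≢iz iy≢iz 1)

    -- k programs used on every oracle that agrees with F below u, which
    -- produce members of p with the labels 0, …, k - 1 only.
    record History (k : ℕ) (F : Baire) (u : ℕ) : Set where
      field
        es       : ℕ → ℕ
        distinct : ∀ {i j} → i < k → j < k → es i ≡ es j → i ≡ j
        used     : ∀ i → i < k → ∀ F′ → (∀ a → a < u → F a ≡ F′ a) → Used F′ (es i)
        labels   : ∀ i → i < k → ∀ {F′ h} → (∀ a → a < u → F a ≡ F′ a) → graph (Φ (es i)) F′ h → label h m ≡ i

    record State (k : ℕ) : Set where
      field
        l       : ℕ
        t y     : Baire
        t<2     : 2^ℕ t
        y<2     : 2^ℕ y
      open At k l t y public
      field
        marks   : count T l ≡ k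
        end     : last T l ≡ l
        valid   : ∀ n → Θ (ix m (count T n)) (λ i → Y (last T n + i)) (n ∸ last T n)
        history : History k F l

      T-end : ∀ i → l ≤ i → T i ≡ 0
      T-end i = patch-≥ t

      T<2 : 2^ℕ T
      T<2 i = patch<2 l i t<2 (s≤s z≤n)

      count≤k : ∀ n → count T n ≤ k
      count≤k n = ≤-trans (count-mono {T} (λ _ → ≤-refl) (m≤m⊔n n l))
        (≤-reflexive (trans (count-const {T} (n ⊔ l) T-end (m≤n⊔m n l)) marks))

      f∈q : k ≤ m → f ∈ q
      f∈q k≤m = q-intro (point<2 t<2 y<2 (only<2 {iz} G<2) G<2) λ n n′ →
        (λ z → Θ-local (λ i i<n → sym (trans (point-row₁ m k l t y (only iz G) G i) (patch-< (only iz G)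
            (<-≤-trans i<n (≮⇒≥ λ m<n → case trans (sym z) (trans (first-cong n λ i _ → point-row₀ m k l t y (only iz G) G i) (first-indicator {m} {n} m<n)) of λ ())))))
          (proj₂ (generic iz) n)) ,
        found n n′ _ refl
        where
        t-row : ∀ i → row 2 f i ≡ T i
        t-row = point-row₂ m k l t y (only iz G) G
        found : ∀ n n′ d → first (row 0 f) n ≡ d → ¬ d ≡ 0 →
                Θ (iw (pred d)) (row 3 f) n′ × count (row 2 f) n′ ≤ pred d ×
                Θ (ix (pred d) (count (row 2 f) n′)) (λ i → f (pr 4 (last (row 2 f) n′ + i))) (n′ ∸ last (row 2 f) n′)
        found n n′ zero    eq nz = contradiction refl nz
        found n n′ (suc d) eq nz with first-unique {λ i → ifz (distance i m) 1 0} {n} {suc m}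
          (trans (sym (first-cong n λ i _ → point-row₀ m k l t y (only iz G) G i)) eq) (first-indicator {m} {suc m} ≤-refl)
        ... | refl =
          Θ-local (λ i _ → sym (point-row₃ m k l t y (only iz G) G i)) (proj₂ (generic (iw m)) n′) ,
          ≤-trans (≤-reflexive (count-cong n′ λ i _ → t-row i)) (≤-trans (count≤k n′) k≤m) ,
          subst₂ (λ c e → Θ (ix m c) (λ i → f (pr 4 (e + i))) (n′ ∸ e))
            (count-cong n′ λ i _ → sym (t-row i)) (last-cong n′ λ i _ → sym (t-row i))
            (Θ-local (λ i _ → sym (point-row₄ m k l t y (only iz G) G (last T n′ + i))) (valid n′))

      -- On `F` the reduction uses a program whose output has label `k`; it is new, as the earlier
      -- programs have smaller labels. Taking `u` beyond the use of both facts makes them persist.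
      extended : k ≤ m → ∃[ u ] l ≤ u × History (suc k) F u
      extended k≤m = u , ≤-trans (m≤m⊔n l u₁) (m≤m⊔n (l ⊔ u₁) u₂) , record
        { es       = es′
        ; distinct = λ {i} {j} i< j< eq → distinct′ (i ≟ k) (j ≟ k) i< j< eq
        ; used     = λ i i< F′ agree → used′ (i ≟ k) i< F′ agree
        ; labels   = λ i i< agree φ → labels′ (i ≟ k) i< agree φ }
        where
        open History history
        F∈ : F ∈ q ⊗ r
        F∈ = f , h₀ , f∈q k≤m , h₀∈r , λ _ → refl
        h = proj₁ (proj₁ (reduces F F∈))
        h-graph = proj₂ (proj₁ (reduces F F∈))
        h∈p : h ∈ p
        h∈p = proj₂ (reduces F F∈) h h-graph
        e = proj₁ (covers h-graph)
        e-used = proj₁ (proj₂ (covers h-graph))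
        φ = proj₂ (proj₂ (covers h-graph))
        label-h : label h m ≡ k
        label-h = label≡k h∈p (Φ⇒≤ᵀ φ)
        u₁ = proj₁ (local e-used)
        u₂ = proj₁ (label-local φ m)
        u = l ⊔ u₁ ⊔ u₂
        choose : ∀ {i} → Dec (i ≡ k) → ℕ
        choose {i} (yes _) = e
        choose {i} (no  _) = es i
        es′ : ℕ → ℕ
        es′ i = choose (i ≟ k)
        old : ∀ {i} → i < suc k → i ≢ k → i < k
        old i<1+k i≢k = ≤∧≢⇒< (s≤s⁻¹ i<1+k) i≢k
        new : ∀ {i} → i < k → es i ≢ e
        new {i} i<k eq = <⇒≢ i<k (trans (sym (labels i i<k (λ _ _ → refl) (subst (λ e → graph (Φ e) F h) (sym eq) φ))) label-h)
        distinct′ : ∀ {i j} (i? : Dec (i ≡ k)) (j? : Dec (j ≡ k)) → i < suc k → j < suc k → choose i? ≡ choose j? → i ≡ j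
        distinct′ (yes refl) (yes refl) i< j< eq = refl
        distinct′ (yes refl) (no  j≢k)  i< j< eq = contradiction (sym eq) (new (old j< j≢k))
        distinct′ (no  i≢k)  (yes refl) i< j< eq = contradiction eq (new (old i< i≢k))
        distinct′ (no  i≢k)  (no  j≢k)  i< j< eq = distinct (old i< i≢k) (old j< j≢k) eq
        used′ : ∀ {i} (i? : Dec (i ≡ k)) → i < suc k → ∀ F′ → (∀ a → a < u → F a ≡ F′ a) → Used F′ (choose i?)
        used′ (yes _) i< F′ agree = proj₂ (local e-used) F′ λ a a< →
          agree a (<-≤-trans a< (≤-trans (m≤n⊔m l u₁) (m≤m⊔n (l ⊔ u₁) u₂)))
        used′ {i} (no i≢k) i< F′ agree = used i (old i< i≢k) F′ λ a a< →
          agree a (<-≤-trans a< (≤-trans (m≤m⊔n l u₁) (m≤m⊔n (l ⊔ u₁) u₂)))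
        labels′ : ∀ {i} (i? : Dec (i ≡ k)) → i < suc k → ∀ {F′ h′} → (∀ a → a < u → F a ≡ F′ a) →
                  graph (Φ (choose i?)) F′ h′ → label h′ m ≡ i
        labels′ (yes refl) i< agree φ′ =
          trans (sym (proj₂ (label-local φ m) (λ a a< → agree a (<-≤-trans a< (m≤n⊔m (l ⊔ u₁) u₂))) φ′)) label-h
        labels′ {i} (no i≢k) i< agree φ′ = labels i (old i< i≢k) (λ a a< →
          agree a (<-≤-trans a< (≤-trans (m≤m⊔n l u₁) (m≤m⊔n (l ⊔ u₁) u₂)))) φ′

      -- A mark at `u` voids the digits of row `y` up to there and calls for the class of `suc k`.
      -- Nothing changes below `u`, so the history survives.
      successor : ∀ u → l ≤ u → History (suc k) F u → State (suc k)
      successor u l≤u hist = record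
        { l = suc u ; t = t′ ; y = Y
        ; t<2 = λ i → ifz-< (distance i u) (s≤s (s≤s z≤n)) (T<2 i)
        ; y<2 = λ i → patch<2 l i y<2 (only<2 {ix m k} G<2 (i ∸ l))
        ; marks = marks′
        ; end = end′
        ; valid = λ n → case n ≤? u of λ
          { (yes n≤u) → subst₂ (λ c e → Θ (ix m c) (λ i → Y′ (e + i)) (n ∸ e))
              (count-cong n λ i i<n → sym (T′-< i (<-≤-trans i<n n≤u))) (last-cong n λ i i<n → sym (T′-< i (<-≤-trans i<n n≤u)))
              (Θ-local (λ i i< → sym (Y′-< _ (inside n i n≤u i<))) (valid n))
          ; (no n≰u) → subst₂ (λ c e → Θ (ix m c) (λ i → Y′ (e + i)) (n ∸ e))
              (sym (trans (count-const {T′} n T′-end (≰⇒> n≰u)) marks′))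
              (sym (trans (last-stable {T′} n (≰⇒> n≰u) (count-const {T′} n T′-end (≰⇒> n≰u))) end′))
              (Θ-local (λ i _ → sym (trans (patch-≥ Y (m≤m+n (suc u) i)) (cong (only (ix m (suc k)) G) (m+n∸m≡n (suc u) i))))
                (proj₂ (generic (ix m (suc k))) (n ∸ suc u))) }
        ; history = record
          { es       = es
          ; distinct = distinct
          ; used     = λ i i< F″ agree → used i i< F″ (λ a a<u → trans (F≡F′ a a<u) (agree a (m<n⇒m<1+n a<u)))
          ; labels   = λ i i< agree → labels i i< (λ a a<u → trans (F≡F′ a a<u) (agree a (m<n⇒m<1+n a<u))) } }
        where
        open History hist
        t′ : Baire
        t′ i = ifz (distance i u) 1 (T i)
        open At (suc k) (suc u) t′ Y using () renaming (T to T′; Y to Y′; f to f′; F to F′)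
        T′-< : ∀ i → i < u → T′ i ≡ T i
        T′-< i i<u = trans (patch-< t′ (m<n⇒m<1+n i<u)) (distance-≢ (<⇒≢ i<u))
        T′-u : T′ u ≡ 1
        T′-u = trans (patch-< t′ {suc u} ≤-refl) (cong (λ d → ifz d 1 (T u)) (distance-refl u))
        T′-end : ∀ i → suc u ≤ i → T′ i ≡ 0
        T′-end i = patch-≥ t′
        Y′-< : ∀ i → i < suc u → Y′ i ≡ Y i
        Y′-< i = patch-< Y
        marks′ : count T′ (suc u) ≡ suc k
        marks′ = trans (cong₂ _+_ (trans (count-cong u T′-<) (trans (count-const {T} u T-end l≤u) marks)) T′-u) (+-comm k 1)
        end′ : last T′ (suc u) ≡ suc u
        end′ = cong (λ d → ifz d (last T′ u) (suc u)) T′-u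
        inside : ∀ n i → n ≤ u → i < n ∸ last T n → last T n + i < suc u
        inside n i n≤u i< = m<n⇒m<1+n (<-≤-trans (+-monoʳ-< (last T n) i<)
          (≤-trans (≤-reflexive (m+[n∸m]≡n (last-≤ T n))) n≤u))
        F≡F′ : ∀ a → a < u → F a ≡ F′ a
        F≡F′ = ⊕-< h₀ {u} (point-agree {m} {only iz G} {G} k l t y (suc k) (suc u) t′ Y (λ i i<u → sym (T′-< i i<u))
          (λ i i<u → sym (Y′-< i (m<n⇒m<1+n i<u))))

    initial : State 0
    initial = record
      { l = 0 ; t = λ _ → 0 ; y = λ _ → 0 ; t<2 = λ _ → s≤s z≤n ; y<2 = λ _ → s≤s z≤n
      ; marks = refl ; end = refl
      ; valid = λ n → subst₂ (λ c e → Θ (ix m c) (λ i → only (ix m 0) G (e + i)) (n ∸ e))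
          (sym (count-const {λ _ → 0} n (λ _ _ → refl) z≤n))
          (sym (last-stable {λ _ → 0} n z≤n (count-const {λ _ → 0} n (λ _ _ → refl) z≤n)))
          (proj₂ (generic (ix m 0)) n)
      ; history = record { es = λ _ → 0 ; distinct = λ () ; used = λ _ () ; labels = λ _ () } }

    state : ∀ k → k ≤ m → State k
    state zero    _   = initial
    state (suc k) k<m = extend-state (state k (<⇒≤ k<m))
      where
      extend-state : State k → State (suc k)
      extend-state S = let u , l≤u , hist = State.extended S (<⇒≤ k<m) in State.successor S u l≤u hist

    too-many : ∀ {F u} → dom Γ F → ¬ History (suc m) F u
    too-many {F} F∈dom hist = <⇒≱ ≤-refl (≤-trans (injective⇒≤ injective) (proj₁ (proj₂ finite)))
      where
      open History hist
      finite = few F F∈dom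
      es∈ : ∀ (i : Fin (suc m)) → es (toℕ i) ∈ˡ proj₁ finite
      es∈ i = proj₂ (proj₂ finite) (used (toℕ i) (toℕ<n i) F (λ _ _ → refl))
      injective : ∀ {i j} → position (es∈ i) ≡ position (es∈ j) → i ≡ j
      injective {i} {j} eq = toℕ-injective (distinct (toℕ<n i) (toℕ<n j)
        (trans (lookup-index (es∈ i)) (trans (cong (lookupˡ (proj₁ finite)) eq) (sym (lookup-index (es∈ j))))))

    absurd : ⊥
    absurd = finish (state m ≤-refl)
      where
      finish : State m → ⊥
      -- At `k = m` one more program is forced without a further mark, so the labels `0, …, m`
      -- require `m + 1` programs.
      finish S = let _ , _ , hist = State.extended S ≤-refl in
        too-many (proj₁ (reduces (State.F S) (State.f S , h₀ , State.f∈q S ≤-refl , h₀∈r , λ _ → refl))) hist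

module NotBrouwerian (dec : ∀ {P : Set} → Dec P) where
  open Independence dec

  s-member : ∀ b → only (iy b) G ∈ s b
  s-member b = s-intro {b} (generic (iy b))

  -- With row 0 constantly 0, this point shows that `p` and `q` are nonempty, as `𝒫` demands.
  zPoint : Baire
  zPoint a = ifz (distance (fst a) 1) (only iz G (snd a)) 0

  zPoint<2 : 2^ℕ zPoint
  zPoint<2 a = ifz-< (distance (fst a) 1) (proj₁ (generic iz) (snd a)) (s≤s z≤n)

  zPoint-first : ∀ n → first (row 0 zPoint) n ≡ 0
  zPoint-first n = first-none n λ i _ → cong (λ c → ifz (distance c 1) (only iz G (snd (pr 0 i))) 0) (fst-pr 0 i)

  zPoint-row₁ : ∀ i → only iz G i ≡ row 1 zPoint i
  zPoint-row₁ i = sym (cong₂ (λ c j → ifz (distance c 1) (only iz G j) 0) (fst-pr 1 i) (snd-pr 1 i))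

  zPoint-valid : ∀ n → Θ iz (row 1 zPoint) n
  zPoint-valid n = Θ-local (λ i _ → zPoint-row₁ i) (proj₂ (generic iz) n)

  zPoint∈p : zPoint ∈ p
  zPoint∈p = p-intro zPoint<2 λ n n′ → (λ _ → zPoint-valid n) , λ nz → contradiction (zPoint-first n) nz

  zPoint∈q : zPoint ∈ q
  zPoint∈q = q-intro zPoint<2 λ n n′ → (λ _ → zPoint-valid n) , λ nz → contradiction (zPoint-first n) nz

  module _ {N : Notion} (N-few : ∀ {Γ} → N Γ → FewGuesses Γ) (N-Γ : ∀ b → N (Reduction.Γ dec b)) where

    module _ {r : Subset} {Γ : PartialFunction} (few : FewGuesses Γ) (p≤ : ∀ F → F ∈ q ⊗ r → dom Γ F × (∀ h → graph Γ F h → h ∈ p)) where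
      open FewGuesses few using (bound)

      unreachable : ¬ Reducible N r (s (suc bound))
      unreachable (Λ , NΛ , r≤) = Lower.absurd dec few {r} p≤ {h₀} (proj₂ (r≤ g g∈s) h₀ h₀-graph) h₀≤g
        where
        g = only (iy (suc bound)) G
        g∈s = s-member (suc bound)
        h₀ = proj₁ (proj₁ (r≤ g g∈s))
        h₀-graph : graph Λ g h₀
        h₀-graph = proj₂ (proj₁ (r≤ g g∈s))
        -- Under each of the notions a single value of `Λ` is computed by one program.
        h₀≤g : h₀ ≤ᵀ g
        h₀≤g = Φ⇒≤ᵀ (proj₂ (proj₂ (FewGuesses.covers (N-few NΛ) h₀-graph)))

    -- The bound of the reduction to `q ⊗ r` is known before `b` is chosen, and leastness has to
    -- hold for that `b` as well.
    no-least : ∀ r → Reducible N p (q ⊗ r) → ¬ (∀ b → Reducible N p (q ⊗ s b) → Reducible N r (s b))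
    no-least r (Γ , NΓ , p≤) least = unreachable {r} {Γ} (N-few NΓ) p≤ (least b (Reduction.reduces dec b {N} (N-Γ b)))
      where b = suc (FewGuesses.bound (N-few NΓ))

    ¬𝒟-brouwerian : ¬ Brouwerian (𝒟 N)
    ¬𝒟-brouwerian brouwer =
      let r , _ , p≤ , least = brouwer p q tt tt in no-least r p≤ (λ b → least (s b) tt)

    ¬𝒫-brouwerian : ¬ Brouwerian (𝒫 N)
    ¬𝒫-brouwerian brouwer =
      let r , _ , p≤ , least = brouwer p q ((zPoint , zPoint∈p) , p-Π⁰₁) ((zPoint , zPoint∈q) , q-Π⁰₁) in
      no-least r p≤ (λ b → least (s b) ((only (iy b) G , s-member b) , s-Π⁰₁ b))

theorem82 : (∀ ℓ → ExcludedMiddle ℓ) →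
    ¬ Brouwerian (𝒟 ⟨1,<ω⟩) ×
    ¬ Brouwerian (𝒟 ⟨1,ω|<ω⟩) ×
    ¬ Brouwerian (𝒟 ⟨<ω,1⟩) ×
    ¬ Brouwerian (𝒫 ⟨1,<ω⟩) ×
    ¬ Brouwerian (𝒫 ⟨1,ω|<ω⟩) ×
    ¬ Brouwerian (𝒫 ⟨<ω,1⟩)
theorem82 em =
  ¬𝒟-brouwerian ⟨1,<ω⟩-few (Reduction.Γ-⟨1,<ω⟩ dec) ,
  ¬𝒟-brouwerian ⟨1,ω|<ω⟩-few (Reduction.Γ-⟨1,ω|<ω⟩ dec) ,
  ¬𝒟-brouwerian ⟨<ω,1⟩-few (Reduction.finitelyMany dec) ,
  ¬𝒫-brouwerian ⟨1,<ω⟩-few (Reduction.Γ-⟨1,<ω⟩ dec) ,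
  ¬𝒫-brouwerian ⟨1,ω|<ω⟩-few (Reduction.Γ-⟨1,ω|<ω⟩ dec) ,
  ¬𝒫-brouwerian ⟨<ω,1⟩-few (Reduction.finitelyMany dec)
  where
  dec : ∀ {P : Set} → Dec P
  dec = em 0ℓ
  open NotBrouwerian dec
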